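{- Let $d(m)$ denote the number of positive divisors of a positive integer $m$. Then $$\sum_{2 \leq n \leq N} d(n^2-1) \sim \frac{6}{\pi^2} N \log^2 N$$ as $N \rightarrow \infty$, where the sum runs over integers $n$ with $2 \le n \le N$; that is, the ratio of the two sides tends to $1$ as $N \to \infty$.
   Context: Here $\log^2 N = (\log N)^2$, with $\log$ the natural logarithm. -}

module Defs where

open import Data.Integer using (+[1+_]; -[1+_])
import Data.Integer as ℤ
import Data.Integer.Properties as ℤP
open import Data.List using (filter; length; map; upTo)
open import Data.Nat using (ℕ; zero; suc)
import Data.Nat as ℕ
open import Data.Nat.ListAction using (sum)
import Data.Nat.Properties as ℕP
open import Data.Nat.Divisibility using (_∣?_)
open import Data.Product using (Σ; ∃; _×_; _,_; proj₁; proj₂)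
open import Data.Rational
open import Data.Rational.Properties
open import Data.Rational.Solver using (module +-*-Solver)
open import Data.Rational.Unnormalised using (mkℚᵘ)
import Data.Rational.Unnormalised as ℚᵘ
import Data.Rational.Unnormalised.Properties as ℚᵘP
open import Data.Sum using (inj₁; inj₂)
open import Relation.Binary.PropositionalEquality
  using (_≡_; _≢_; refl; sym; trans; cong; cong₂; subst; subst₂)

open +-*-Solver using (solve; con; _:=_; _:+_; _:*_; _:-_; :-_)

d : ℕ → ℕ
d m = length (filter (_∣? m) (map suc (upTo m)))

-- Σ_{2 ≤ n ≤ N} f n; note that upTo (suc N) is 0, 1, …, N.
sum₂ : ℕ → (ℕ → ℕ) → ℕ
sum₂ N f = sum (map f (filter (2 ℕ.≤?_) (upTo (suc N))))

ℕ→ℚ : ℕ → ℚ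
ℕ→ℚ n = ℤ.+ n / 1

-- Total reciprocal, with the junk value 0 at 0.
inv : ℚ → ℚ
inv p@(mkℚ (ℤ.+ zero) _ _) = 0ℚ
inv p@(mkℚ +[1+ _ ] _ _) = 1/ p
inv p@(mkℚ -[1+ _ ] _ _) = 1/ p

p*inv[p]≡1 : ∀ p → .{{NonZero p}} → p * inv p ≡ 1ℚ
p*inv[p]≡1 p@(mkℚ +[1+ _ ] _ _) = *-inverseʳ p
p*inv[p]≡1 p@(mkℚ -[1+ _ ] _ _) = *-inverseʳ p

0<1 : 0ℚ < 1ℚ
0<1 = positive⁻¹ 1ℚ

*-mono-≤-≤ : ∀ {a b c e} → 0ℚ ≤ a → a ≤ b → 0ℚ ≤ c → c ≤ e → a * c ≤ b * e
*-mono-≤-≤ {a} {b} {c} {e} 0≤a a≤b 0≤c c≤e =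
  ≤-trans (*-monoˡ-≤-nonNeg a {{nonNegative 0≤a}} c≤e)
          (*-monoʳ-≤-nonNeg e {{nonNegative (≤-trans 0≤c c≤e)}} a≤b)

*-mono-≤-< : ∀ {a b c e} → a ≤ b → 0ℚ < b → 0ℚ ≤ c → c < e → a * c < b * e
*-mono-≤-< {a} {b} {c} {e} a≤b 0<b 0≤c c<e =
  ≤-<-trans (*-monoʳ-≤-nonNeg c {{nonNegative 0≤c}} a≤b)
            (*-monoʳ-<-pos b {{positive 0<b}} c<e)

0≤* : ∀ {a b} → 0ℚ ≤ a → 0ℚ ≤ b → 0ℚ ≤ a * b
0≤* {a} {b} p q = subst (_≤ a * b) (*-zeroʳ a)
  (*-monoˡ-≤-nonNeg a {{nonNegative p}} q)

0<* : ∀ {a b} → 0ℚ < a → 0ℚ < b → 0ℚ < a * b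
0<* {a} {b} p q = subst (_< a * b) (*-zeroʳ a)
  (*-monoʳ-<-pos a {{positive p}} q)

0<+ : ∀ {a b} → 0ℚ < a → 0ℚ < b → 0ℚ < a + b
0<+ p q = +-mono-< p q

0<inv : ∀ {p} → 0ℚ < p → 0ℚ < inv p
0<inv {p} 0<p = *-cancelˡ-<-nonNeg p {{nonNegative (<⇒≤ 0<p)}}
  (subst₂ _<_ (sym (*-zeroʳ p)) (sym (p*inv[p]≡1 p {{>-nonZero 0<p}})) 0<1)

inv-anti : ∀ {x y} → 0ℚ < x → x ≤ y → inv y ≤ inv x
inv-anti {x} {y} 0<x x≤y = *-cancelˡ-≤-pos (x * y) {{positive (0<* 0<x 0<y)}}
  (subst₂ _≤_ eq₁ eq₂ x≤y)
  where
  0<y = <-≤-trans 0<x x≤y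
  eq₁ : x ≡ x * y * inv y
  eq₁ = sym (trans (*-assoc x y (inv y))
    (trans (cong (x *_) (p*inv[p]≡1 y {{>-nonZero 0<y}})) (*-identityʳ x)))
  eq₂ : y ≡ x * y * inv x
  eq₂ = sym (trans (solve 3 (λ a b c → a :* b :* c := b :* (a :* c)) refl x y (inv x))
    (trans (cong (y *_) (p*inv[p]≡1 x {{>-nonZero 0<x}})) (*-identityʳ y)))

p≤q⇒0≤q-p : ∀ {p q} → p ≤ q → 0ℚ ≤ q - p
p≤q⇒0≤q-p {p} {q} p≤q = subst (_≤ q - p) (+-inverseʳ p) (+-monoˡ-≤ (- p) p≤q)

∣p∣<ε : ∀ {p ε} → p < ε → - p < ε → ∣ p ∣ < ε
∣p∣<ε {p} {ε} u v with ∣p∣≡p∨∣p∣≡-p p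
... | inj₁ e = subst (_< ε) (sym e) u
... | inj₂ e = subst (_< ε) (sym e) v

p≤∣p∣ : ∀ p → p ≤ ∣ p ∣
p≤∣p∣ p with ≤-total 0ℚ p
... | inj₁ 0≤p = ≤-reflexive (sym (0≤p⇒∣p∣≡p 0≤p))
... | inj₂ p≤0 = ≤-trans p≤0 (0≤∣p∣ p)

toℚᵘ-ℕ : ∀ n → toℚᵘ (ℕ→ℚ n) ℚᵘ.≃ mkℚᵘ (ℤ.+ n) 0
toℚᵘ-ℕ n = toℚᵘ-fromℚᵘ (mkℚᵘ (ℤ.+ n) 0)

ℕ→ℚ-+ : ∀ m n → ℕ→ℚ (m ℕ.+ n) ≡ ℕ→ℚ m + ℕ→ℚ n
ℕ→ℚ-+ m n = toℚᵘ-injective (ℚᵘP.≃-trans (toℚᵘ-ℕ (m ℕ.+ n)) (ℚᵘP.≃-trans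
  (ℚᵘ.*≡* (cong (ℤ._* ℤ.+ 1) (sym (cong₂ ℤ._+_ (ℤP.*-identityʳ (ℤ.+ m)) (ℤP.*-identityʳ (ℤ.+ n))))))
  (ℚᵘP.≃-sym (ℚᵘP.≃-trans (toℚᵘ-homo-+ (ℕ→ℚ m) (ℕ→ℚ n))
    (ℚᵘP.+-cong (toℚᵘ-ℕ m) (toℚᵘ-ℕ n))))))

ℕ→ℚ-suc : ∀ n → ℕ→ℚ (suc n) ≡ 1ℚ + ℕ→ℚ n
ℕ→ℚ-suc n = ℕ→ℚ-+ 1 n

ℕ→ℚ-* : ∀ m n → ℕ→ℚ (m ℕ.* n) ≡ ℕ→ℚ m * ℕ→ℚ n
ℕ→ℚ-* zero n = sym (*-zeroˡ (ℕ→ℚ n))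
ℕ→ℚ-* (suc m) n = trans (ℕ→ℚ-+ n (m ℕ.* n)) (trans
  (cong (ℕ→ℚ n +_) (ℕ→ℚ-* m n)) (trans
  (solve 2 (λ a b → a :+ b :* a := (con 1ℚ :+ b) :* a) refl (ℕ→ℚ n) (ℕ→ℚ m))
  (cong (_* ℕ→ℚ n) (sym (ℕ→ℚ-suc m)))))

0≤ℕ→ℚ : ∀ n → 0ℚ ≤ ℕ→ℚ n
0≤ℕ→ℚ n = nonNegative⁻¹ (ℕ→ℚ n) {{normalize-nonNeg n 1}}

ℕ→ℚ-mono : ∀ {m n} → m ℕ.≤ n → ℕ→ℚ m ≤ ℕ→ℚ n
ℕ→ℚ-mono {m} {n} m≤n = subst₂ _≤_ (+-identityʳ (ℕ→ℚ m))
  (trans (sym (ℕ→ℚ-+ m (n ℕ.∸ m))) (cong ℕ→ℚ (ℕP.m+[n∸m]≡n m≤n)))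
  (+-monoʳ-≤ (ℕ→ℚ m) (0≤ℕ→ℚ (n ℕ.∸ m)))

1≤suc : ∀ n → 1ℚ ≤ ℕ→ℚ (suc n)
1≤suc n = ℕ→ℚ-mono {1} {suc n} (ℕ.s≤s ℕ.z≤n)

0<suc : ∀ n → 0ℚ < ℕ→ℚ (suc n)
0<suc n = <-≤-trans 0<1 (1≤suc n)

archimedean : ∀ D ε → 0ℚ < ε →
  ∃ λ M → ∀ n → M ℕ.≤ n → D * inv (ℕ→ℚ (suc n)) < ε
archimedean D ε 0<ε = M , λ n M≤n →
  *-cancelʳ-<-nonNeg (ℕ→ℚ (suc n)) {{nonNegative (0≤ℕ→ℚ (suc n))}}
    (subst₂ _<_ (eq n) refl (bound n M≤n))
  where
  p = D * inv ε
  M = ℤ.∣ ↥ p ∣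

  below : ∀ q → q ≤ ℕ→ℚ ℤ.∣ ↥ q ∣
  below q@(mkℚ i e _) = toℚᵘ-cancel-≤ (ℚᵘP.≤-respʳ-≃ (ℚᵘP.≃-sym (toℚᵘ-ℕ ℤ.∣ i ∣))
    (ℚᵘ.*≤* (ineq i)))
    where
    ineq : ∀ j → j ℤ.* ℤ.+ 1 ℤ.≤ ℤ.+ ℤ.∣ j ∣ ℤ.* ℤ.+ suc e
    ineq (ℤ.+ k) rewrite sym (ℤP.pos-* k 1) | sym (ℤP.pos-* k (suc e)) =
      ℤ.+≤+ (ℕP.*-monoʳ-≤ k (ℕ.s≤s ℕ.z≤n))
    ineq -[1+ k ] rewrite sym (ℤP.pos-* (suc k) (suc e)) = ℤ.-≤+

  pε≡D : p * ε ≡ D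
  pε≡D = trans (solve 3 (λ a b c → a :* b :* c := a :* (c :* b)) refl D (inv ε) ε)
    (trans (cong (D *_) (p*inv[p]≡1 ε {{>-nonZero 0<ε}})) (*-identityʳ D))

  eq : ∀ n → D ≡ D * inv (ℕ→ℚ (suc n)) * ℕ→ℚ (suc n)
  eq n = sym (trans
    (solve 3 (λ a b c → a :* b :* c := a :* (c :* b)) refl D (inv (ℕ→ℚ (suc n))) (ℕ→ℚ (suc n)))
    (trans (cong (D *_) (p*inv[p]≡1 (ℕ→ℚ (suc n)) {{>-nonZero (0<suc n)}})) (*-identityʳ D)))

  bound : ∀ n → M ℕ.≤ n → D < ε * ℕ→ℚ (suc n)
  bound n M≤n = subst₂ _<_ pε≡D (*-comm (ℕ→ℚ (suc n)) ε)
    (*-monoˡ-<-pos ε {{positive 0<ε}}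
      (≤-<-trans (≤-trans (below p) (ℕ→ℚ-mono M≤n))
        (subst₂ _<_ (+-identityˡ (ℕ→ℚ n)) (sym (ℕ→ℚ-suc n)) (+-monoˡ-< (ℕ→ℚ n) 0<1))))

-- Real numbers, as Cauchy sequences of rationals.  Two such sequences
-- represent the same real when their difference tends to 0; the strict
-- order below does not depend on the representatives.
record ℝ : Set where
  constructor mkℝ
  field
    seq    : ℕ → ℚ
    cauchy : ∀ ε → 0ℚ < ε →
             ∃ λ M → ∀ m n → M ℕ.≤ m → M ℕ.≤ n → ∣ seq m - seq n ∣ < ε

open ℝ public

infix 4 _<ᴿ_
infixl 6 _+ᴿ_ _-ᴿ_
infixl 7 _*ᴿ_ divᴿ

_<ᴿ_ : ℝ → ℝ → Set
x <ᴿ y = ∃ λ δ → 0ℚ < δ × ∃ λ M → ∀ m → M ℕ.≤ m → seq x m + δ ≤ seq y m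

ℚ→ℝ : ℚ → ℝ
ℚ→ℝ p = mkℝ (λ _ → p) λ ε 0<ε →
  0 , λ _ _ _ _ → subst (_< ε) (sym (cong ∣_∣ (+-inverseʳ p))) 0<ε

ℕ→ℝ : ℕ → ℝ
ℕ→ℝ n = ℚ→ℝ (ℕ→ℚ n)

0ℝ 1ℝ : ℝ
0ℝ = ℚ→ℝ 0ℚ
1ℝ = ℚ→ℝ 1ℚ

-- If a quantity is controlled by the increments of two Cauchy sequences
-- with positive weights a and b, then it is eventually small.
combine : ∀ (x y : ℝ) (a b : ℚ) → 0ℚ < a → 0ℚ < b → (K : ℕ) (z : ℕ → ℕ → ℚ) →
  (∀ m n → K ℕ.≤ m → K ℕ.≤ n →
     z m n ≤ a * ∣ seq x m - seq x n ∣ + b * ∣ seq y m - seq y n ∣) →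
  ∀ ε → 0ℚ < ε → ∃ λ M → ∀ m n → M ℕ.≤ m → M ℕ.≤ n → z m n < ε
combine x y a b 0<a 0<b K z hyp ε 0<ε = K ℕ.⊔ (M₁ ℕ.⊔ M₂) , small
  where
  0<c : 0ℚ < a + b
  0<c = 0<+ 0<a 0<b
  δ = inv (a + b) * ε
  0<δ : 0ℚ < δ
  0<δ = 0<* (0<inv 0<c) 0<ε
  M₁ = proj₁ (cauchy x δ 0<δ)
  M₂ = proj₁ (cauchy y δ 0<δ)

  total : a * δ + b * δ ≡ ε
  total = trans (sym (*-distribʳ-+ δ a b)) (trans (sym (*-assoc (a + b) (inv (a + b)) ε))
    (trans (cong (_* ε) (p*inv[p]≡1 (a + b) {{>-nonZero 0<c}})) (*-identityˡ ε)))

  small : ∀ m n → K ℕ.⊔ (M₁ ℕ.⊔ M₂) ℕ.≤ m → K ℕ.⊔ (M₁ ℕ.⊔ M₂) ℕ.≤ n → z m n < ε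
  small m n u v = ≤-<-trans (hyp m n (k u) (k v)) (subst (_ <_) total
    (+-mono-< (*-monoʳ-<-pos a {{positive 0<a}} (proj₂ (cauchy x δ 0<δ) m n (m₁ u) (m₁ v)))
              (*-monoʳ-<-pos b {{positive 0<b}} (proj₂ (cauchy y δ 0<δ) m n (m₂ u) (m₂ v)))))
    where
    k : ∀ {i} → K ℕ.⊔ (M₁ ℕ.⊔ M₂) ℕ.≤ i → K ℕ.≤ i
    k = ℕP.m⊔n≤o⇒m≤o K _
    m₁ : ∀ {i} → K ℕ.⊔ (M₁ ℕ.⊔ M₂) ℕ.≤ i → M₁ ℕ.≤ i
    m₁ w = ℕP.m⊔n≤o⇒m≤o M₁ M₂ (ℕP.m⊔n≤o⇒n≤o K _ w)
    m₂ : ∀ {i} → K ℕ.⊔ (M₁ ℕ.⊔ M₂) ℕ.≤ i → M₂ ℕ.≤ i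
    m₂ w = ℕP.m⊔n≤o⇒n≤o M₁ M₂ (ℕP.m⊔n≤o⇒n≤o K _ w)

bounded : ∀ (x : ℝ) → ∃ λ B → 0ℚ < B × ∃ λ M → ∀ m → M ℕ.≤ m → ∣ seq x m ∣ ≤ B
bounded x = B , <-≤-trans 0<1 1≤B , M , λ m M≤m →
    ≤-trans
      (subst (_≤ ∣ seq x m - seq x M ∣ + ∣ seq x M ∣)
        (cong ∣_∣ (solve 2 (λ a b → (a :- b) :+ b := a) refl (seq x m) (seq x M)))
        (∣p+q∣≤∣p∣+∣q∣ (seq x m - seq x M) (seq x M)))
      (+-monoˡ-≤ ∣ seq x M ∣ (<⇒≤ (proj₂ (cauchy x 1ℚ 0<1) m M M≤m ℕP.≤-refl)))
  where
  M = proj₁ (cauchy x 1ℚ 0<1)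
  B = 1ℚ + ∣ seq x M ∣
  1≤B : 1ℚ ≤ B
  1≤B = subst (_≤ B) (+-identityʳ 1ℚ) (+-monoʳ-≤ 1ℚ (0≤∣p∣ (seq x M)))

_+ᴿ_ : ℝ → ℝ → ℝ
x +ᴿ y = mkℝ (λ n → seq x n + seq y n)
  (combine x y 1ℚ 1ℚ 0<1 0<1 0 _ λ m n _ _ →
    subst₂ _≤_
      (cong ∣_∣ (solve 4 (λ a b c e → (a :- b) :+ (c :- e) := (a :+ c) :- (b :+ e)) refl
        (seq x m) (seq x n) (seq y m) (seq y n)))
      (sym (cong₂ _+_ (*-identityˡ ∣ seq x m - seq x n ∣) (*-identityˡ ∣ seq y m - seq y n ∣)))
      (∣p+q∣≤∣p∣+∣q∣ (seq x m - seq x n) (seq y m - seq y n)))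

_-ᴿ_ : ℝ → ℝ → ℝ
x -ᴿ y = mkℝ (λ n → seq x n - seq y n)
  (combine x y 1ℚ 1ℚ 0<1 0<1 0 _ λ m n _ _ →
    subst₂ _≤_
      (cong ∣_∣ (solve 4 (λ a b c e → (a :- b) :- (c :- e) := (a :- c) :- (b :- e)) refl
        (seq x m) (seq x n) (seq y m) (seq y n)))
      (sym (cong₂ _+_ (*-identityˡ ∣ seq x m - seq x n ∣) (*-identityˡ ∣ seq y m - seq y n ∣)))
      (∣p-q∣≤∣p∣+∣q∣ (seq x m - seq x n) (seq y m - seq y n)))

_*ᴿ_ : ℝ → ℝ → ℝ
x *ᴿ y = mkℝ (λ n → seq x n * seq y n)
  (combine x y B₂ B₁ 0<B₂ 0<B₁ (M₁ ℕ.⊔ M₂) _ λ m n u v →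
    subst (_≤ B₂ * ∣ seq x m - seq x n ∣ + B₁ * ∣ seq y m - seq y n ∣)
      (cong ∣_∣ (solve 4
        (λ a b c e → (e :* (a :- b)) :+ (a :* (c :- e)) := (a :* c) :- (b :* e)) refl
        (seq x m) (seq x n) (seq y m) (seq y n)))
      (≤-trans
        (∣p+q∣≤∣p∣+∣q∣ (seq y n * (seq x m - seq x n)) (seq x m * (seq y m - seq y n)))
        (+-mono-≤
          (scale (seq y n) _ (bd₂ n (ℕP.m⊔n≤o⇒n≤o M₁ M₂ v)))
          (scale (seq x m) _ (bd₁ m (ℕP.m⊔n≤o⇒m≤o M₁ M₂ u))))))
  where
  B₁ = proj₁ (bounded x)
  B₂ = proj₁ (bounded y)
  0<B₁ = proj₁ (proj₂ (bounded x))
  0<B₂ = proj₁ (proj₂ (bounded y))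
  M₁ = proj₁ (proj₂ (proj₂ (bounded x)))
  M₂ = proj₁ (proj₂ (proj₂ (bounded y)))
  bd₁ = proj₂ (proj₂ (proj₂ (bounded x)))
  bd₂ = proj₂ (proj₂ (proj₂ (bounded y)))
  scale : ∀ p q {B} → ∣ p ∣ ≤ B → ∣ p * q ∣ ≤ B * ∣ q ∣
  scale p q {B} p≤B = subst (_≤ B * ∣ q ∣) (sym (∣p*q∣≡∣p∣*∣q∣ p q))
    (*-monoʳ-≤-nonNeg ∣ q ∣ {{∣-∣-nonNeg q}} p≤B)

∣_∣ᴿ : ℝ → ℝ
∣ x ∣ᴿ = mkℝ (λ n → ∣ seq x n ∣) λ ε 0<ε →
  let M , p = cauchy x ε 0<ε in M , λ m n u v →
    ∣p∣<ε (≤-<-trans (reverse (seq x m) (seq x n)) (p m n u v))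
          (subst (_< ε) (solve 2 (λ a b → a :- b := :- (b :- a)) refl ∣ seq x n ∣ ∣ seq x m ∣)
            (≤-<-trans (reverse (seq x n) (seq x m)) (p n m v u)))
  where
  reverse : ∀ a b → ∣ a ∣ - ∣ b ∣ ≤ ∣ a - b ∣
  reverse a b = subst₂ _≤_
    refl
    (solve 2 (λ s t → s :+ t :- t := s) refl ∣ a - b ∣ ∣ b ∣)
    (+-monoˡ-≤ (- ∣ b ∣)
      (subst (λ t → ∣ t ∣ ≤ ∣ a - b ∣ + ∣ b ∣)
        (solve 2 (λ s t → (s :- t) :+ t := s) refl a b)
        (∣p+q∣≤∣p∣+∣q∣ (a - b) b)))

-- Nonvanishing is apartness from 0, as division requires.
NonZeroᴿ : ℝ → Set
NonZeroᴿ x = 0ℝ <ᴿ ∣ x ∣ᴿ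

apart : ∀ {δ p} → 0ℚ + δ ≤ ∣ p ∣ → δ ≤ ∣ p ∣
apart {δ} {p} = subst (_≤ ∣ p ∣) (+-identityˡ δ)

∣∣>0⇒nonZero : ∀ {δ} p → 0ℚ < δ → δ ≤ ∣ p ∣ → NonZero p
∣∣>0⇒nonZero {δ} p 0<δ δ≤ = ≢-nonZero {p} λ where
  refl → <-irrefl refl (<-≤-trans 0<δ δ≤)

invᴿ : (x : ℝ) → NonZeroᴿ x → ℝ
invᴿ x (δ , 0<δ , K , far) = mkℝ (λ n → inv (seq x n)) λ ε 0<ε →
  let 0<δδ = 0<* 0<δ 0<δ
      M , p = cauchy x (ε * (δ * δ)) (0<* 0<ε 0<δδ)
  in K ℕ.⊔ M , λ m n u v → *-cancelʳ-<-nonNeg (δ * δ) {{nonNegative (<⇒≤ 0<δδ)}}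
    (≤-<-trans
      (bound (seq x m) (seq x n)
        (apart (far m (ℕP.m⊔n≤o⇒m≤o K M u))) (apart (far n (ℕP.m⊔n≤o⇒m≤o K M v))))
      (p n m (ℕP.m⊔n≤o⇒n≤o K M v) (ℕP.m⊔n≤o⇒n≤o K M u)))
  where
  bound : ∀ a b → δ ≤ ∣ a ∣ → δ ≤ ∣ b ∣ → ∣ inv a - inv b ∣ * (δ * δ) ≤ ∣ b - a ∣
  bound a b δ≤a δ≤b = ≤-trans
    (*-monoˡ-≤-nonNeg ∣ inv a - inv b ∣ {{∣-∣-nonNeg (inv a - inv b)}}
      (*-mono-≤-≤ (<⇒≤ 0<δ) δ≤a (<⇒≤ 0<δ) δ≤b))
    (≤-reflexive (trans (cong (∣ inv a - inv b ∣ *_) (sym (∣p*q∣≡∣p∣*∣q∣ a b)))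
      (trans (sym (∣p*q∣≡∣p∣*∣q∣ (inv a - inv b) (a * b))) (cong ∣_∣ eq))))
    where
    eq : (inv a - inv b) * (a * b) ≡ b - a
    eq = trans
      (solve 4 (λ a b i j → (i :- j) :* (a :* b) := b :* (a :* i) :- a :* (b :* j)) refl
        a b (inv a) (inv b))
      (cong₂ _-_
        (trans (cong (b *_) (p*inv[p]≡1 a {{∣∣>0⇒nonZero a 0<δ δ≤a}})) (*-identityʳ b))
        (trans (cong (a *_) (p*inv[p]≡1 b {{∣∣>0⇒nonZero b 0<δ δ≤b}})) (*-identityʳ a)))

divᴿ : (x y : ℝ) → NonZeroᴿ y → ℝ
divᴿ x y y≠0 = x *ᴿ invᴿ y y≠0

syntax divᴿ x y y≠0 = x ÷ᴿ y [ y≠0 ]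

*-nonZeroᴿ : ∀ x y → NonZeroᴿ x → NonZeroᴿ y → NonZeroᴿ (x *ᴿ y)
*-nonZeroᴿ x y (δ₁ , 0<δ₁ , M₁ , far₁) (δ₂ , 0<δ₂ , M₂ , far₂) =
  δ₁ * δ₂ , 0<* 0<δ₁ 0<δ₂ , M₁ ℕ.⊔ M₂ , λ m u →
    subst₂ _≤_ (sym (+-identityˡ (δ₁ * δ₂))) (sym (∣p*q∣≡∣p∣*∣q∣ (seq x m) (seq y m)))
      (*-mono-≤-≤ (<⇒≤ 0<δ₁) (apart (far₁ m (ℕP.m⊔n≤o⇒m≤o M₁ M₂ u)))
                  (<⇒≤ 0<δ₂) (apart (far₂ m (ℕP.m⊔n≤o⇒n≤o M₁ M₂ u))))

AntitoneOn : ℚ → ℚ → (ℚ → ℚ) → Set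
AntitoneOn a b f = ∀ x y → a ≤ x → x ≤ y → y ≤ b → f y ≤ f x

Σ< : ℕ → (ℕ → ℚ) → ℚ
Σ< zero    g = 0ℚ
Σ< (suc m) g = Σ< m g + g m

step : ℚ → ℚ → ℕ → ℚ
step a b n = (b - a) * inv (ℕ→ℚ (suc n))

-- Right Riemann sum for the division of [a,b] into suc n equal parts.
riemann : ℚ → ℚ → (ℚ → ℚ) → ℕ → ℚ
riemann a b f n = step a b n * Σ< (suc n) (λ k → f (a + ℕ→ℚ (suc k) * step a b n))

Σ<-cong : ∀ m {g h} → (∀ i → g i ≡ h i) → Σ< m g ≡ Σ< m h
Σ<-cong zero e = refl
Σ<-cong (suc m) e = cong₂ _+_ (Σ<-cong m e) (e m)

Σ<-mono : ∀ m {g h} → (∀ i → i ℕ.< m → g i ≤ h i) → Σ< m g ≤ Σ< m h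
Σ<-mono zero e = ≤-refl
Σ<-mono (suc m) e =
  +-mono-≤ (Σ<-mono m (λ i i<m → e i (ℕP.m<n⇒m<1+n i<m))) (e m ℕP.≤-refl)

Σ<-+ : ∀ m k g → Σ< (m ℕ.+ k) g ≡ Σ< m g + Σ< k (λ j → g (m ℕ.+ j))
Σ<-+ m zero g rewrite ℕP.+-identityʳ m = sym (+-identityʳ (Σ< m g))
Σ<-+ m (suc k) g rewrite ℕP.+-suc m k = trans (cong (_+ g (m ℕ.+ k)) (Σ<-+ m k g))
  (+-assoc (Σ< m g) (Σ< k (λ j → g (m ℕ.+ j))) (g (m ℕ.+ k)))

Σ<-* : ∀ m k g → Σ< (m ℕ.* k) g ≡ Σ< m (λ i → Σ< k (λ j → g (i ℕ.* k ℕ.+ j)))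
Σ<-* zero k g = refl
Σ<-* (suc m) k g rewrite ℕP.+-comm k (m ℕ.* k) =
  trans (Σ<-+ (m ℕ.* k) k g) (cong (_+ Σ< k (λ j → g (m ℕ.* k ℕ.+ j))) (Σ<-* m k g))

Σ<-const : ∀ m c → Σ< m (λ _ → c) ≡ ℕ→ℚ m * c
Σ<-const zero c = sym (*-zeroˡ c)
Σ<-const (suc m) c = trans (cong (_+ c) (Σ<-const m c)) (trans
  (solve 2 (λ a b → a :* b :+ b := (con 1ℚ :+ a) :* b) refl (ℕ→ℚ m) c)
  (cong (_* c) (sym (ℕ→ℚ-suc m))))

Σ<-*ˡ : ∀ m c g → Σ< m (λ i → c * g i) ≡ c * Σ< m g
Σ<-*ˡ zero c g = sym (*-zeroʳ c)
Σ<-*ˡ (suc m) c g = trans (cong (_+ c * g m) (Σ<-*ˡ m c g)) (sym (*-distribˡ-+ c (Σ< m g) (g m)))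

Σ<-shift : ∀ m g → Σ< m g ≡ Σ< m (λ i → g (suc i)) + (g 0 - g m)
Σ<-shift zero g = solve 1 (λ a → con 0ℚ := con 0ℚ :+ (a :- a)) refl (g 0)
Σ<-shift (suc m) g = trans (cong (_+ g m) (Σ<-shift m g))
  (solve 4 (λ s a b c → s :+ (a :- b) :+ b := s :+ c :+ (a :- c)) refl
    (Σ< m (λ i → g (suc i))) (g 0) (g m) (g (suc m)))

module Riemann (a b : ℚ) (f : ℚ → ℚ) (a≤b : a ≤ b) (anti : AntitoneOn a b f) where

  R : ℕ → ℚ
  R = riemann a b f

  0≤step : ∀ n → 0ℚ ≤ step a b n
  0≤step n = 0≤* (p≤q⇒0≤q-p a≤b) (<⇒≤ (0<inv (0<suc n)))

  point : ℕ → ℕ → ℚ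
  point n i = a + ℕ→ℚ i * step a b n

  steps : ∀ n → ℕ→ℚ (suc n) * step a b n ≡ b - a
  steps n = trans
    (solve 3 (λ x y z → x :* (y :* z) := y :* (x :* z)) refl
      (ℕ→ℚ (suc n)) (b - a) (inv (ℕ→ℚ (suc n))))
    (trans (cong ((b - a) *_) (p*inv[p]≡1 (ℕ→ℚ (suc n)) {{>-nonZero (0<suc n)}}))
      (*-identityʳ (b - a)))

  point-first : ∀ n → point n 0 ≡ a
  point-first n = trans (cong (a +_) (*-zeroˡ (step a b n))) (+-identityʳ a)

  point-last : ∀ n → point n (suc n) ≡ b
  point-last n = trans (cong (a +_) (steps n))
    (solve 2 (λ x y → x :+ (y :- x) := y) refl a b)

  point-mono : ∀ n {i j} → i ℕ.≤ j → point n i ≤ point n j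
  point-mono n i≤j =
    +-monoʳ-≤ a (*-monoʳ-≤-nonNeg (step a b n) {{nonNegative (0≤step n)}} (ℕ→ℚ-mono i≤j))

  f-anti : ∀ n {i j} → i ℕ.≤ j → j ℕ.≤ suc n → f (point n j) ≤ f (point n i)
  f-anti n {i} {j} i≤j j≤ = anti _ _
    (subst (_≤ point n i) (point-first n) (point-mono n {0} {i} ℕ.z≤n))
    (point-mono n i≤j)
    (subst (point n j ≤_) (point-last n) (point-mono n j≤))

  -- suc (refine p q) = suc p * suc q
  refine : ℕ → ℕ → ℕ
  refine p q = q ℕ.+ p ℕ.* suc q

  refine-comm : ∀ p q → refine p q ≡ refine q p
  refine-comm p q = ℕP.suc-injective (ℕP.*-comm (suc p) (suc q))

  step-refine : ∀ p q → ℕ→ℚ (suc q) * step a b (refine p q) ≡ step a b p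
  step-refine p q = *-cancelˡ (ℕ→ℚ (suc p)) (0<suc p) (trans
    (sym (*-assoc (ℕ→ℚ (suc p)) (ℕ→ℚ (suc q)) (step a b (refine p q))))
    (trans (cong (_* step a b (refine p q)) (sym (ℕ→ℚ-* (suc p) (suc q))))
      (trans (steps (refine p q)) (sym (steps p)))))
    where
    *-cancelˡ : ∀ c {x y} → 0ℚ < c → c * x ≡ c * y → x ≡ y
    *-cancelˡ c 0<c e = ≤-antisym
      (*-cancelˡ-≤-pos c {{positive 0<c}} (≤-reflexive e))
      (*-cancelˡ-≤-pos c {{positive 0<c}} (≤-reflexive (sym e)))

  point-refine : ∀ p q i → point (refine p q) (i ℕ.* suc q) ≡ point p i
  point-refine p q i = cong (a +_) (trans
    (cong (_* step a b (refine p q)) (ℕ→ℚ-* i (suc q)))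
    (trans (*-assoc (ℕ→ℚ i) (ℕ→ℚ (suc q)) (step a b (refine p q)))
      (cong (ℕ→ℚ i *_) (step-refine p q))))

  -- Sum over the q+1 subintervals into which the i-th one is divided.
  block : ∀ p q i → ℚ
  block p q i = Σ< (suc q) (λ j → f (point (refine p q) (suc (i ℕ.* suc q ℕ.+ j))))

  R-refine : ∀ p q → R (refine p q) ≡ step a b (refine p q) * Σ< (suc p) (block p q)
  R-refine p q = cong (step a b (refine p q) *_)
    (Σ<-* (suc p) (suc q) (λ k → f (point (refine p q) (suc k))))

  next : ∀ q i → suc (i ℕ.* suc q ℕ.+ q) ≡ suc i ℕ.* suc q
  next q i = trans (sym (ℕP.+-suc (i ℕ.* suc q) q)) (ℕP.+-comm (i ℕ.* suc q) (suc q))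

  block-≥ : ∀ p q i → i ℕ.< suc p → ℕ→ℚ (suc q) * f (point p (suc i)) ≤ block p q i
  block-≥ p q i i<p = subst (_≤ block p q i) (Σ<-const (suc q) (f (point p (suc i))))
    (Σ<-mono (suc q) λ j j<q →
      subst (_≤ f (point (refine p q) (suc (i ℕ.* suc q ℕ.+ j))))
        (cong f (point-refine p q (suc i)))
        (f-anti (refine p q)
          (subst (suc (i ℕ.* suc q ℕ.+ j) ℕ.≤_) (next q i)
            (ℕ.s≤s (ℕP.+-monoʳ-≤ (i ℕ.* suc q) (ℕ.s≤s⁻¹ j<q))))
          (ℕP.*-monoˡ-≤ (suc q) i<p)))

  block-≤ : ∀ p q i → i ℕ.< suc p → block p q i ≤ ℕ→ℚ (suc q) * f (point p i)
  block-≤ p q i i<p = subst (block p q i ≤_) (Σ<-const (suc q) (f (point p i)))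
    (Σ<-mono (suc q) λ j j<q →
      subst (f (point (refine p q) (suc (i ℕ.* suc q ℕ.+ j))) ≤_)
        (cong f (point-refine p q i))
        (f-anti (refine p q)
          (ℕP.m≤n⇒m≤1+n (ℕP.m≤m+n (i ℕ.* suc q) j))
          (ℕP.≤-trans
            (subst (suc (i ℕ.* suc q ℕ.+ j) ℕ.≤_) (next q i)
              (ℕ.s≤s (ℕP.+-monoʳ-≤ (i ℕ.* suc q) (ℕ.s≤s⁻¹ j<q))))
            (ℕP.*-monoˡ-≤ (suc q) i<p))))

  scaled : ∀ p q g →
    step a b (refine p q) * Σ< (suc p) (λ i → ℕ→ℚ (suc q) * g i) ≡ step a b p * Σ< (suc p) g
  scaled p q g = trans (cong (step a b (refine p q) *_) (Σ<-*ˡ (suc p) (ℕ→ℚ (suc q)) g))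
    (trans (solve 3 (λ x y z → x :* (y :* z) := (y :* x) :* z) refl
        (step a b (refine p q)) (ℕ→ℚ (suc q)) (Σ< (suc p) g))
      (cong (_* Σ< (suc p) g) (step-refine p q)))

  R≤refined : ∀ p q → R p ≤ R (refine p q)
  R≤refined p q = subst₂ _≤_ (scaled p q (λ i → f (point p (suc i)))) (sym (R-refine p q))
    (*-monoˡ-≤-nonNeg (step a b (refine p q)) {{nonNegative (0≤step (refine p q))}}
      (Σ<-mono (suc p) (block-≥ p q)))

  drop : ℚ
  drop = (b - a) * (f a - f b)

  refined≤R : ∀ p q → R (refine p q) ≤ R p + drop * inv (ℕ→ℚ (suc p))
  refined≤R p q = subst₂ _≤_ (sym (R-refine p q))
    (trans (scaled p q (λ i → f (point p i))) left)
    (*-monoˡ-≤-nonNeg (step a b (refine p q)) {{nonNegative (0≤step (refine p q))}}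
      (Σ<-mono (suc p) (block-≤ p q)))
    where
    S = Σ< (suc p) (λ i → f (point p (suc i)))
    left : step a b p * Σ< (suc p) (λ i → f (point p i)) ≡ R p + drop * inv (ℕ→ℚ (suc p))
    left = trans (cong (step a b p *_) (trans (Σ<-shift (suc p) (λ i → f (point p i)))
        (cong (λ t → S + t) (cong₂ (λ u v → f u - f v) (point-first p) (point-last p)))))
      (solve 5 (λ w i s u v →
          w :* i :* (s :+ (u :- v)) := w :* i :* s :+ w :* (u :- v) :* i) refl
        (b - a) (inv (ℕ→ℚ (suc p))) S (f a) (f b))

  R-cauchy : ∀ ε → 0ℚ < ε → ∃ λ M → ∀ m n → M ℕ.≤ m → M ℕ.≤ n → ∣ R m - R n ∣ < ε
  R-cauchy ε 0<ε = M , λ m n M≤m M≤n → ∣p∣<ε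
      (one-sided m n M≤n)
      (subst (_< ε) (solve 2 (λ x y → x :- y := :- (y :- x)) refl (R n) (R m))
        (one-sided n m M≤m))
    where
    M = proj₁ (archimedean drop ε 0<ε)
    one-sided : ∀ m n → M ℕ.≤ n → R m - R n < ε
    one-sided m n M≤n = ≤-<-trans
      (subst (R m - R n ≤_)
        (solve 2 (λ x y → x :+ y :- x := y) refl (R n) (drop * inv (ℕ→ℚ (suc n))))
        (+-monoˡ-≤ (- R n) (≤-trans (R≤refined m n)
          (subst (_≤ R n + drop * inv (ℕ→ℚ (suc n))) (cong R (refine-comm n m))
            (refined≤R n m)))))
      (proj₂ (archimedean drop ε 0<ε) n M≤n)

-- The integral over [a,b] of a decreasing function, as the limit of the sums
-- above: the n-th one is within (b-a)(f(a)-f(b))/(n+1) of any refinement.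
∫ : (a b : ℚ) (f : ℚ → ℚ) → a ≤ b → AntitoneOn a b f → ℝ
∫ a b f a≤b anti = mkℝ (riemann a b f) (Riemann.R-cauchy a b f a≤b anti)

-- log n = ∫₁ⁿ dt/t, with the junk value 0 at n = 0
log : ℕ → ℝ
log zero    = 0ℝ
log (suc n) = ∫ 1ℚ (ℕ→ℚ (suc n)) inv (1≤suc n)
  λ x y 1≤x x≤y _ → inv-anti (<-≤-trans 0<1 1≤x) x≤y

arctan′ : ℚ → ℚ
arctan′ t = inv (1ℚ + t * t)

arctan′-anti : AntitoneOn 0ℚ 1ℚ arctan′
arctan′-anti x y 0≤x x≤y _ = inv-anti
  (<-≤-trans 0<1 (subst (_≤ 1ℚ + x * x) (+-identityʳ 1ℚ) (+-monoʳ-≤ 1ℚ (0≤* 0≤x 0≤x))))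
  (+-monoʳ-≤ 1ℚ (*-mono-≤-≤ 0≤x x≤y 0≤x x≤y))

-- π = 4 arctan 1 = 4 ∫₀¹ dt/(1+t²)
π : ℝ
π = ℕ→ℝ 4 *ᴿ ∫ 0ℚ 1ℚ arctan′ (<⇒≤ 0<1) arctan′-anti

π-nonZero : NonZeroᴿ π
π-nonZero = ½ , positive⁻¹ ½ , 0 , λ m _ → ≤-trans
  (subst (_≤ ℕ→ℚ 4 * R m) (+-identityˡ ½) (≤-trans {½} {ℕ→ℚ 4 * ½}
    (≤ᵇ⇒≤ {½} {ℕ→ℚ 4 * ½} _)
    (*-monoˡ-≤-nonNeg (ℕ→ℚ 4)
      (subst (λ t → ½ ≤ R t) (ℕP.+-identityʳ m) (R≤refined 0 m)))))
  (p≤∣p∣ (ℕ→ℚ 4 * R m))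
  where
  open Riemann 0ℚ 1ℚ arctan′ (<⇒≤ 0<1) arctan′-anti using (R; R≤refined)

π²-nonZero : NonZeroᴿ (π *ᴿ π)
π²-nonZero = *-nonZeroᴿ π π π-nonZero π-nonZero

-- f(N) ∼ g(N) as N → ∞: the ratio f(N)/g(N) is defined for all large N
-- and tends to 1.
infix 4 _∼_

_∼_ : (ℕ → ℝ) → (ℕ → ℝ) → Set
f ∼ g = ∀ ε → 0ℝ <ᴿ ε → ∃ λ N₀ → ∀ N → N₀ ℕ.≤ N →
  Σ (NonZeroᴿ (g N)) λ g≠0 → ∣ (f N ÷ᴿ g N [ g≠0 ]) -ᴿ 1ℝ ∣ᴿ <ᴿ ε

{-# OPTIONS --safe #-}
module Submission where

-- Write n² − 1 = x(x+2) with x = n − 1.  Its divisors d correspond to the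
-- coprime pairs (a,b) with a ∣ x and b ∣ x + 2, in such a way that
-- ab ≤ d ≤ 2ab.  By the hyperbola method only the divisors d < n are needed, and
-- for fixed (a,b) the admissible x form one residue class modulo ab, so the sum
-- is 2N P(N) + O(N log N) where P(N) = Σ 1/(ab) over coprime a, b with ab ≤ N.
-- Dropping coprimality gives F(N) = Σ_{ab ≤ N} 1/(ab) = ½ log² N + O(log N), and
-- F(N) = Σ_g P(N/g²)/g²; as P is increasing this yields P ∼ F/ζ(2), without
-- Möbius inversion.  Finally ζ(2) = π²/6 follows from Leibniz's series by the
-- elementary estimate 2(Σ(−1)ᵏ/(2k+1))² − Σ1/(2k+1)² = o(1).

open import Defs
open import Data.Nat using (_^_; _∸_)

-- x and x + 2 share at most a factor 2. Sorting by coprime pairs, and not by the roots of n² ≡ 1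
-- modulo d, makes every local count equal to 1, at the price of knowing d only up to a factor 2.
-- The price is small: d ≤ x forces ab ≤ x, and x ≥ 2ab forces d ≤ x, so for each pair only
-- boundedly many blocks of length ab are in doubt. Reals are Cauchy sequences, and no limit is ever
-- evaluated. A precision K is chosen from ε, then N large in terms of K, and all inequalities are
-- proved between rationals at every late enough index m of the sequences for π and log N. ζ(2)
-- enters only through its partial sum at K², which is compared with π² on one side and with the
-- count on the other. For the value of ζ(2): the sum of (-1)^k/(2k + 1) over -N ≤ k < N is twice
-- Leibniz's partial sum, and partial fractions split the off-diagonal terms of its square into
-- weighted alternating harmonic windows.

module Divisors where

  open import Data.Empty using (⊥; ⊥-elim)
  open import Data.Nat using (ℕ; zero; suc; _+_; _*_; _≤_; _<_; z≤n; s≤s; NonZero; >-nonZero)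
  open import Data.Nat.Coprimality as Coprime using (Coprime; coprime-divisor; coprime-Bézout)
  open import Data.Nat.Divisibility
  open import Data.Nat.DivMod using (_/_; _%_; m≡m%n+[m/n]*n; m%n<n)
  open import Data.Nat.GCD
    using (gcd; gcd[m,n]∣m; gcd[m,n]∣n; gcd-greatest; c*gcd[m,n]≡gcd[cm,cn]; module Bézout)
  open import Data.Nat.Properties
  open import Data.Nat.Tactic.RingSolver using (solve-∀)
  open import Data.Product using (∃; ∃₂; _×_; _,_)
  open import Data.Sum using (_⊎_; inj₁; inj₂)
  open import Relation.Binary.PropositionalEquality
  open import Relation.Nullary using (Dec; yes; no)

  -- Parity and coprimality

  ∣⇒1≤ : ∀ {m n} → m ∣ n → 1 ≤ n → 1 ≤ m
  ∣⇒1≤ {zero} m∣n 1≤n with 0∣⇒≡0 m∣n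
  ∣⇒1≤ {zero} m∣n () | refl
  ∣⇒1≤ {suc m} _ _ = s≤s z≤n

  ∣2 : ∀ {k} → k ∣ 2 → k ≡ 1 ⊎ k ≡ 2
  ∣2 {zero} k∣2 with () ← 0∣⇒≡0 k∣2
  ∣2 {1} _ = inj₁ refl
  ∣2 {2} _ = inj₂ refl
  ∣2 {suc (suc (suc k))} k∣2 with s≤s (s≤s ()) ← ∣⇒≤ k∣2

  odd⇒coprime : ∀ {n} → 2 ∤ n → Coprime 2 n
  odd⇒coprime 2∤n (k∣2 , k∣n) with ∣2 k∣2
  ... | inj₁ e = e
  ... | inj₂ refl = ⊥-elim (2∤n k∣n)

  coprime-2* : ∀ {m n} → 2 ∤ n → Coprime m n → Coprime (2 * m) n
  coprime-2* {m} 2∤n c {k} (k∣2m , k∣n) = c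
    (coprime-divisor {k} {2} {m} (λ (i∣k , i∣2) → odd⇒coprime 2∤n (i∣2 , ∣-trans i∣k k∣n)) k∣2m , k∣n)

  2∣* : ∀ m n → 2 ∣ m * n → 2 ∣ m ⊎ 2 ∣ n
  2∣* m n 2∣mn with 2 ∣? m
  ... | yes 2∣m = inj₁ 2∣m
  ... | no 2∤m = inj₂ (coprime-divisor (odd⇒coprime 2∤m) 2∣mn)

  coprime-*-∣ : ∀ {m n k} → Coprime m n → m ∣ k → n ∣ k → m * n ∣ k
  coprime-*-∣ {m} {n} c m∣k (divides q refl) =
    *-monoˡ-∣ n (coprime-divisor c (subst (m ∣_) (*-comm q n) m∣k))

  -- Pulling factors into the gcd twice shows that q divides the product of the two gcds; their
  -- coprimality gives the converse divisibility.
  coprime-gcd-* : ∀ {q u v} → q ∣ u * v → Coprime (gcd q u) (gcd q v) → gcd q u * gcd q v ≡ q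
  coprime-gcd-* {q} {u} {v} q∣uv c =
    ∣-antisym (coprime-*-∣ c (gcd[m,n]∣m q u) (gcd[m,n]∣m q v)) q∣gh
    where
    q∣vg : q ∣ v * gcd q u
    q∣vg = subst (q ∣_) (sym (c*gcd[m,n]≡gcd[cm,cn] v q u))
      (gcd-greatest (n∣m*n v) (subst (q ∣_) (*-comm u v) q∣uv))
    q∣gh : q ∣ gcd q u * gcd q v
    q∣gh = subst (q ∣_) (sym (c*gcd[m,n]≡gcd[cm,cn] (gcd q u) q v))
      (gcd-greatest (n∣m*n (gcd q u)) (subst (q ∣_) (*-comm v (gcd q u)) q∣vg))

  -- The correspondence between divisors of x(x + 2) and coprime pairs

  record CoprimePair (x a b : ℕ) : Set where
    constructor pair
    field
      a∣x : a ∣ x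
      b∣2+x : b ∣ 2 + x
      coprime : Coprime a b

  open CoprimePair

  -- The factor 2 makes up for the common factor 2 of x and x + 2 when x is even.
  data _⟨_,_⟩ (d a b : ℕ) : Set where
    single : 2 ∤ b → 4 ∤ a → d ≡ a * b → d ⟨ a , b ⟩
    double : 2 ∣ b ⊎ 4 ∣ a → d ≡ 2 * (a * b) → d ⟨ a , b ⟩

  product≤divisor : ∀ {d a b} → d ⟨ a , b ⟩ → a * b ≤ d
  product≤divisor (single _ _ refl) = ≤-refl
  product≤divisor {a = a} {b} (double _ refl) = m≤m+n (a * b) _

  divisor≤2product : ∀ {d a b} → d ⟨ a , b ⟩ → d ≤ 2 * (a * b)
  divisor≤2product {a = a} {b} (single _ _ refl) = m≤m+n (a * b) _
  divisor≤2product (double _ refl) = ≤-refl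

  divisor-unique : ∀ {d d′ a b} → d ⟨ a , b ⟩ → d′ ⟨ a , b ⟩ → d ≡ d′
  divisor-unique (single _ _ refl) (single _ _ refl) = refl
  divisor-unique (single 2∤b _ _) (double (inj₁ 2∣b) _) = ⊥-elim (2∤b 2∣b)
  divisor-unique (single _ 4∤a _) (double (inj₂ 4∣a) _) = ⊥-elim (4∤a 4∣a)
  divisor-unique (double (inj₁ 2∣b) _) (single 2∤b _ _) = ⊥-elim (2∤b 2∣b)
  divisor-unique (double (inj₂ 4∣a) _) (single _ 4∤a _) = ⊥-elim (4∤a 4∣a)
  divisor-unique (double _ refl) (double _ refl) = refl

  2∣4 : 2 ∣ 4
  2∣4 = divides 2 refl

  common∣2 : ∀ {x k} → k ∣ x → k ∣ 2 + x → k ∣ 2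
  common∣2 {x} {k} k∣x k∣2+x = ∣m+n∣m⇒∣n (subst (k ∣_) (+-comm 2 x) k∣2+x) k∣x

  -- A common divisor of x and x + 2 divides 2, and parity excludes 2. In `pair-unique` the a and b
  -- come from two different pairs, so their coprimality is not among the data.
  cross-coprime : ∀ {x a b} → a ∣ x → b ∣ 2 + x → 2 ∤ a ⊎ 2 ∤ b → Coprime a b
  cross-coprime a∣x b∣2+x odd (k∣a , k∣b)
    with ∣2 (common∣2 (∣-trans k∣a a∣x) (∣-trans k∣b b∣2+x))
  ... | inj₁ e = e
  cross-coprime _ _ (inj₁ 2∤a) (k∣a , _) | inj₂ refl = ⊥-elim (2∤a k∣a)
  cross-coprime _ _ (inj₂ 2∤b) (_ , k∣b) | inj₂ refl = ⊥-elim (2∤b k∣b)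

  not-both-even : ∀ {x a b} → CoprimePair x a b → 2 ∣ a → 2 ∤ b
  not-both-even p 2∣a 2∣b with () ← coprime p (2∣a , 2∣b)

  factors-unique : ∀ {a b a′ b′} → Coprime a b′ → Coprime a′ b → a * b ≡ a′ * b′ → a ≡ a′ × b ≡ b′
  factors-unique {a} {b} {a′} {b′} c c′ e =
      ∣-antisym (coprime-divisor c (divides b (trans (*-comm b′ a′) (trans (sym e) (*-comm a b)))))
        (coprime-divisor c′ (divides b′ (trans (*-comm b a) (trans e (*-comm a′ b′)))))
    , ∣-antisym (coprime-divisor (Coprime.sym c′) (divides a (sym e)))
        (coprime-divisor (Coprime.sym c) (divides a′ e))

  4-coprime : ∀ {n} → 2 ∤ n → Coprime 4 n
  4-coprime 2∤n {k} (k∣4 , k∣n) = odd⇒coprime 2∤n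
    (coprime-divisor {k} {2} {2} (λ (i∣k , i∣2) → odd⇒coprime 2∤n (i∣2 , ∣-trans i∣k k∣n)) k∣4 , k∣n)

  -- The right side is divisible by 4; on the left an odd b would pass the whole 4 on to a.
  single≢double : ∀ {a b a′ b′} → 2 ∤ b → 4 ∤ a → 2 ∣ b′ ⊎ 4 ∣ a′ → a * b ≢ 2 * (a′ * b′)
  single≢double {a} {b} {a′} {b′} 2∤b 4∤a h e =
    4∤a (coprime-divisor {4} {b} {a} (4-coprime 2∤b) (subst (4 ∣_) (*-comm a b) 4∣ab))
    where
    2∣a′b′ : 2 ∣ b′ ⊎ 4 ∣ a′ → 2 ∣ a′ * b′
    2∣a′b′ (inj₁ 2∣b′) = ∣n⇒∣m*n a′ 2∣b′
    2∣a′b′ (inj₂ 4∣a′) = ∣m⇒∣m*n b′ (∣-trans 2∣4 4∣a′)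
    4∣ab : 4 ∣ a * b
    4∣ab = subst (4 ∣_) (sym e) (*-monoʳ-∣ 2 (2∣a′b′ h))

  pair-unique : ∀ {x d a b a′ b′} → CoprimePair x a b → CoprimePair x a′ b′ →
    d ⟨ a , b ⟩ → d ⟨ a′ , b′ ⟩ → a ≡ a′ × b ≡ b′
  pair-unique {x} p q (single 2∤b _ refl) (single 2∤b′ _ e) =
    factors-unique (cross-coprime (a∣x p) (b∣2+x q) (inj₂ 2∤b′))
      (cross-coprime (a∣x q) (b∣2+x p) (inj₂ 2∤b)) e
  pair-unique p q (single 2∤b 4∤a e) (double h e′) =
    ⊥-elim (single≢double 2∤b 4∤a h (trans (sym e) e′))
  pair-unique p q (double h e) (single 2∤b 4∤a e′) =
    ⊥-elim (single≢double 2∤b 4∤a h (trans (sym e′) e))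
  pair-unique {x} {d} {a} {b} {a′} {b′} p q (double h e) (double h′ e′) = both h h′
    where
    ab≡ : a * b ≡ a′ * b′
    ab≡ = *-cancelˡ-≡ (a * b) (a′ * b′) 2 (trans (sym e) e′)
    -- With b even, a is odd, so the 4 in a′b′ = ab divides b and hence x + 2. Through a′ it also
    -- divides x, and 4 would divide 2.
    mixed : ∀ {a b a′ b′} → CoprimePair x a b → CoprimePair x a′ b′ → 2 ∣ b → 4 ∣ a′ →
      a * b ≡ a′ * b′ → ⊥
    mixed {a} {b} {a′} {b′} p q 2∣b 4∣a′ e = 4∤2 (common∣2 4∣x (∣-trans 4∣b (b∣2+x p)))
      where
      4∤2 : 4 ∤ 2
      4∤2 4∣2 with s≤s (s≤s ()) ← ∣⇒≤ 4∣2
      4∣x = ∣-trans 4∣a′ (a∣x q)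
      2∤a : 2 ∤ a
      2∤a 2∣a = not-both-even p 2∣a 2∣b
      4∣b = coprime-divisor {4} {a} {b} (4-coprime 2∤a) (subst (4 ∣_) (sym e) (∣m⇒∣m*n b′ 4∣a′))
    both : 2 ∣ b ⊎ 4 ∣ a → 2 ∣ b′ ⊎ 4 ∣ a′ → a ≡ a′ × b ≡ b′
    both (inj₁ 2∣b) (inj₁ 2∣b′) = factors-unique
      (cross-coprime (a∣x p) (b∣2+x q) (inj₁ (λ 2∣a → not-both-even p 2∣a 2∣b)))
      (cross-coprime (a∣x q) (b∣2+x p) (inj₁ (λ 2∣a′ → not-both-even q 2∣a′ 2∣b′))) ab≡
    both (inj₁ 2∣b) (inj₂ 4∣a′) = ⊥-elim (mixed p q 2∣b 4∣a′ ab≡)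
    both (inj₂ 4∣a) (inj₁ 2∣b′) = ⊥-elim (mixed q p 2∣b′ 4∣a (sym ab≡))
    both (inj₂ 4∣a) (inj₂ 4∣a′) = factors-unique
      (cross-coprime (a∣x p) (b∣2+x q) (inj₂ (not-both-even q (∣-trans 2∣4 4∣a′))))
      (cross-coprime (a∣x q) (b∣2+x p) (inj₂ (not-both-even p (∣-trans 2∣4 4∣a)))) ab≡

  -- The extra 2 goes where there is room. If b is even, then x is even and a odd, so 2a ∣ x. If 4 ∣
  -- a, then x + 2 is even and b odd, so 2b ∣ x + 2.
  pair⇒divisor : ∀ {x a b} → CoprimePair x a b → ∃ λ d → d ∣ x * (2 + x) × d ⟨ a , b ⟩
  pair⇒divisor {x} {a} {b} p with 2 ∣? b | 4 ∣? a
  ... | yes 2∣b | _ = 2 * (a * b) , subst (_∣ x * (2 + x)) (*-assoc 2 a b) (*-pres-∣ 2a∣x (b∣2+x p))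
      , double (inj₁ 2∣b) refl
    where
    2∣x : 2 ∣ x
    2∣x = ∣m+n∣m⇒∣n (∣-trans 2∣b (b∣2+x p)) ∣-refl
    2a∣x : 2 * a ∣ x
    2a∣x = coprime-*-∣ (odd⇒coprime (λ 2∣a → not-both-even p 2∣a 2∣b)) 2∣x (a∣x p)
  ... | no _ | yes 4∣a = 2 * (a * b) , subst (_∣ x * (2 + x)) (swap a b) (*-pres-∣ (a∣x p) 2b∣2+x)
      , double (inj₂ 4∣a) refl
    where
    swap : ∀ a b → a * (2 * b) ≡ 2 * (a * b)
    swap = solve-∀
    2∣a = ∣-trans 2∣4 4∣a
    2b∣2+x : 2 * b ∣ 2 + x
    2b∣2+x = coprime-*-∣ (odd⇒coprime (not-both-even p 2∣a))
      (∣m∣n⇒∣m+n ∣-refl (∣-trans 2∣a (a∣x p))) (b∣2+x p)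
  ... | no 2∤b | no 4∤a = a * b , *-pres-∣ (a∣x p) (b∣2+x p) , single 2∤b 4∤a refl

  odd-divisor⇒pair : ∀ {x e} → 2 ∤ e → e ∣ x * (2 + x) →
    2 ∤ gcd e x × 2 ∤ gcd e (2 + x) × CoprimePair x (gcd e x) (gcd e (2 + x)) ×
    gcd e x * gcd e (2 + x) ≡ e
  odd-divisor⇒pair {x} {e} 2∤e e∣ =
      (λ 2∣a → 2∤e (∣-trans 2∣a (gcd[m,n]∣m e x)))
    , 2∤b
    , pair (gcd[m,n]∣n e x) (gcd[m,n]∣n e (2 + x)) c
    , coprime-gcd-* e∣ c
    where
    2∤b : 2 ∤ gcd e (2 + x)
    2∤b 2∣b = 2∤e (∣-trans 2∣b (gcd[m,n]∣m e (2 + x)))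
    c = cross-coprime (gcd[m,n]∣n e x) (gcd[m,n]∣n e (2 + x)) (inj₂ 2∤b)

  even-x : ∀ {x} → 2 ∣ x * (2 + x) → 2 ∣ x
  even-x {x} 2∣ with 2∣* x (2 + x) 2∣
  ... | inj₁ 2∣x = 2∣x
  ... | inj₂ 2∣2+x = ∣m+n∣m⇒∣n 2∣2+x ∣-refl

  -- With x = 2m the product is 4m(m + 1), and m, m + 1 are coprime, so c = st. Of the factor 4, one
  -- 2 joins s if s is even and t otherwise, which keeps the pair coprime; the other is the 2 of
  -- `double`.
  4*divisor⇒pair : ∀ m c → c ∣ m * (1 + m) → ∃₂ λ a b → CoprimePair (m * 2) a b × (c * 2 * 2) ⟨ a , b ⟩
  4*divisor⇒pair m c c∣ = byParity (2 ∣? s)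
    where
    s = gcd c m
    t = gcd c (1 + m)
    s∣m = gcd[m,n]∣n c m
    t∣1+m = gcd[m,n]∣n c (1 + m)
    s⊥t : Coprime s t
    s⊥t {k} (k∣s , k∣t) = ∣1⇒≡1 (∣m+n∣m⇒∣n
      (subst (k ∣_) (+-comm 1 m) (∣-trans k∣t t∣1+m)) (∣-trans k∣s s∣m))
    4c≡ : ∀ {r} → s * t * 2 * 2 ≡ r → c * 2 * 2 ≡ r
    4c≡ = trans (cong (λ r → r * 2 * 2) (sym (coprime-gcd-* c∣ s⊥t)))
    1≢2 : 1 ≢ 2
    1≢2 ()
    lemma₁ : ∀ s t → s * t * 2 * 2 ≡ 2 * (2 * s * t)
    lemma₁ = solve-∀
    lemma₂ : ∀ s t → s * t * 2 * 2 ≡ 2 * (s * (2 * t))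
    lemma₂ = solve-∀
    byParity : Dec (2 ∣ s) → ∃₂ λ a b → CoprimePair (m * 2) a b × (c * 2 * 2) ⟨ a , b ⟩
    byParity (yes 2∣s) = 2 * s , t ,
      pair (subst (2 * s ∣_) (*-comm 2 m) (*-monoʳ-∣ 2 s∣m))
        (∣-trans t∣1+m (divides 2 (*-comm (1 + m) 2)))
        (coprime-2* (λ 2∣t → 1≢2 (sym (s⊥t (2∣s , 2∣t)))) s⊥t) ,
      double (inj₂ (*-monoʳ-∣ {2} {s} 2 2∣s)) (4c≡ (lemma₁ s t))
    byParity (no 2∤s) = s , 2 * t ,
      pair (∣-trans s∣m (m∣m*n 2))
        (subst (2 * t ∣_) (*-comm 2 (1 + m)) (*-monoʳ-∣ 2 t∣1+m))
        (Coprime.sym (coprime-2* 2∤s (Coprime.sym s⊥t))) ,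
      double (inj₁ (m∣m*n t)) (4c≡ (lemma₂ s t))

  double-pair : ∀ {x a b} e → 2 ∤ a → 2 ∤ b → CoprimePair x a b → a * b ≡ e → 2 ∣ x →
    CoprimePair x (2 * a) b × (e * 2) ⟨ 2 * a , b ⟩
  double-pair {x} {a} {b} e 2∤a 2∤b p refl 2∣x =
      pair (coprime-*-∣ (odd⇒coprime 2∤a) 2∣x (a∣x p)) (b∣2+x p) (coprime-2* 2∤b (coprime p)) ,
      single 2∤b (λ 4∣2a → 2∤a (*-cancelˡ-∣ {2} {a} 2 4∣2a)) (lemma a b)
    where
    lemma : ∀ a b → a * b * 2 ≡ 2 * a * b
    lemma = solve-∀

  4*divisor⇒pair-even : ∀ {x} c → 2 ∣ x → c * 2 * 2 ∣ x * (2 + x) →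
    ∃₂ λ a b → CoprimePair x a b × (c * 2 * 2) ⟨ a , b ⟩
  4*divisor⇒pair-even c (divides m refl) d∣ =
    4*divisor⇒pair m c (*-cancelˡ-∣ 4 (subst₂ _∣_ (lemma₁ c) (lemma₂ m) d∣))
    where
    lemma₁ : ∀ c → c * 2 * 2 ≡ 4 * c
    lemma₁ = solve-∀
    lemma₂ : ∀ m → m * 2 * (2 + m * 2) ≡ 4 * (m * (1 + m))
    lemma₂ = solve-∀

  -- Cases by the power of 2 in d: an odd d splits by gcds, twice an odd number puts its 2 into a,
  -- and a multiple of 4 is treated through m(m + 1) with x = 2m.
  divisor⇒pair : ∀ {x d} → d ∣ x * (2 + x) → ∃₂ λ a b → CoprimePair x a b × d ⟨ a , b ⟩
  divisor⇒pair {x} {d} d∣ = byParity (2 ∣? d)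
    where
    byParity₂ : ∀ e → e * 2 ∣ x * (2 + x) → Dec (2 ∣ e) →
      ∃₂ λ a b → CoprimePair x a b × (e * 2) ⟨ a , b ⟩
    byParity₂ _ d∣ (yes (divides c refl)) = 4*divisor⇒pair-even c (even-x {x} (m*n∣⇒n∣ (c * 2) 2 d∣)) d∣
    byParity₂ e d∣ (no 2∤e) =
      let 2∤a , 2∤b , p , eq = odd-divisor⇒pair {x} 2∤e (m*n∣⇒m∣ e 2 d∣)
      in _ , _ , double-pair e 2∤a 2∤b p eq (even-x {x} (m*n∣⇒n∣ e 2 d∣))
    byParity : Dec (2 ∣ d) → ∃₂ λ a b → CoprimePair x a b × d ⟨ a , b ⟩
    byParity (yes (divides e refl)) = byParity₂ e d∣ (2 ∣? e)
    byParity (no 2∤d) =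
      let 2∤a , 2∤b , p , e = odd-divisor⇒pair {x} 2∤d d∣
      in gcd d x , gcd d (2 + x) , p , single 2∤b (λ 4∣a → 2∤a (∣-trans 2∣4 4∣a)) (sym e)

  -- Chinese remainders

  crt : ∀ {a b} → 1 ≤ b → Coprime a b → ∃ λ x → a ∣ x × b ∣ 2 + x
  crt {a} {suc b} _ c with coprime-Bézout c
  -- Here ua ≡ 1 modulo `suc b`, and -2 is represented by 2 * b. In the other case ua ≡ -1, so
  -- doubling it is enough.
  ... | Bézout.+- u v e = u * a * (2 * b) , ∣m⇒∣m*n (2 * b) (n∣m*n u) ,
    divides (2 + v * (2 * b)) (trans (cong (λ t → 2 + t * (2 * b)) (sym e)) (lemma v b))
    where
    lemma : ∀ v b → 2 + (1 + v * suc b) * (2 * b) ≡ (2 + v * (2 * b)) * suc b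
    lemma = solve-∀
  ... | Bézout.-+ u v e = 2 * (u * a) , ∣n⇒∣m*n 2 (n∣m*n u) ,
    divides (2 * v) (trans (lemma (u * a)) (trans (cong (2 *_) e) (sym (*-assoc 2 v (suc b)))))
    where
    lemma : ∀ t → 2 + 2 * t ≡ 2 * (1 + t)
    lemma = solve-∀

  -- Together with `crt-unique`: each block of ab integers starting at a multiple of ab holds
  -- exactly one admissible x, so the admissible x are numbered by blocks.
  crt-block : ∀ {a b} k → 1 ≤ a → 1 ≤ b → Coprime a b →
    ∃ λ x → CoprimePair x a b × k * (a * b) ≤ x × x < suc k * (a * b)
  crt-block {a} {b} k 1≤a 1≤b c with crt 1≤b c
  ... | y , a∣y , b∣2+y = r + k * n
    , pair (∣m∣n⇒∣m+n (%-presˡ-∣ a∣y (m∣m*n b)) (∣n⇒∣m*n k (m∣m*n b)))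
        (subst (b ∣_) (+-assoc 2 r (k * n)) (∣m∣n⇒∣m+n b∣2+r (∣n⇒∣m*n k (n∣m*n a)))) c
    , m≤n+m (k * n) r
    , +-monoˡ-< (k * n) (m%n<n y n)
    where
    n = a * b
    instance
      n≢0 : NonZero n
      n≢0 = >-nonZero (*-mono-≤ 1≤a 1≤b)
    r = y % n
    b∣2+r : b ∣ 2 + r
    b∣2+r = ∣m+n∣m⇒∣n
      (subst (b ∣_) (trans (cong (2 +_) (m≡m%n+[m/n]*n y n)) (lemma r (y / n * n))) b∣2+y)
      (∣n⇒∣m*n (y / n) (n∣m*n a))
      where
      lemma : ∀ r s → 2 + (r + s) ≡ s + (2 + r)
      lemma = solve-∀

  crt-unique-≤ : ∀ {a b x x′} k → CoprimePair x a b → CoprimePair x′ a b →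
    k * (a * b) ≤ x → x′ < suc k * (a * b) → x ≤ x′ → x ≡ x′
  crt-unique-≤ {a} {b} {x} {x′} k p q lo hi x≤x′ with x′ ∸ x in eq
  ... | zero = ≤-antisym x≤x′ (m∸n≡0⇒m≤n eq)
  ... | suc e = ⊥-elim (<-irrefl refl (<-≤-trans e<ab (∣⇒≤ ab∣e)))
    where
    x′≡ : x′ ≡ x + suc e
    x′≡ = sym (trans (cong (x +_) (sym eq)) (m+[n∸m]≡n x≤x′))
    ab∣e : a * b ∣ suc e
    ab∣e = coprime-*-∣ (coprime p)
      (∣m+n∣m⇒∣n (subst (a ∣_) x′≡ (a∣x q)) (a∣x p))
      (∣m+n∣m⇒∣n (subst (b ∣_) (cong (2 +_) x′≡) (b∣2+x q)) (b∣2+x p))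
    e<ab : suc e < a * b
    e<ab = +-cancelˡ-< x (suc e) (a * b) (<-≤-trans (subst (_< suc k * (a * b)) x′≡ hi)
      (subst (suc k * (a * b) ≤_) (+-comm (a * b) x) (+-monoʳ-≤ (a * b) lo)))

  crt-unique : ∀ {a b x x′} k → CoprimePair x a b → CoprimePair x′ a b →
    k * (a * b) ≤ x → x < suc k * (a * b) → k * (a * b) ≤ x′ → x′ < suc k * (a * b) → x ≡ x′
  crt-unique {x = x} {x′} k p q lo hi lo′ hi′ with ≤-total x x′
  ... | inj₁ x≤x′ = crt-unique-≤ k p q lo hi′ x≤x′
  ... | inj₂ x′≤x = sym (crt-unique-≤ k q p lo′ hi x′≤x)

open import Data.Bool using (Bool; true; false)
open import Data.Empty using (⊥-elim)
open import Data.List using (List; []; _∷_; _++_; map; filter; length; upTo)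
open import Data.List.Membership.Propositional using (_∈_)
open import Data.List.Membership.Propositional.Properties
  using (∈-++⁺ˡ; ∈-++⁺ʳ; ∈-++⁻; ∈-map⁺; ∈-map⁻; ∈-filter⁺; ∈-filter⁻; ∈-upTo⁺; ∈-upTo⁻)
open import Data.List.Relation.Unary.All as All using ()
open import Data.List.Relation.Unary.AllPairs as AllPairs using ([]; _∷_)
open import Data.List.Relation.Unary.Any using (here; there)
open import Data.List.Relation.Unary.Unique.Propositional using (Unique)
import Data.List.Relation.Unary.Unique.Propositional.Properties as Unique
open import Data.Maybe using (Maybe; just; nothing)
open import Data.Nat using (ℕ; zero; suc)
import Data.Nat as ℕ
open import Data.Nat.Coprimality using (Coprime; coprime?; coprime-/gcd; coprime⇒gcd≡1)
open import Data.Nat.Divisibility using (_∣_; divides; _∣?_; ∣⇒≤)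
import Data.Nat.DivMod as ℕD
open import Data.Nat.GCD using (gcd; gcd[m,n]∣m; gcd[m,n]∣n; c*gcd[m,n]≡gcd[cm,cn])
import Data.Nat.ListAction as ℕL
import Data.Nat.Properties as ℕP
import Data.Nat.Tactic.RingSolver as ℕ-Solver
open import Data.Product using (Σ; ∃; _×_; _,_; proj₁; proj₂)
open import Data.Rational
open import Data.Rational.Properties
open import Data.Sum using (inj₁; inj₂)
open import Relation.Binary.PropositionalEquality
open import Relation.Nullary using (¬_; yes; no)
open import Relation.Unary using (Decidable)
open import Tactic.RingSolver using (solve-∀)
open import Tactic.RingSolver.Core.AlmostCommutativeRing
  using (AlmostCommutativeRing; fromCommutativeRing)

open Divisors

-- Rational arithmetic

ℚ-ring : AlmostCommutativeRing _ _
ℚ-ring = fromCommutativeRing +-*-commutativeRing isZero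
  where
  isZero : ∀ p → Maybe (0ℚ ≡ p)
  isZero p with 0ℚ ≟ p
  ... | yes e = just e
  ... | no _ = nothing

0≤+ : ∀ {a b} → 0ℚ ≤ a → 0ℚ ≤ b → 0ℚ ≤ a + b
0≤+ p q = +-mono-≤ p q

*-monoˡ : ∀ c {a b} → 0ℚ ≤ c → a ≤ b → c * a ≤ c * b
*-monoˡ c 0≤c = *-monoˡ-≤-nonNeg c {{nonNegative 0≤c}}

*-monoʳ : ∀ c {a b} → 0ℚ ≤ c → a ≤ b → a * c ≤ b * c
*-monoʳ c 0≤c = *-monoʳ-≤-nonNeg c {{nonNegative 0≤c}}

*-cancelˡ : ∀ c {a b} → 0ℚ < c → c * a ≤ c * b → a ≤ b
*-cancelˡ c 0<c = *-cancelˡ-≤-pos c {{positive 0<c}}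

≤-by : ∀ {a b} c → 0ℚ ≤ c → b ≡ a + c → a ≤ b
≤-by {a} {b} c 0≤c e = subst₂ _≤_ (+-identityʳ a) (sym e) (+-monoʳ-≤ a 0≤c)

-- Linear arithmetic: an inequality is a nonnegative combination of others,
-- and an equation a combination of others, up to a ring identity.
≤-comb₁ : ∀ {a b p q} c → 0ℚ ≤ c → p ≤ q → b - a ≡ c * (q - p) → a ≤ b
≤-comb₁ {a} {b} {p} {q} c 0≤c p≤q e = ≤-by (c * (q - p)) (0≤* 0≤c (p≤q⇒0≤q-p p≤q))
  (trans (lemma a b) (cong (λ t → a + t) e))
  where
  lemma : ∀ a b → b ≡ a + (b - a)
  lemma = solve-∀ ℚ-ring

≤-comb₂ : ∀ {a b p q r s} c e → 0ℚ ≤ c → 0ℚ ≤ e → p ≤ q → r ≤ s →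
  b - a ≡ c * (q - p) + e * (s - r) → a ≤ b
≤-comb₂ {a} {b} {p} {q} {r} {s} c e 0≤c 0≤e p≤q r≤s eq =
  ≤-by (c * (q - p) + e * (s - r))
    (0≤+ (0≤* 0≤c (p≤q⇒0≤q-p p≤q)) (0≤* 0≤e (p≤q⇒0≤q-p r≤s)))
    (trans (lemma a b) (cong (λ t → a + t) eq))
  where
  lemma : ∀ a b → b ≡ a + (b - a)
  lemma = solve-∀ ℚ-ring

≤-comb₃ : ∀ {a b p q r s u v} c e f → 0ℚ ≤ c → 0ℚ ≤ e → 0ℚ ≤ f → p ≤ q → r ≤ s → u ≤ v →
  b - a ≡ c * (q - p) + e * (s - r) + f * (v - u) → a ≤ b
≤-comb₃ {a} {b} {p} {q} {r} {s} {u} {v} c e f 0≤c 0≤e 0≤f p≤q r≤s u≤v eq =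
  ≤-comb₂ 1ℚ f (<⇒≤ 0<1) 0≤f
    (0≤+ (0≤* 0≤c (p≤q⇒0≤q-p p≤q)) (0≤* 0≤e (p≤q⇒0≤q-p r≤s))) u≤v
    (trans eq (lemma (c * (q - p) + e * (s - r)) (f * (v - u))))
  where
  lemma : ∀ x y → x + y ≡ 1ℚ * (x - 0ℚ) + y
  lemma = solve-∀ ℚ-ring

≡-comb₁ : ∀ {a b p q} c → p ≡ q → a - b ≡ c * (p - q) → a ≡ b
≡-comb₁ {a} {b} {p} c refl e = trans (lemma a b) (trans (cong (λ t → t + b) e) (lemma′ c p b))
  where
  lemma : ∀ a b → a ≡ (a - b) + b
  lemma = solve-∀ ℚ-ring
  lemma′ : ∀ c p b → c * (p - p) + b ≡ b
  lemma′ = solve-∀ ℚ-ring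

≡-comb₂ : ∀ {a b p q r s} c e → p ≡ q → r ≡ s → a - b ≡ c * (p - q) + e * (r - s) → a ≡ b
≡-comb₂ {a} {b} {p} {_} {r} c e refl refl eq =
  trans (lemma a b) (trans (cong (λ t → t + b) eq) (lemma′ c p e r b))
  where
  lemma : ∀ a b → a ≡ (a - b) + b
  lemma = solve-∀ ℚ-ring
  lemma′ : ∀ c p e r b → c * (p - p) + e * (r - r) + b ≡ b
  lemma′ = solve-∀ ℚ-ring

∣p∣≤ : ∀ {p b} → p ≤ b → - p ≤ b → ∣ p ∣ ≤ b
∣p∣≤ {p} {b} u v with ∣p∣≡p∨∣p∣≡-p p
... | inj₁ e = subst (_≤ b) (sym e) u
... | inj₂ e = subst (_≤ b) (sym e) v

-∣p∣≤p : ∀ p → - p ≤ ∣ p ∣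
-∣p∣≤p p = subst (- p ≤_) (∣-p∣≡∣p∣ p) (p≤∣p∣ (- p))

≤∣-∣ : ∀ {x y b} → ∣ x - y ∣ ≤ b → x ≤ y + b × y ≤ x + b
≤∣-∣ {x} {y} {b} le =
    ≤-comb₁ 1ℚ (<⇒≤ 0<1) (≤-trans (p≤∣p∣ (x - y)) le) (lemma x y b)
  , ≤-comb₁ 1ℚ (<⇒≤ 0<1) (≤-trans (-∣p∣≤p (x - y)) le) (lemma′ x y b)
  where
  lemma : ∀ x y b → y + b - x ≡ 1ℚ * (b - (x - y))
  lemma = solve-∀ ℚ-ring
  lemma′ : ∀ x y b → x + b - y ≡ 1ℚ * (b - (- (x - y)))
  lemma′ = solve-∀ ℚ-ring

0≤square : ∀ p → 0ℚ ≤ p * p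
0≤square p with ≤-total 0ℚ p
... | inj₁ 0≤p = 0≤* 0≤p 0≤p
... | inj₂ p≤0 = subst (0ℚ ≤_) (lemma p) (0≤* (p≤q⇒0≤q-p p≤0) (p≤q⇒0≤q-p p≤0))
  where
  lemma : ∀ p → (0ℚ - p) * (0ℚ - p) ≡ p * p
  lemma = solve-∀ ℚ-ring

inverseʳ : ∀ {p} → 0ℚ < p → p * inv p ≡ 1ℚ
inverseʳ {p} 0<p = p*inv[p]≡1 p {{>-nonZero 0<p}}

inv-unique : ∀ {x y} → 0ℚ < x → x * y ≡ 1ℚ → y ≡ inv x
inv-unique {x} {y} 0<x e = ≡-comb₂ (inv x) (- y) e (inverseʳ 0<x) (lemma x y (inv x))
  where
  lemma : ∀ x y i → y - i ≡ i * (x * y - 1ℚ) + (- y) * (x * i - 1ℚ)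
  lemma = solve-∀ ℚ-ring

inv-* : ∀ {x y} → 0ℚ < x → 0ℚ < y → inv (x * y) ≡ inv x * inv y
inv-* {x} {y} 0<x 0<y = sym (inv-unique (0<* 0<x 0<y)
  (≡-comb₂ (y * inv y) 1ℚ (inverseʳ 0<x) (inverseʳ 0<y) (lemma x y (inv x) (inv y))))
  where
  lemma : ∀ x y i j → x * y * (i * j) - 1ℚ ≡ y * j * (x * i - 1ℚ) + 1ℚ * (y * j - 1ℚ)
  lemma = solve-∀ ℚ-ring

0<ℕ→ℚ : ∀ {n} → 1 ℕ.≤ n → 0ℚ < ℕ→ℚ n
0<ℕ→ℚ {suc n} _ = 0<suc n

recip : ℕ → ℚ
recip n = inv (ℕ→ℚ n)

0≤recip : ∀ n → 0ℚ ≤ recip n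
0≤recip zero = ≤-refl
0≤recip (suc n) = <⇒≤ (0<inv (0<suc n))

0<recip : ∀ {n} → 1 ℕ.≤ n → 0ℚ < recip n
0<recip 1≤n = 0<inv (0<ℕ→ℚ 1≤n)

recip-inverse : ∀ {n} → 1 ℕ.≤ n → ℕ→ℚ n * recip n ≡ 1ℚ
recip-inverse 1≤n = inverseʳ (0<ℕ→ℚ 1≤n)

recip-* : ∀ m n → recip (m ℕ.* n) ≡ recip m * recip n
recip-* zero n = sym (*-zeroˡ (recip n))
recip-* (suc m) zero = trans (cong recip (ℕP.*-zeroʳ (suc m))) (sym (*-zeroʳ (recip (suc m))))
recip-* (suc m) (suc n) = trans (cong inv (ℕ→ℚ-* (suc m) (suc n))) (inv-* (0<suc m) (0<suc n))

recip-anti : ∀ {m n} → 1 ℕ.≤ m → m ℕ.≤ n → recip n ≤ recip m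
recip-anti 1≤m m≤n = inv-anti (0<ℕ→ℚ 1≤m) (ℕ→ℚ-mono m≤n)

recip≤1 : ∀ n → recip n ≤ 1ℚ
recip≤1 zero = <⇒≤ 0<1
recip≤1 (suc n) = recip-anti {1} {suc n} ℕP.≤-refl (ℕ.s≤s ℕ.z≤n)

-- Sums over lists

private variable
  X Y : Set

∑ : List X → (X → ℚ) → ℚ
∑ [] f = 0ℚ
∑ (x ∷ xs) f = f x + ∑ xs f

∑-≤ : ∀ (xs : List X) {f g} → (∀ {x} → x ∈ xs → f x ≤ g x) → ∑ xs f ≤ ∑ xs g
∑-≤ [] p = ≤-refl
∑-≤ (x ∷ xs) p = +-mono-≤ (p (here refl)) (∑-≤ xs (λ m → p (there m)))

∑-cong : ∀ (xs : List X) {f g} → (∀ {x} → x ∈ xs → f x ≡ g x) → ∑ xs f ≡ ∑ xs g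
∑-cong [] p = refl
∑-cong (x ∷ xs) p = cong₂ _+_ (p (here refl)) (∑-cong xs (λ m → p (there m)))

∑-++ : ∀ (xs {ys} : List X) f → ∑ (xs ++ ys) f ≡ ∑ xs f + ∑ ys f
∑-++ [] f = sym (+-identityˡ _)
∑-++ (x ∷ xs) {ys} f = trans (cong (f x +_) (∑-++ xs f)) (sym (+-assoc (f x) (∑ xs f) (∑ ys f)))

∑-+ : ∀ (xs : List X) f g → ∑ xs (λ x → f x + g x) ≡ ∑ xs f + ∑ xs g
∑-+ [] f g = refl
∑-+ (x ∷ xs) f g = trans (cong (f x + g x +_) (∑-+ xs f g)) (lemma (f x) (g x) (∑ xs f) (∑ xs g))
  where
  lemma : ∀ a b c e → a + b + (c + e) ≡ a + c + (b + e)
  lemma = solve-∀ ℚ-ring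

∑-*ˡ : ∀ (xs : List X) c f → ∑ xs (λ x → c * f x) ≡ c * ∑ xs f
∑-*ˡ [] c f = sym (*-zeroʳ c)
∑-*ˡ (x ∷ xs) c f = trans (cong (c * f x +_) (∑-*ˡ xs c f)) (sym (*-distribˡ-+ c (f x) (∑ xs f)))

∑-*ʳ : ∀ (xs : List X) c f → ∑ xs (λ x → f x * c) ≡ ∑ xs f * c
∑-*ʳ xs c f = trans (∑-cong xs (λ {x} _ → *-comm (f x) c)) (trans (∑-*ˡ xs c f) (*-comm c (∑ xs f)))

∑-map : ∀ (k : X → Y) xs f → ∑ (map k xs) f ≡ ∑ xs (λ x → f (k x))
∑-map k [] f = refl
∑-map k (x ∷ xs) f = cong (f (k x) +_) (∑-map k xs f)

0≤∑ : ∀ (xs : List X) {f} → (∀ x → 0ℚ ≤ f x) → 0ℚ ≤ ∑ xs f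
0≤∑ [] p = ≤-refl
0≤∑ (x ∷ xs) p = 0≤+ (p x) (0≤∑ xs p)

∑-length : ∀ (xs : List X) → ∑ xs (λ _ → 1ℚ) ≡ ℕ→ℚ (length xs)
∑-length [] = refl
∑-length (x ∷ xs) = trans (cong (1ℚ +_) (∑-length xs)) (sym (ℕ→ℚ-suc (length xs)))

∑-sum : ∀ (xs : List X) (f : X → ℕ) → ℕ→ℚ (ℕL.sum (map f xs)) ≡ ∑ xs (λ x → ℕ→ℚ (f x))
∑-sum [] f = refl
∑-sum (x ∷ xs) f = trans (ℕ→ℚ-+ (f x) _) (cong (ℕ→ℚ (f x) +_) (∑-sum xs f))

∑-remove : ∀ {y : Y} {ys} (g : Y → ℚ) → y ∈ ys →
  ∃ λ zs → ∑ ys g ≡ g y + ∑ zs g × (∀ {z} → z ∈ ys → z ≢ y → z ∈ zs)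
∑-remove {y = y} {_ ∷ ys} g (here refl) = ys , refl , λ
  { (here e) z≢y → ⊥-elim (z≢y e)
  ; (there m) _ → m }
∑-remove {y = y} {x ∷ ys} g (there m) with ∑-remove g m
... | zs , e , keep = x ∷ zs , trans (cong (g x +_) e) (lemma (g x) (g y) (∑ zs g)) , λ
  { (here refl) _ → here refl
  ; (there n) z≢y → there (keep n z≢y) }
  where
  lemma : ∀ a b c → a + (b + c) ≡ b + (a + c)
  lemma = solve-∀ ℚ-ring

-- The counting principle used throughout. Matching by a relation lets existence lemmas supply the
-- partners; a partner is removed from `ys` once used, and unmatched terms only help since g ≥ 0.
∑-inject : ∀ {f : X → ℚ} {g : Y → ℚ} {xs : List X} {ys : List Y} (_~_ : X → Y → Set) →
  Unique xs → (∀ y → 0ℚ ≤ g y) →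
  (∀ {x} → x ∈ xs → ∃ λ y → y ∈ ys × x ~ y × f x ≤ g y) →
  (∀ {x x′ y} → x ~ y → x′ ~ y → x ≡ x′) →
  ∑ xs f ≤ ∑ ys g
∑-inject {xs = []} {ys} _~_ _ 0≤g total inj = 0≤∑ ys 0≤g
∑-inject {f = f} {g} {x ∷ xs} {ys} _~_ (x∉xs ∷ uniq) 0≤g total inj with total (here refl)
... | y , y∈ys , x~y , fx≤gy with ∑-remove g y∈ys
... | zs , e , keep = subst (f x + ∑ xs f ≤_) (sym e)
  (+-mono-≤ fx≤gy (∑-inject _~_ uniq 0≤g total′ inj))
  where
  total′ : ∀ {x′} → x′ ∈ xs → ∃ λ y′ → y′ ∈ zs × x′ ~ y′ × f x′ ≤ g y′
  total′ m with total (there m)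
  ... | y′ , y′∈ys , x′~y′ , le = y′ , keep y′∈ys (λ { refl → All.lookup x∉xs m (inj x~y x′~y′) }) , x′~y′ , le

infixr 5 _⋉_
_⋉_ : List X → (X → List Y) → List (X × Y)
[] ⋉ ys = []
(x ∷ xs) ⋉ ys = map (x ,_) (ys x) ++ (xs ⋉ ys)

∑-⋉ : ∀ (xs : List X) (ys : X → List Y) f → ∑ (xs ⋉ ys) f ≡ ∑ xs (λ x → ∑ (ys x) (λ y → f (x , y)))
∑-⋉ [] ys f = refl
∑-⋉ (x ∷ xs) ys f = trans (∑-++ (map (x ,_) (ys x)) f)
  (cong₂ _+_ (∑-map (x ,_) (ys x) f) (∑-⋉ xs ys f))

∈-⋉⁺ : ∀ {xs : List X} {ys : X → List Y} {x y} → x ∈ xs → y ∈ ys x → (x , y) ∈ xs ⋉ ys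
∈-⋉⁺ {xs = x ∷ xs} (here refl) n = ∈-++⁺ˡ (∈-map⁺ (x ,_) n)
∈-⋉⁺ {xs = x ∷ xs} {ys} (there m) n = ∈-++⁺ʳ (map (x ,_) (ys x)) (∈-⋉⁺ m n)

∈-⋉⁻ : ∀ (xs : List X) {ys : X → List Y} {x y} → (x , y) ∈ xs ⋉ ys → x ∈ xs × y ∈ ys x
∈-⋉⁻ (x ∷ xs) {ys} m with ∈-++⁻ (map (x ,_) (ys x)) m
... | inj₁ n with ∈-map⁻ (x ,_) n
...   | _ , y∈ , refl = here refl , y∈
∈-⋉⁻ (x ∷ xs) m | inj₂ n with ∈-⋉⁻ xs n
... | p , q = there p , q

Unique-⋉ : ∀ {xs : List X} {ys : X → List Y} → Unique xs → (∀ x → Unique (ys x)) → Unique (xs ⋉ ys)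
Unique-⋉ [] u = []
Unique-⋉ {xs = x ∷ xs} {ys} (x∉xs ∷ uniq) u =
  Unique.++⁺ (Unique.map⁺ (cong proj₂) (u x)) (Unique-⋉ uniq u) disjoint
  where
  disjoint : ∀ {v} → ¬ (v ∈ map (x ,_) (ys x) × v ∈ xs ⋉ ys)
  disjoint (m , n) with ∈-map⁻ (x ,_) m
  ... | _ , _ , refl = All.lookup x∉xs (proj₁ (∈-⋉⁻ xs n)) refl

-- Listed downwards, so that sums up to `suc n` release their last term by computation.
range : ℕ → List ℕ
range zero = []
range (suc n) = suc n ∷ range n

∈-range⁺ : ∀ {n i} → 1 ℕ.≤ i → i ℕ.≤ n → i ∈ range n
∈-range⁺ {zero} {suc i} _ ()
∈-range⁺ {suc n} {i} 1≤i i≤n with ℕP.m≤n⇒m<n∨m≡n i≤n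
... | inj₁ i<n = there (∈-range⁺ 1≤i (ℕ.s≤s⁻¹ i<n))
... | inj₂ refl = here refl

∈-range⁻ : ∀ {n i} → i ∈ range n → 1 ℕ.≤ i × i ℕ.≤ n
∈-range⁻ {suc n} (here refl) = ℕ.s≤s ℕ.z≤n , ℕP.≤-refl
∈-range⁻ {suc n} (there m) with ∈-range⁻ m
... | p , q = p , ℕP.m≤n⇒m≤1+n q

Unique-range : ∀ n → Unique (range n)
Unique-range zero = []
Unique-range (suc n) =
  All.tabulate (λ m e → ℕP.<-irrefl (sym e) (ℕ.s≤s (proj₂ (∈-range⁻ m)))) ∷ Unique-range n

∑-const-range : ∀ n c → ∑ (range n) (λ _ → c) ≡ ℕ→ℚ n * c
∑-const-range zero c = sym (*-zeroˡ c)
∑-const-range (suc n) c = trans (cong (c +_) (∑-const-range n c))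
  (trans (lemma c (ℕ→ℚ n)) (cong (_* c) (sym (ℕ→ℚ-suc n))))
  where
  lemma : ∀ c n → c + n * c ≡ (1ℚ + n) * c
  lemma = solve-∀ ℚ-ring

∑-range-+ : ∀ m k f → ∑ (range (k ℕ.+ m)) f ≡ ∑ (range m) f + ∑ (range k) (λ j → f (j ℕ.+ m))
∑-range-+ m zero f = sym (+-identityʳ _)
∑-range-+ m (suc k) f = trans (cong (f (suc k ℕ.+ m) +_) (∑-range-+ m k f))
  (lemma (f (suc k ℕ.+ m)) (∑ (range m) f) (∑ (range k) (λ j → f (j ℕ.+ m))))
  where
  lemma : ∀ a b c → a + (b + c) ≡ b + (a + c)
  lemma = solve-∀ ℚ-ring

∑-range-mono : ∀ {m n} f → (∀ i → 0ℚ ≤ f i) → m ℕ.≤ n → ∑ (range m) f ≤ ∑ (range n) f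
∑-range-mono {m} {n} f 0≤f m≤n = subst (λ t → ∑ (range m) f ≤ ∑ (range t) f) (ℕP.m∸n+n≡m m≤n)
  (≤-by (∑ (range (n ℕ.∸ m)) (λ j → f (j ℕ.+ m))) (0≤∑ (range (n ℕ.∸ m)) (λ j → 0≤f _))
    (∑-range-+ m (n ℕ.∸ m) f))

-- Reduction to P

-- Junk value 0 at m = 0.
quot : ℕ → ℕ → ℕ
quot N zero = 0
quot N (suc m) = N ℕ./ suc m

quot*≤ : ∀ N m → quot N m ℕ.* m ℕ.≤ N
quot*≤ N zero = ℕ.z≤n
quot*≤ N (suc m) = ℕD.m/n*n≤m N (suc m)

<suc-quot* : ∀ N {m} → 1 ℕ.≤ m → N ℕ.< suc (quot N m) ℕ.* m
<suc-quot* N {suc m} _ = subst (ℕ._< suc (N ℕ./ suc m) ℕ.* suc m)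
  (sym (ℕD.m≡m%n+[m/n]*n N (suc m))) (ℕP.+-monoˡ-< (N ℕ./ suc m ℕ.* suc m) (ℕD.m%n<n N (suc m)))

≤quot : ∀ {N m k} → 1 ℕ.≤ m → k ℕ.* m ℕ.≤ N → k ℕ.≤ quot N m
≤quot {N} {m} {k} 1≤m km≤N = ℕ.s≤s⁻¹ (ℕP.*-cancelʳ-< m k (suc (quot N m))
  (ℕP.≤-<-trans km≤N (<suc-quot* N 1≤m)))

quot≤ : ∀ N {m} → 1 ℕ.≤ m → ℕ→ℚ (quot N m) ≤ ℕ→ℚ N * recip m
quot≤ N {m} 1≤m = *-cancelˡ (ℕ→ℚ m) (0<ℕ→ℚ 1≤m) (subst₂ _≤_
  (trans (ℕ→ℚ-* (quot N m) m) (*-comm (ℕ→ℚ (quot N m)) (ℕ→ℚ m)))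
  (≡-comb₁ (- ℕ→ℚ N) (recip-inverse 1≤m) (lemma (ℕ→ℚ N) (ℕ→ℚ m) (recip m)))
  (ℕ→ℚ-mono (quot*≤ N m)))
  where
  lemma : ∀ n m r → n - m * (n * r) ≡ (- n) * (m * r - 1ℚ)
  lemma = solve-∀ ℚ-ring

≤quot+1 : ∀ N {m} → 1 ℕ.≤ m → ℕ→ℚ N * recip m ≤ ℕ→ℚ (quot N m) + 1ℚ
≤quot+1 N {m} 1≤m = *-cancelˡ (ℕ→ℚ m) (0<ℕ→ℚ 1≤m) (subst₂ _≤_
  (≡-comb₁ (- ℕ→ℚ N) (recip-inverse 1≤m) (lemma (ℕ→ℚ N) (ℕ→ℚ m) (recip m)))
  (trans (ℕ→ℚ-* (suc (quot N m)) m) (trans (cong (_* ℕ→ℚ m) (ℕ→ℚ-suc (quot N m)))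
    (lemma′ (ℕ→ℚ (quot N m)) (ℕ→ℚ m))))
  (ℕ→ℚ-mono (ℕP.<⇒≤ (<suc-quot* N 1≤m))))
  where
  lemma : ∀ n m r → n - m * (n * r) ≡ (- n) * (m * r - 1ℚ)
  lemma = solve-∀ ℚ-ring
  lemma′ : ∀ q m → (1ℚ + q) * m ≡ m * (q + 1ℚ)
  lemma′ = solve-∀ ℚ-ring

-- Pairs with bounded product, and small divisors

pairs : ℕ → List (ℕ × ℕ)
pairs N = range N ⋉ λ s → range (quot N s)

∈-pairs⁺ : ∀ {N s t} → 1 ℕ.≤ s → 1 ℕ.≤ t → s ℕ.* t ℕ.≤ N → (s , t) ∈ pairs N
∈-pairs⁺ {N} {s} {t} 1≤s 1≤t st≤N = ∈-⋉⁺
  (∈-range⁺ 1≤s (ℕP.≤-trans (ℕP.m≤m*n s t {{ℕ.>-nonZero 1≤t}}) st≤N))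
  (∈-range⁺ 1≤t (≤quot 1≤s (subst (ℕ._≤ N) (ℕP.*-comm s t) st≤N)))

∈-pairs⁻ : ∀ {N s t} → (s , t) ∈ pairs N → 1 ℕ.≤ s × 1 ℕ.≤ t × s ℕ.* t ℕ.≤ N
∈-pairs⁻ {N} {s} {t} m with ∈-⋉⁻ (range N) m
... | p , q = proj₁ (∈-range⁻ p) , proj₁ (∈-range⁻ q) ,
  ℕP.≤-trans (subst (s ℕ.* t ℕ.≤_) (ℕP.*-comm s (quot N s)) (ℕP.*-monoʳ-≤ s (proj₂ (∈-range⁻ q)))) (quot*≤ N s)

Unique-pairs : ∀ N → Unique (pairs N)
Unique-pairs N = Unique-⋉ (Unique-range N) (λ s → Unique-range (quot N s))

coprime²? : Decidable (λ (p : ℕ × ℕ) → Coprime (proj₁ p) (proj₂ p))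
coprime²? (a , b) = coprime? a b

coprimePairs : ℕ → List (ℕ × ℕ)
coprimePairs N = filter coprime²? (pairs N)

∈-coprimePairs⁺ : ∀ {N a b} → 1 ℕ.≤ a → 1 ℕ.≤ b → a ℕ.* b ℕ.≤ N → Coprime a b → (a , b) ∈ coprimePairs N
∈-coprimePairs⁺ 1≤a 1≤b ab≤N c = ∈-filter⁺ coprime²? (∈-pairs⁺ 1≤a 1≤b ab≤N) c

∈-coprimePairs⁻ : ∀ {N a b} → (a , b) ∈ coprimePairs N →
  (1 ℕ.≤ a × 1 ℕ.≤ b × a ℕ.* b ℕ.≤ N) × Coprime a b
∈-coprimePairs⁻ {N} {a} {b} m =
  ∈-pairs⁻ {N} (proj₁ split) , λ {i} → proj₂ split {i}
  where
  split : (a , b) ∈ pairs N × Coprime a b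
  split = ∈-filter⁻ coprime²? m

Unique-coprimePairs : ∀ N → Unique (coprimePairs N)
Unique-coprimePairs N = Unique.filter⁺ coprime²? (Unique-pairs N)

weight : ℕ × ℕ → ℚ
weight (a , b) = recip a * recip b

0≤weight : ∀ p → 0ℚ ≤ weight p
0≤weight (a , b) = 0≤* (0≤recip a) (0≤recip b)

P F : ℕ → ℚ
P N = ∑ (coprimePairs N) weight
F N = ∑ (pairs N) weight

-- The harmonic numbers, which stand in for log N up to a bounded error.
h : ℕ → ℚ
h n = ∑ (range n) recip

1ᶠ : ∀ {X : Set} → X → ℚ
1ᶠ _ = 1ℚ

0≤1 : ∀ {X : Set} (x : X) → 0ℚ ≤ 1ᶠ x
0≤1 _ = <⇒≤ 0<1

smallDivisors : ℕ → List ℕ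
smallDivisors x = filter (_∣? x ℕ.* (2 ℕ.+ x)) (range x)

smalls : ℕ → List (ℕ × ℕ)
smalls N = range (N ∸ 1) ⋉ smallDivisors

∈-smalls⁺ : ∀ {N x e} → 1 ℕ.≤ x → x ℕ.< N → 1 ℕ.≤ e → e ℕ.≤ x → e ∣ x ℕ.* (2 ℕ.+ x) → (x , e) ∈ smalls N
∈-smalls⁺ {suc N} {x} 1≤x x<N 1≤e e≤x e∣ = ∈-⋉⁺ (∈-range⁺ 1≤x (ℕ.s≤s⁻¹ x<N))
  (∈-filter⁺ (_∣? x ℕ.* (2 ℕ.+ x)) (∈-range⁺ 1≤e e≤x) e∣)

∈-smalls⁻ : ∀ {N x e} → (x , e) ∈ smalls N →
  1 ℕ.≤ x × x ℕ.≤ N × 1 ℕ.≤ e × e ℕ.≤ x × e ∣ x ℕ.* (2 ℕ.+ x)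
∈-smalls⁻ {N} {x} m with ∈-⋉⁻ (range (N ∸ 1)) m
... | p , q with ∈-range⁻ p | ∈-filter⁻ (_∣? x ℕ.* (2 ℕ.+ x)) {xs = range x} q
... | 1≤x , x≤ | r , e∣ with ∈-range⁻ r
... | 1≤e , e≤x = 1≤x , ℕP.≤-trans x≤ (ℕP.m∸n≤m N 1) , 1≤e , e≤x , e∣

Unique-smalls : ∀ N → Unique (smalls N)
Unique-smalls N = Unique-⋉ (Unique-range (N ∸ 1)) λ x → Unique.filter⁺ (_∣? x ℕ.* (2 ℕ.+ x)) (Unique-range x)

Triple : Set
Triple = (ℕ × ℕ) × ℕ

-- x lies in block number k of length ab. For a fixed pair, x and k determine each other; for a
-- fixed x, so do e and the pair.
Match : ℕ × ℕ → ℕ × ℕ → ℕ → Set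
Match (x , e) (a , b) k =
  CoprimePair x a b × e ⟨ a , b ⟩ × k ℕ.* (a ℕ.* b) ℕ.≤ x × x ℕ.< suc k ℕ.* (a ℕ.* b)

Match-unique : ∀ {s s′ p k} → Match s p k → Match s′ p k → s ≡ s′
Match-unique {k = k} (c , d , lo , hi) (c′ , d′ , lo′ , hi′) =
  cong₂ _,_ (crt-unique k c c′ lo hi lo′ hi′) (divisor-unique d d′)

block-index-≤ : ∀ {k k′ m x} → k ℕ.* m ℕ.≤ x → x ℕ.< suc k′ ℕ.* m → k ℕ.≤ k′
block-index-≤ {k} {k′} {m} lo hi = ℕ.s≤s⁻¹ (ℕP.*-cancelʳ-< m k (suc k′) (ℕP.≤-<-trans lo hi))

Match-unique′ : ∀ {s p p′ k k′} → Match s p k → Match s p′ k′ → p ≡ p′ × k ≡ k′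
Match-unique′ {p = a , b} {k = k} {k′} (c , d , lo , hi) (c′ , d′ , lo′ , hi′)
  with pair-unique c c′ d d′
... | refl , refl = refl , ℕP.≤-antisym (block-index-≤ lo hi′) (block-index-≤ lo′ hi)

-- For δ = 0 the blocks 1 to ⌊N/(ab)⌋ are enough for an upper bound. For δ = 2, index j stands for
-- block j + 1: these are blocks 2 to ⌊N/(ab)⌋ - 1, each of which ends by N.
triples : ℕ → ℕ → List Triple
triples δ N = coprimePairs N ⋉ λ (a , b) → range (quot N (a ℕ.* b) ∸ δ)

Unique-triples : ∀ δ N → Unique (triples δ N)
Unique-triples δ N = Unique-⋉ (Unique-coprimePairs N) λ (a , b) → Unique-range (quot N (a ℕ.* b) ∸ δ)

smalls≤triples : ∀ N → ∑ (smalls N) 1ᶠ ≤ ∑ (triples 0 N) 1ᶠ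
smalls≤triples N = ∑-inject (λ s (p , k) → Match s p k) (Unique-smalls N) 0≤1 total
  (λ {s} {s′} {t} → Match-unique {s} {s′} {proj₁ t} {proj₂ t})
  where
  total : ∀ {s} → s ∈ smalls N →
    ∃ λ t → t ∈ triples 0 N × Match s (proj₁ t) (proj₂ t) × 1ℚ ≤ 1ℚ
  total {x , e} m = let
      1≤x , x≤N , 1≤e , e≤x , e∣ = ∈-smalls⁻ {N} m
      a , b , c , e-ab = divisor⇒pair {x} e∣
      1≤a = ∣⇒1≤ (CoprimePair.a∣x c) 1≤x
      1≤b = ∣⇒1≤ (CoprimePair.b∣2+x c) (ℕ.s≤s ℕ.z≤n)
      1≤ab = ℕP.*-mono-≤ 1≤a 1≤b
      ab≤x = ℕP.≤-trans (product≤divisor e-ab) e≤x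
      k = quot x (a ℕ.* b)
      -- Block 0 cannot occur, because ab ≤ e ≤ x.
      1≤k = ≤quot 1≤ab (subst (ℕ._≤ x) (sym (ℕP.*-identityˡ (a ℕ.* b))) ab≤x)
      k≤ = ≤quot 1≤ab (ℕP.≤-trans (quot*≤ x (a ℕ.* b)) x≤N)
    in ((a , b) , k)
      , ∈-⋉⁺ (∈-coprimePairs⁺ 1≤a 1≤b (ℕP.≤-trans ab≤x x≤N) (CoprimePair.coprime c))
          (∈-range⁺ 1≤k k≤)
      , (c , e-ab , quot*≤ x (a ℕ.* b) , <suc-quot* x 1≤ab)
      , ≤-refl

∸-shift : ∀ {j q} → 1 ℕ.≤ j → j ℕ.≤ q ∸ 2 → 2 ℕ.+ j ℕ.≤ q
∸-shift {j} {suc (suc q)} _ j≤q = ℕ.s≤s (ℕ.s≤s j≤q)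
∸-shift {q = zero} 1≤j j≤0 = ⊥-elim (ℕP.<⇒≱ 1≤j j≤0)
∸-shift {q = suc zero} 1≤j j≤0 = ⊥-elim (ℕP.<⇒≱ 1≤j j≤0)

-- From the second block on, x ≥ 2ab, so that the divisor is small.
triples≤smalls : ∀ N → ∑ (triples 2 N) 1ᶠ ≤ ∑ (smalls N) 1ᶠ
triples≤smalls N = ∑-inject (λ (p , j) s → Match s p (suc j)) (Unique-triples 2 N) 0≤1 total unique
  where
  unique : ∀ {t t′ s} → Match s (proj₁ t) (suc (proj₂ t)) → Match s (proj₁ t′) (suc (proj₂ t′)) → t ≡ t′
  unique {p , j} {p′ , j′} {s} u v with Match-unique′ {s} {p} {p′} {suc j} {suc j′} u v
  ... | refl , refl = refl
  total : ∀ {t} → t ∈ triples 2 N →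
    ∃ λ s → s ∈ smalls N × Match s (proj₁ t) (suc (proj₂ t)) × 1ℚ ≤ 1ℚ
  total {(a , b) , j} m = let
      ab∈ , j∈ = ∈-⋉⁻ (coprimePairs N) m
      (1≤a , 1≤b , ab≤N) , c = ∈-coprimePairs⁻ {N} ab∈
      1≤j , j≤ = ∈-range⁻ j∈
      n = a ℕ.* b
      x , c′ , lo , hi = crt-block (suc j) 1≤a 1≤b c
      e , e∣ , e-ab = pair⇒divisor c′
      2+j≤ : 2 ℕ.+ j ℕ.≤ quot N n
      2+j≤ = ∸-shift 1≤j j≤
      x<N = ℕP.<-≤-trans hi (ℕP.≤-trans (ℕP.*-monoˡ-≤ n 2+j≤) (quot*≤ N n))
      2n≤x = ℕP.≤-trans (ℕP.*-monoˡ-≤ n (ℕ.s≤s 1≤j)) lo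
      n≤x = ℕP.≤-trans (ℕP.m≤m+n n _) 2n≤x
      1≤x = ℕP.≤-trans (ℕP.*-mono-≤ 1≤a 1≤b) n≤x
      1≤e = ℕP.≤-trans (ℕP.*-mono-≤ 1≤a 1≤b) (product≤divisor e-ab)
    in (x , e)
      , ∈-smalls⁺ 1≤x x<N 1≤e (ℕP.≤-trans (divisor≤2product e-ab) 2n≤x) e∣
      , (c′ , e-ab , lo , hi)
      , ≤-refl

-- The hyperbola method

divisors : ℕ → List ℕ
divisors m = filter (_∣? m) (map suc (upTo m))

∈-divisors⁻ : ∀ {m e} → e ∈ divisors m → 1 ℕ.≤ e × e ∣ m
∈-divisors⁻ {m} p with ∈-filter⁻ (_∣? m) {xs = map suc (upTo m)} p
... | q , e∣m with ∈-map⁻ suc q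
... | _ , _ , refl = ℕ.s≤s ℕ.z≤n , e∣m

∈-divisors⁺ : ∀ {m e} → 1 ℕ.≤ m → 1 ℕ.≤ e → e ∣ m → e ∈ divisors m
∈-divisors⁺ {m} {suc e} 1≤m _ e∣m = ∈-filter⁺ (_∣? m)
  (∈-map⁺ suc (∈-upTo⁺ (∣⇒≤ {{ℕ.>-nonZero 1≤m}} e∣m))) e∣m

Unique-divisors : ∀ m → Unique (divisors m)
Unique-divisors m = Unique.filter⁺ (_∣? m) (Unique.map⁺ ℕP.suc-injective (Unique.upTo⁺ m))

module Hyperbola (x : ℕ) (1≤x : 1 ℕ.≤ x) where

  D : ℕ
  D = x ℕ.* (2 ℕ.+ x)

  1≤D : 1 ℕ.≤ D
  1≤D = ℕP.*-mono-≤ 1≤x (ℕ.s≤s ℕ.z≤n)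

  -- Each small divisor serves twice, for itself and for its cofactor; the boolean keeps the two
  -- uses apart.
  data Via (e : ℕ) : Bool × ℕ → Set where
    itself : ∀ {i} → e ≡ i → Via e (true , i)
    cofactor : ∀ {i} → e ℕ.* i ≡ D → Via e (false , i)

  -- D lies strictly between x² and (x + 1)², so of two complementary divisors exactly one is at
  -- most x, with no square root to treat separately.
  x*x<D : x ℕ.* x ℕ.< D
  x*x<D = ℕP.*-monoʳ-< x {{ℕ.>-nonZero 1≤x}} (ℕP.m<n+m x (ℕ.s≤s ℕ.z≤n))

  D<[1+x]² : D ℕ.< suc x ℕ.* suc x
  D<[1+x]² = subst (suc D ℕ.≤_) (lemma x) ℕP.≤-refl
    where
    lemma : ∀ x → 1 ℕ.+ x ℕ.* (2 ℕ.+ x) ≡ (1 ℕ.+ x) ℕ.* (1 ℕ.+ x)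
    lemma = ℕ-Solver.solve-∀

  twoCopies : List (Bool × ℕ)
  twoCopies = (true ∷ false ∷ []) ⋉ λ _ → smallDivisors x

  ∈-twoCopies⁺ : ∀ {t i} → t ∈ true ∷ false ∷ [] → i ∈ smallDivisors x → (t , i) ∈ twoCopies
  ∈-twoCopies⁺ = ∈-⋉⁺

  ∈-twoCopies⁻ : ∀ {t i} → (t , i) ∈ twoCopies → 1 ℕ.≤ i × i ℕ.≤ x × i ∣ D
  ∈-twoCopies⁻ m with ∈-filter⁻ (_∣? D) {xs = range x} (proj₂ (∈-⋉⁻ (true ∷ false ∷ []) m))
  ... | r , i∣ = proj₁ (∈-range⁻ r) , proj₂ (∈-range⁻ r) , i∣

  ∑-twoCopies : ∑ twoCopies 1ᶠ ≡ ℕ→ℚ 2 * ∑ (smallDivisors x) 1ᶠ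
  ∑-twoCopies = trans (∑-⋉ (true ∷ false ∷ []) (λ _ → smallDivisors x) 1ᶠ) (lemma (∑ (smallDivisors x) 1ᶠ))
    where
    lemma : ∀ s → s + (s + 0ℚ) ≡ ℕ→ℚ 2 * s
    lemma = solve-∀ ℚ-ring

  cancel : ∀ {i j k} → i ℕ.* k ≡ D → j ℕ.* k ≡ D → i ≡ j
  cancel {i} {j} {zero} e _ = ⊥-elim (ℕP.<⇒≢ 1≤D (trans (sym (ℕP.*-zeroʳ i)) e))
  cancel {i} {j} {suc k} e e′ = ℕP.*-cancelʳ-≡ i j (suc k) (trans e (sym e′))

  divisors≤ : ∑ (divisors D) 1ᶠ ≤ ∑ twoCopies 1ᶠ
  divisors≤ = ∑-inject Via (Unique-divisors D) 0≤1 total inj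
    where
    inj : ∀ {e e′ i} → Via e i → Via e′ i → e ≡ e′
    inj (itself refl) (itself refl) = refl
    inj (cofactor p) (cofactor q) = cancel p q
    total : ∀ {e} → e ∈ divisors D → ∃ λ i → i ∈ twoCopies × Via e i × 1ℚ ≤ 1ℚ
    total {e} m with ∈-divisors⁻ {D} m
    ... | 1≤e , e∣D with e ℕ.≤? x
    ... | yes e≤x = (true , e) , ∈-twoCopies⁺ (here refl) (∈-filter⁺ (_∣? D) (∈-range⁺ 1≤e e≤x) e∣D) , itself refl , ≤-refl
    ... | no e≰x with e∣D
    ... | divides q D≡ = (false , q)
            , ∈-twoCopies⁺ (there (here refl)) (∈-filter⁺ (_∣? D) (∈-range⁺ 1≤q q≤x) q∣D)
            , cofactor (trans (ℕP.*-comm e q) (sym D≡)) , ≤-refl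
      where
      q∣D : q ∣ D
      q∣D = divides e (trans D≡ (ℕP.*-comm q e))
      1≤q = ∣⇒1≤ q∣D 1≤D
      q≤x : q ℕ.≤ x
      q≤x = ℕP.≮⇒≥ λ x<q → ℕP.<⇒≱ D<[1+x]²
        (subst (suc x ℕ.* suc x ℕ.≤_) (sym D≡) (ℕP.*-mono-≤ x<q (ℕP.≰⇒> e≰x)))

  ≤divisors : ∑ twoCopies 1ᶠ ≤ ∑ (divisors D) 1ᶠ
  ≤divisors = ∑-inject (λ i e → Via e i × proj₂ i ℕ.≤ x)
    (Unique-⋉ (((λ ()) All.∷ All.[]) AllPairs.∷ (All.[] AllPairs.∷ AllPairs.[])) λ _ → Unique.filter⁺ (_∣? D) (Unique-range x))
    0≤1 total inj
    where
    clash : ∀ {e j} → e ℕ.≤ x → j ℕ.≤ x → e ℕ.* j ≢ D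
    clash e≤x j≤x e = ℕP.<⇒≢ (ℕP.≤-<-trans (ℕP.*-mono-≤ e≤x j≤x) x*x<D) e
    inj : ∀ {i i′ e} → Via e i × proj₂ i ℕ.≤ x → Via e i′ × proj₂ i′ ℕ.≤ x → i ≡ i′
    inj (itself refl , _) (itself refl , _) = refl
    inj {e = e} (cofactor {i} p , _) (cofactor {j} q , _) = cong (false ,_)
      (cancel (trans (ℕP.*-comm i e) p) (trans (ℕP.*-comm j e) q))
    inj (itself refl , le) (cofactor q , le′) = ⊥-elim (clash le le′ q)
    inj (cofactor q , le′) (itself refl , le) = ⊥-elim (clash le le′ q)
    total : ∀ {i} → i ∈ twoCopies → ∃ λ e → e ∈ divisors D × (Via e i × proj₂ i ℕ.≤ x) × 1ℚ ≤ 1ℚ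
    total {t , i} m with ∈-twoCopies⁻ {t} m
    total {true , i} m | 1≤i , i≤x , i∣D = i , ∈-divisors⁺ 1≤D 1≤i i∣D , (itself refl , i≤x) , ≤-refl
    total {false , i} m | 1≤i , i≤x , divides q D≡ =
      q , ∈-divisors⁺ 1≤D (∣⇒1≤ q∣D 1≤D) q∣D , (cofactor (sym D≡) , i≤x) , ≤-refl
      where
      q∣D : q ∣ D
      q∣D = divides i (trans D≡ (ℕP.*-comm q i))

  divisors≡ : ∑ (divisors D) 1ᶠ ≡ ℕ→ℚ 2 * ∑ (smallDivisors x) 1ᶠ
  divisors≡ = trans (≤-antisym divisors≤ ≤divisors) ∑-twoCopies

∑-sum₂ : ∀ N (f : ℕ → ℕ) → ℕ→ℚ (sum₂ N f) ≡ ∑ (range (N ∸ 1)) (λ x → ℕ→ℚ (f (suc x)))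
∑-sum₂ N f = trans (∑-sum ns f) (≤-antisym
    (∑-inject (λ n x → n ≡ suc x) (Unique.filter⁺ (2 ℕ.≤?_) (Unique.upTo⁺ (suc N)))
      (λ x → 0≤ℕ→ℚ (f (suc x))) to λ { refl refl → refl })
    (∑-inject (λ x n → n ≡ suc x) (Unique-range (N ∸ 1)) (λ n → 0≤ℕ→ℚ (f n)) from λ { refl refl → refl }))
  where
  ns : List ℕ
  ns = filter (2 ℕ.≤?_) (upTo (suc N))
  to : ∀ {n} → n ∈ ns → ∃ λ x → x ∈ range (N ∸ 1) × n ≡ suc x × ℕ→ℚ (f n) ≤ ℕ→ℚ (f (suc x))
  to {zero} m with () ← proj₂ (∈-filter⁻ (2 ℕ.≤?_) {xs = upTo (suc N)} m)
  to {suc x} m with ∈-filter⁻ (2 ℕ.≤?_) {xs = upTo (suc N)} m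
  ... | p , q = x , ∈-range⁺ (ℕ.s≤s⁻¹ q) (ℕP.∸-monoˡ-≤ 1 (ℕ.s≤s⁻¹ (∈-upTo⁻ p))) , refl , ≤-refl
  bound : ∀ {x} N → 1 ℕ.≤ x → x ℕ.≤ N ∸ 1 → suc x ℕ.≤ N
  bound zero 1≤x x≤0 = ⊥-elim (ℕP.<⇒≱ 1≤x x≤0)
  bound (suc N) _ x≤N = ℕ.s≤s x≤N
  from : ∀ {x} → x ∈ range (N ∸ 1) → ∃ λ n → n ∈ ns × n ≡ suc x × ℕ→ℚ (f (suc x)) ≤ ℕ→ℚ (f n)
  from {x} m with ∈-range⁻ m
  ... | 1≤x , x≤ = suc x , ∈-filter⁺ (2 ℕ.≤?_) (∈-upTo⁺ (ℕ.s≤s (bound N 1≤x x≤))) (ℕ.s≤s 1≤x) , refl , ≤-refl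

T : ℕ → ℕ
T N = sum₂ N (λ n → d (n ^ 2 ∸ 1))

T≡ : ∀ N → ℕ→ℚ (T N) ≡ ℕ→ℚ 2 * ∑ (smalls N) 1ᶠ
T≡ N = begin
  ℕ→ℚ (T N)                                              ≡⟨ ∑-sum₂ N (λ n → d (n ^ 2 ∸ 1)) ⟩
  ∑ (range (N ∸ 1)) (λ x → ℕ→ℚ (d (suc x ^ 2 ∸ 1)))       ≡⟨ ∑-cong (range (N ∸ 1)) (λ m → term (proj₁ (∈-range⁻ m))) ⟩
  ∑ (range (N ∸ 1)) (λ x → ℕ→ℚ 2 * ∑ (smallDivisors x) 1ᶠ) ≡⟨ ∑-*ˡ (range (N ∸ 1)) (ℕ→ℚ 2) (λ x → ∑ (smallDivisors x) 1ᶠ) ⟩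
  ℕ→ℚ 2 * ∑ (range (N ∸ 1)) (λ x → ∑ (smallDivisors x) 1ᶠ) ≡⟨ cong (ℕ→ℚ 2 *_) (∑-⋉ (range (N ∸ 1)) smallDivisors 1ᶠ) ⟨
  ℕ→ℚ 2 * ∑ (smalls N) 1ᶠ                                 ∎
  where
  open ≡-Reasoning
  square : ∀ x → (1 ℕ.+ x) ℕ.* ((1 ℕ.+ x) ℕ.* 1) ≡ 1 ℕ.+ x ℕ.* (2 ℕ.+ x)
  square = ℕ-Solver.solve-∀
  term : ∀ {x} → 1 ℕ.≤ x → ℕ→ℚ (d (suc x ^ 2 ∸ 1)) ≡ ℕ→ℚ 2 * ∑ (smallDivisors x) 1ᶠ
  term {x} 1≤x = trans (cong (λ n → ℕ→ℚ (d (n ∸ 1))) (square x))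
    (trans (sym (∑-length (divisors (x ℕ.* (2 ℕ.+ x))))) (Hyperbola.divisors≡ x 1≤x))

∑-triples : ∀ δ N → ∑ (triples δ N) 1ᶠ ≡ ∑ (coprimePairs N) (λ (a , b) → ℕ→ℚ (quot N (a ℕ.* b) ∸ δ))
∑-triples δ N = trans (∑-⋉ (coprimePairs N) _ 1ᶠ) (∑-cong (coprimePairs N)
  λ {(a , b)} _ → trans (∑-const-range (quot N (a ℕ.* b) ∸ δ) 1ℚ) (*-identityʳ _))

triples₀≤ : ∀ N → ∑ (triples 0 N) 1ᶠ ≤ ℕ→ℚ N * P N
triples₀≤ N = subst₂ _≤_ (sym (∑-triples 0 N)) (∑-*ˡ (coprimePairs N) (ℕ→ℚ N) weight)
  (∑-≤ (coprimePairs N) term)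
  where
  term : ∀ {p} → p ∈ coprimePairs N → ℕ→ℚ (quot N (proj₁ p ℕ.* proj₂ p)) ≤ ℕ→ℚ N * weight p
  term {a , b} m with ∈-coprimePairs⁻ {N} m
  ... | (1≤a , 1≤b , _) , _ = subst (λ w → ℕ→ℚ (quot N (a ℕ.* b)) ≤ ℕ→ℚ N * w) (recip-* a b)
    (quot≤ N (ℕP.*-mono-≤ 1≤a 1≤b))

coprimePairs≤ : ∀ N → ∑ (coprimePairs N) 1ᶠ ≤ ℕ→ℚ N * h N
coprimePairs≤ N = begin
  ∑ (coprimePairs N) 1ᶠ                    ≤⟨ ∑-inject _≡_ (Unique-coprimePairs N) 0≤1
                                              (λ {p} m → p , proj₁ (∈-filter⁻ coprime²? {xs = pairs N} m) , refl , ≤-refl)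
                                              (λ { refl refl → refl }) ⟩
  ∑ (pairs N) 1ᶠ                           ≡⟨ ∑-⋉ (range N) (λ s → range (quot N s)) 1ᶠ ⟩
  ∑ (range N) (λ s → ∑ (range (quot N s)) 1ᶠ) ≤⟨ ∑-≤ (range N) (λ {s} m → ≤-trans
    (≤-reflexive (trans (∑-const-range (quot N s) 1ℚ) (*-identityʳ _))) (quot≤ N (proj₁ (∈-range⁻ m)))) ⟩
  ∑ (range N) (λ s → ℕ→ℚ N * recip s)       ≡⟨ ∑-*ˡ (range N) (ℕ→ℚ N) recip ⟩
  ℕ→ℚ N * h N                               ∎
  where open ≤-Reasoning

-- Rounding down costs at most 1 per pair and the two dropped blocks at most 2, whence 3 times the
-- number of pairs.
≤triples₂ : ∀ N → ℕ→ℚ N * P N ≤ ∑ (triples 2 N) 1ᶠ + ℕ→ℚ 3 * (ℕ→ℚ N * h N)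
≤triples₂ N = begin
  ℕ→ℚ N * P N                                        ≡⟨ ∑-*ˡ (coprimePairs N) (ℕ→ℚ N) weight ⟨
  ∑ (coprimePairs N) (λ p → ℕ→ℚ N * weight p)         ≤⟨ ∑-≤ (coprimePairs N) term ⟩
  ∑ (coprimePairs N) (λ p → count p + ℕ→ℚ 3 * 1ℚ)     ≡⟨ ∑-+ (coprimePairs N) count (λ _ → ℕ→ℚ 3 * 1ℚ) ⟩
  ∑ (coprimePairs N) count + ∑ (coprimePairs N) (λ _ → ℕ→ℚ 3 * 1ℚ)
    ≡⟨ cong₂ _+_ (sym (∑-triples 2 N)) (∑-*ˡ (coprimePairs N) (ℕ→ℚ 3) 1ᶠ) ⟩
  ∑ (triples 2 N) 1ᶠ + ℕ→ℚ 3 * ∑ (coprimePairs N) 1ᶠ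
    ≤⟨ +-monoʳ-≤ (∑ (triples 2 N) 1ᶠ) (*-monoˡ (ℕ→ℚ 3) (0≤ℕ→ℚ 3) (coprimePairs≤ N)) ⟩
  ∑ (triples 2 N) 1ᶠ + ℕ→ℚ 3 * (ℕ→ℚ N * h N)          ∎
  where
  open ≤-Reasoning
  count : ℕ × ℕ → ℚ
  count (a , b) = ℕ→ℚ (quot N (a ℕ.* b) ∸ 2)
  ∸2 : ∀ q → ℕ→ℚ q + 1ℚ ≤ ℕ→ℚ (q ∸ 2) + ℕ→ℚ 3 * 1ℚ
  ∸2 q = subst₂ _≤_ (trans (ℕ→ℚ-suc q) (+-comm 1ℚ (ℕ→ℚ q))) (ℕ→ℚ-+ (q ∸ 2) 3)
    (ℕ→ℚ-mono (subst (suc q ℕ.≤_) (sym (ℕP.+-suc (q ∸ 2) 2)) (ℕ.s≤s (subst (q ℕ.≤_) (ℕP.+-comm 2 (q ∸ 2)) (ℕP.m≤n+m∸n q 2)))))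
  term : ∀ {p} → p ∈ coprimePairs N → ℕ→ℚ N * weight p ≤ count p + ℕ→ℚ 3 * 1ℚ
  term {a , b} m with ∈-coprimePairs⁻ {N} m
  ... | (1≤a , 1≤b , _) , _ = ≤-trans
    (subst (λ w → ℕ→ℚ N * w ≤ ℕ→ℚ (quot N (a ℕ.* b)) + 1ℚ) (recip-* a b)
      (≤quot+1 N (ℕP.*-mono-≤ 1≤a 1≤b)))
    (∸2 (quot N (a ℕ.* b)))

T≤ : ∀ N → ℕ→ℚ (T N) ≤ ℕ→ℚ 2 * (ℕ→ℚ N * P N)
T≤ N = subst (_≤ ℕ→ℚ 2 * (ℕ→ℚ N * P N)) (sym (T≡ N))
  (*-monoˡ (ℕ→ℚ 2) (0≤ℕ→ℚ 2) (≤-trans (smalls≤triples N) (triples₀≤ N)))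

≤T : ∀ N → ℕ→ℚ 2 * (ℕ→ℚ N * P N) ≤ ℕ→ℚ (T N) + ℕ→ℚ 6 * (ℕ→ℚ N * h N)
≤T N = begin
  ℕ→ℚ 2 * (ℕ→ℚ N * P N)
    ≤⟨ *-monoˡ (ℕ→ℚ 2) (0≤ℕ→ℚ 2) (≤-trans (≤triples₂ N) (+-monoˡ-≤ _ (triples≤smalls N))) ⟩
  ℕ→ℚ 2 * (∑ (smalls N) 1ᶠ + ℕ→ℚ 3 * (ℕ→ℚ N * h N)) ≡⟨ lemma (∑ (smalls N) 1ᶠ) (ℕ→ℚ N * h N) ⟩
  ℕ→ℚ 2 * ∑ (smalls N) 1ᶠ + ℕ→ℚ 6 * (ℕ→ℚ N * h N)   ≡⟨ cong (_+ ℕ→ℚ 6 * (ℕ→ℚ N * h N)) (T≡ N) ⟨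
  ℕ→ℚ (T N) + ℕ→ℚ 6 * (ℕ→ℚ N * h N)                 ∎
  where
  open ≤-Reasoning
  lemma : ∀ s t → ℕ→ℚ 2 * (s + ℕ→ℚ 3 * t) ≡ ℕ→ℚ 2 * s + ℕ→ℚ 6 * t
  lemma = solve-∀ ℚ-ring

-- Harmonic sums and the Tauberian step

h-mono : ∀ {m n} → m ℕ.≤ n → h m ≤ h n
h-mono = ∑-range-mono recip 0≤recip

0≤h : ∀ n → 0ℚ ≤ h n
0≤h n = 0≤∑ (range n) 0≤recip

1≤h : ∀ {n} → 1 ℕ.≤ n → 1ℚ ≤ h n
1≤h {n} = h-mono {1} {n}

h≤n : ∀ n → h n ≤ ℕ→ℚ n
h≤n n = ≤-trans (∑-≤ (range n) (λ {i} _ → recip≤1 i)) (≤-reflexive (trans (∑-const-range n 1ℚ) (*-identityʳ _)))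

Σ<-recip : ∀ n → Σ< n (λ j → recip (suc j)) ≡ h n
Σ<-recip zero = refl
Σ<-recip (suc n) = trans (cong (_+ recip (suc n)) (Σ<-recip n)) (+-comm (h n) (recip (suc n)))

h-+ : ∀ m k → h (k ℕ.+ m) ≡ h m + ∑ (range k) (λ j → recip (j ℕ.+ m))
h-+ m k = ∑-range-+ m k recip

n*recip[m*n] : ∀ m {n} → 1 ℕ.≤ n → ℕ→ℚ n * recip (m ℕ.* n) ≡ recip m
n*recip[m*n] m {n} 1≤n = trans (cong (ℕ→ℚ n *_) (recip-* m n))
  (≡-comb₁ (recip m) (recip-inverse 1≤n) (lemma (ℕ→ℚ n) (recip m) (recip n)))
  where
  lemma : ∀ n r s → n * (r * s) - r ≡ r * (n * s - 1ℚ)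
  lemma = solve-∀ ℚ-ring

block≤ : ∀ {a} b → 1 ℕ.≤ a → 1 ℕ.≤ b → ∑ (range a) (λ j → recip (j ℕ.+ b ℕ.* a)) ≤ recip b
block≤ {a} b 1≤a 1≤b = ≤-trans
  (∑-≤ (range a) (λ {j} _ → recip-anti (ℕP.*-mono-≤ 1≤b 1≤a) (ℕP.m≤n+m (b ℕ.* a) j)))
  (≤-reflexive (trans (∑-const-range a (recip (b ℕ.* a))) (n*recip[m*n] b 1≤a)))

≤block : ∀ {a} b → 1 ℕ.≤ a → recip (suc b) ≤ ∑ (range a) (λ j → recip (j ℕ.+ b ℕ.* a))
≤block {a} b 1≤a = ≤-trans
  (≤-reflexive (sym (trans (∑-const-range a (recip (suc b ℕ.* a))) (n*recip[m*n] (suc b) 1≤a))))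
  (∑-≤ (range a) (λ {j} m → let 1≤j , j≤a = ∈-range⁻ m in
    recip-anti (ℕP.≤-trans 1≤j (ℕP.m≤m+n j (b ℕ.* a))) (ℕP.+-monoˡ-≤ (b ℕ.* a) j≤a)))

-- The terms from ba + 1 to (b + 1)a sum to between 1/(b + 1) and 1/b. This lemma and `≤h-*` are the
-- additivity of the logarithm, up to a bounded error.
h-*≤ : ∀ {a} b → 1 ℕ.≤ a → h (suc b ℕ.* a) ≤ h a + h b
h-*≤ {a} zero 1≤a = ≤-reflexive (trans (cong h (ℕP.*-identityˡ a)) (sym (+-identityʳ (h a))))
h-*≤ {a} (suc b) 1≤a = begin
  h (suc (suc b) ℕ.* a)                                                        ≡⟨ h-+ (suc b ℕ.* a) a ⟩
  h (suc b ℕ.* a) + ∑ (range a) (λ j → recip (j ℕ.+ suc b ℕ.* a))              ≤⟨ +-mono-≤ (h-*≤ b 1≤a) (block≤ (suc b) 1≤a (ℕ.s≤s ℕ.z≤n)) ⟩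
  h a + h b + recip (suc b)                                                    ≡⟨ lemma (h a) (h b) (recip (suc b)) ⟩
  h a + h (suc b)                                                              ∎
  where
  open ≤-Reasoning
  lemma : ∀ x y z → x + y + z ≡ x + (z + y)
  lemma = solve-∀ ℚ-ring

≤h-* : ∀ {a} b → 1 ℕ.≤ a → h a + h (suc b) ≤ h (suc b ℕ.* a) + 1ℚ
≤h-* {a} zero 1≤a = ≤-reflexive (cong (λ t → h t + 1ℚ) (sym (ℕP.*-identityˡ a)))
≤h-* {a} (suc b) 1≤a = begin
  h a + (recip (2 ℕ.+ b) + h (suc b))                                          ≡⟨ lemma (h a) (recip (2 ℕ.+ b)) (h (suc b)) ⟩
  h a + h (suc b) + recip (2 ℕ.+ b)                                            ≤⟨ +-mono-≤ (≤h-* b 1≤a) (≤block (suc b) 1≤a) ⟩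
  h (suc b ℕ.* a) + 1ℚ + ∑ (range a) (λ j → recip (j ℕ.+ suc b ℕ.* a))          ≡⟨ lemma (h (suc b ℕ.* a)) _ 1ℚ ⟨
  h (suc b ℕ.* a) + (∑ (range a) (λ j → recip (j ℕ.+ suc b ℕ.* a)) + 1ℚ)        ≡⟨ +-assoc (h (suc b ℕ.* a)) _ 1ℚ ⟨
  h (suc b ℕ.* a) + ∑ (range a) (λ j → recip (j ℕ.+ suc b ℕ.* a)) + 1ℚ          ≡⟨ cong (_+ 1ℚ) (h-+ (suc b ℕ.* a) a) ⟨
  h (suc (suc b) ℕ.* a) + 1ℚ                                                   ∎
  where
  open ≤-Reasoning
  lemma : ∀ x y z → x + (y + z) ≡ x + z + y
  lemma = solve-∀ ℚ-ring

h≤h+h-quot : ∀ {x s} → 1 ℕ.≤ s → h x ≤ h s + h (quot x s)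
h≤h+h-quot {x} {s} 1≤s = ≤-trans (h-mono (ℕP.<⇒≤ (<suc-quot* x 1≤s))) (h-*≤ (quot x s) 1≤s)

h+h-quot≤h : ∀ {x s} → 1 ℕ.≤ s → s ℕ.≤ x → h s + h (quot x s) ≤ h x + 1ℚ
h+h-quot≤h {x} {s} 1≤s s≤x = go (quot x s) (≤quot 1≤s (subst (ℕ._≤ x) (sym (ℕP.*-identityˡ s)) s≤x)) (quot*≤ x s)
  where
  go : ∀ q → 1 ℕ.≤ q → q ℕ.* s ℕ.≤ x → h s + h q ≤ h x + 1ℚ
  go (suc q) _ le = ≤-trans (≤h-* q 1≤s) (+-monoˡ-≤ 1ℚ (h-mono le))

-- Base 4 because h 4 = 25/12 ≥ 2: one unit is lost in `≤h-*`, which leaves a gain of 1 per factor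
-- 4.
4^≤h : ∀ k → ℕ→ℚ k ≤ h (4 ^ k)
4^≤h zero = 0≤h 1
4^≤h (suc k) = begin
  ℕ→ℚ (suc k)         ≡⟨ ℕ→ℚ-suc k ⟩
  1ℚ + ℕ→ℚ k          ≤⟨ +-monoʳ-≤ 1ℚ (4^≤h k) ⟩
  1ℚ + h (4 ^ k)      ≤⟨ ≤-comb₂ 1ℚ 1ℚ (<⇒≤ 0<1) (<⇒≤ 0<1) 2≤h4 (≤h-* 3 (ℕP.m^n>0 4 k)) (lemma (h (4 ^ k)) (h 4) (h (4 ^ suc k))) ⟩
  h (4 ^ suc k)       ∎
  where
  open ≤-Reasoning
  2≤h4 : 1ℚ + 1ℚ ≤ h 4
  2≤h4 = ≤ᵇ⇒≤ {1ℚ + 1ℚ} {h 4} _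
  lemma : ∀ a b c → c - (1ℚ + a) ≡ 1ℚ * (b - (1ℚ + 1ℚ)) + 1ℚ * (c + 1ℚ - (a + b))
  lemma = solve-∀ ℚ-ring

-- Partial sums of ζ(2)

recip² : ℕ → ℚ
recip² g = recip g * recip g

0≤recip² : ∀ g → 0ℚ ≤ recip² g
0≤recip² g = 0≤* (0≤recip g) (0≤recip g)

Z : ℕ → ℚ
Z n = ∑ (range n) recip²

0≤Z : ∀ n → 0ℚ ≤ Z n
0≤Z n = 0≤∑ (range n) 0≤recip²

Z-mono : ∀ {m n} → m ℕ.≤ n → Z m ≤ Z n
Z-mono = ∑-range-mono recip² 0≤recip²

recip-suc : ∀ {n} → 1 ℕ.≤ n → recip n - recip (suc n) ≡ recip n * recip (suc n)
recip-suc {n} 1≤n = ≡-comb₂ (recip (suc n)) (- recip n) (recip-inverse 1≤n)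
  (trans (cong (_* recip (suc n)) (sym (ℕ→ℚ-suc n))) (recip-inverse {suc n} (ℕ.s≤s ℕ.z≤n)))
  (lemma (ℕ→ℚ n) (recip n) (recip (suc n)))
  where
  lemma : ∀ n i j → i - j - i * j ≡ j * (n * i - 1ℚ) + (- i) * ((1ℚ + n) * j - 1ℚ)
  lemma = solve-∀ ℚ-ring

-- Z n + 1/n is decreasing in n, since 1/(n + 1)² ≤ 1/(n(n + 1)) = 1/n - 1/(n + 1).
Z-tail : ∀ k {n} → 1 ℕ.≤ n → Z (k ℕ.+ n) + recip (k ℕ.+ n) ≤ Z n + recip n
Z-tail zero _ = ≤-refl
Z-tail (suc k) {n} 1≤n = ≤-trans step′ (Z-tail k 1≤n)
  where
  m = k ℕ.+ n
  1≤m = ℕP.≤-trans 1≤n (ℕP.m≤n+m n k)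
  lemma : ∀ z i j → z + i - (j * j + z + j) ≡ j * (i - j) + 1ℚ * ((i - j) - i * j)
  lemma = solve-∀ ℚ-ring
  step′ : recip² (suc m) + Z m + recip (suc m) ≤ Z m + recip m
  step′ = ≤-comb₂ (recip (suc m)) 1ℚ (0≤recip (suc m)) (<⇒≤ 0<1) (recip-anti 1≤m (ℕP.n≤1+n m))
    (≤-reflexive (sym (recip-suc 1≤m))) (lemma (Z m) (recip m) (recip (suc m)))

Z≤ : ∀ N {G} → 1 ℕ.≤ G → Z N ≤ Z G + recip G
Z≤ N {G} 1≤G = ≤-trans (Z-mono (ℕP.m≤m+n N G)) (≤-trans
  (≤-by (recip (N ℕ.+ G)) (0≤recip (N ℕ.+ G)) refl) (Z-tail N 1≤G))

1≤Z : ∀ {G} → 1 ℕ.≤ G → 1ℚ ≤ Z G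
1≤Z {G} = Z-mono {1} {G}

Z≤2 : ∀ N → Z N ≤ ℕ→ℚ 2
Z≤2 N = Z≤ N {1} ℕP.≤-refl

-- The sum over all pairs, in harmonic numbers

F≡ : ∀ N → F N ≡ ∑ (range N) (λ s → recip s * h (quot N s))
F≡ N = trans (∑-⋉ (range N) (λ s → range (quot N s)) weight)
  (∑-cong (range N) (λ {s} _ → ∑-*ˡ (range (quot N s)) (recip s) recip))

-- The sum runs over 1/(st) with t ≤ s ≤ N. Doubled, it covers the square once and the diagonal a
-- second time.
∑-recip*h : ∀ N → ℕ→ℚ 2 * ∑ (range N) (λ s → recip s * h s) ≡ h N * h N + Z N
∑-recip*h zero = refl
∑-recip*h (suc n) = ≡-comb₁ 1ℚ (∑-recip*h n)
  (lemma (recip (suc n)) (h n) (Z n) (∑ (range n) (λ s → recip s * h s)))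
  where
  lemma : ∀ r h z s → ℕ→ℚ 2 * (r * (r + h) + s) - ((r + h) * (r + h) + (r * r + z)) ≡
    1ℚ * (ℕ→ℚ 2 * s - (h * h + z))
  lemma = solve-∀ ℚ-ring

-- F N is the sum of h(N/s)/s, and h(N/s) + h(s) exceeds h N by at most 1. Adding the sum of h(s)/s,
-- which is half of h² + Z, therefore gives at most h(h + 1).
F≤ : ∀ N → ℕ→ℚ 2 * F N + Z N ≤ h N * h N + ℕ→ℚ 2 * h N
F≤ N = ≤-comb₂ (ℕ→ℚ 2) 1ℚ (0≤ℕ→ℚ 2) (<⇒≤ 0<1) bound (≤-reflexive (sym (∑-recip*h N)))
  (lemma (h N) (F N) S (Z N))
  where
  S = ∑ (range N) (λ s → recip s * h s)
  lemma : ∀ h f s z → h * h + ℕ→ℚ 2 * h - (ℕ→ℚ 2 * f + z) ≡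
    ℕ→ℚ 2 * (h * (h + 1ℚ) - (f + s)) + 1ℚ * (ℕ→ℚ 2 * s - (h * h + z))
  lemma = solve-∀ ℚ-ring
  bound : F N + S ≤ h N * (h N + 1ℚ)
  bound = begin
    F N + S                                                      ≡⟨ cong (_+ S) (F≡ N) ⟩
    ∑ (range N) (λ s → recip s * h (quot N s)) + S                ≡⟨ ∑-+ (range N) _ _ ⟨
    ∑ (range N) (λ s → recip s * h (quot N s) + recip s * h s)    ≤⟨ ∑-≤ (range N) term ⟩
    ∑ (range N) (λ s → recip s * (h N + 1ℚ))                      ≡⟨ ∑-*ʳ (range N) (h N + 1ℚ) recip ⟩
    h N * (h N + 1ℚ)                                              ∎
    where
    open ≤-Reasoning
    factor : ∀ r x y → r * x + r * y ≡ r * (y + x)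
    factor = solve-∀ ℚ-ring
    term : ∀ {s} → s ∈ range N → recip s * h (quot N s) + recip s * h s ≤ recip s * (h N + 1ℚ)
    term {s} m = let 1≤s , s≤N = ∈-range⁻ m in
      ≤-trans (≤-reflexive (factor (recip s) (h (quot N s)) (h s)))
        (*-monoˡ (recip s) (0≤recip s) (h+h-quot≤h 1≤s s≤N))

≤F : ∀ N → h N * h N ≤ ℕ→ℚ 2 * F N + Z N
≤F N = ≤-comb₂ (ℕ→ℚ 2) 1ℚ (0≤ℕ→ℚ 2) (<⇒≤ 0<1) bound (≤-reflexive (∑-recip*h N))
  (lemma (h N) (F N) S (Z N))
  where
  S = ∑ (range N) (λ s → recip s * h s)
  lemma : ∀ h f s z → ℕ→ℚ 2 * f + z - h * h ≡
    ℕ→ℚ 2 * (f + s - h * h) + 1ℚ * (h * h + z - ℕ→ℚ 2 * s)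
  lemma = solve-∀ ℚ-ring
  bound : h N * h N ≤ F N + S
  bound = begin
    h N * h N                                                     ≡⟨ ∑-*ʳ (range N) (h N) recip ⟨
    ∑ (range N) (λ s → recip s * h N)                              ≤⟨ ∑-≤ (range N) term ⟩
    ∑ (range N) (λ s → recip s * h (quot N s) + recip s * h s)    ≡⟨ ∑-+ (range N) _ _ ⟩
    ∑ (range N) (λ s → recip s * h (quot N s)) + S                ≡⟨ cong (_+ S) (F≡ N) ⟨
    F N + S                                                      ∎
    where
    open ≤-Reasoning
    factor : ∀ r x y → r * (y + x) ≡ r * x + r * y
    factor = solve-∀ ℚ-ring
    term : ∀ {s} → s ∈ range N → recip s * h N ≤ recip s * h (quot N s) + recip s * h s
    term {s} m = let 1≤s , s≤N = ∈-range⁻ m in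
      ≤-trans (*-monoˡ (recip s) (0≤recip s) (h≤h+h-quot {N} 1≤s))
        (≤-reflexive (factor (recip s) (h (quot N s)) (h s)))

-- Splitting off the greatest common divisor

Scaled : ℕ × (ℕ × ℕ) → ℕ × ℕ → Set
Scaled (g , a , b) (s , t) = 1 ℕ.≤ g × Coprime a b × s ≡ g ℕ.* a × t ≡ g ℕ.* b

Scaled-gcd : ∀ {g a b s t} → Scaled (g , a , b) (s , t) → gcd s t ≡ g
Scaled-gcd {g} {a} {b} (_ , c , refl , refl) = trans (sym (c*gcd[m,n]≡gcd[cm,cn] g a b))
  (trans (cong (g ℕ.*_) (coprime⇒gcd≡1 c)) (ℕP.*-identityʳ g))

Scaled-unique : ∀ {u v p} → Scaled u p → Scaled v p → u ≡ v
Scaled-unique {g , a , b} {g′ , a′ , b′} {s , t} u v =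
  same (trans (sym (Scaled-gcd {g} {a} {b} {s} {t} u)) (Scaled-gcd {g′} {a′} {b′} {s} {t} v)) u v
  where
  same : g ≡ g′ → Scaled (g , a , b) (s , t) → Scaled (g′ , a′ , b′) (s , t) → (g , a , b) ≡ (g′ , a′ , b′)
  same refl (1≤g , _ , s≡ , t≡) (_ , _ , s≡′ , t≡′) = cong₂ (λ a b → g , a , b)
    (ℕP.*-cancelˡ-≡ a a′ g {{ℕ.>-nonZero 1≤g}} (trans (sym s≡) s≡′))
    (ℕP.*-cancelˡ-≡ b b′ g {{ℕ.>-nonZero 1≤g}} (trans (sym t≡) t≡′))

scaledWeight : ℕ × (ℕ × ℕ) → ℚ
scaledWeight (g , p) = recip² g * weight p

weight-scaled : ∀ g a b → scaledWeight (g , a , b) ≡ weight (g ℕ.* a , g ℕ.* b)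
weight-scaled g a b = trans (lemma (recip g) (recip a) (recip b))
  (sym (cong₂ _*_ (recip-* g a) (recip-* g b)))
  where
  lemma : ∀ g a b → g * g * (a * b) ≡ g * a * (g * b)
  lemma = solve-∀ ℚ-ring

∑-scaled : ∀ G N → ∑ (range G ⋉ λ _ → coprimePairs N) scaledWeight ≡ Z G * P N
∑-scaled G N = trans (∑-⋉ (range G) (λ _ → coprimePairs N) scaledWeight)
  (trans (∑-cong (range G) (λ {g} _ → ∑-*ˡ (coprimePairs N) (recip² g) weight))
    (∑-*ʳ (range G) (P N) recip²))

Z*P≤F : ∀ G N → Z G * P N ≤ F (G ℕ.* G ℕ.* N)
Z*P≤F G N = subst (_≤ F (G ℕ.* G ℕ.* N)) (∑-scaled G N)
  (∑-inject Scaled (Unique-⋉ (Unique-range G) λ _ → Unique-coprimePairs N) 0≤weight total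
    (λ {u} {v} {p} → Scaled-unique {u} {v} {p}))
  where
  swap : ∀ g a b → g ℕ.* g ℕ.* (a ℕ.* b) ≡ g ℕ.* a ℕ.* (g ℕ.* b)
  swap = ℕ-Solver.solve-∀
  total : ∀ {u} → u ∈ (range G ⋉ λ _ → coprimePairs N) →
    ∃ λ p → p ∈ pairs (G ℕ.* G ℕ.* N) × Scaled u p × scaledWeight u ≤ weight p
  total {g , a , b} m = let
      g∈ , ab∈ = ∈-⋉⁻ (range G) m
      1≤g , g≤G = ∈-range⁻ g∈
      (1≤a , 1≤b , ab≤N) , c = ∈-coprimePairs⁻ {N} ab∈
    in (g ℕ.* a , g ℕ.* b)
      , ∈-pairs⁺ (ℕP.*-mono-≤ 1≤g 1≤a) (ℕP.*-mono-≤ 1≤g 1≤b)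
          (subst (ℕ._≤ G ℕ.* G ℕ.* N) (swap g a b) (ℕP.*-mono-≤ (ℕP.*-mono-≤ g≤G g≤G) ab≤N))
      , (1≤g , (λ {i} → c {i}) , refl , refl)
      , ≤-reflexive (weight-scaled g a b)

-- Every (s, t) is g(a, b) with a, b coprime, and ab ≤ st ≤ N. Bounding ab by N and not by N/g² is
-- where monotonicity of P enters.
F≤Z*P : ∀ N → F N ≤ Z N * P N
F≤Z*P N = subst (F N ≤_) (∑-scaled N N)
  (∑-inject (λ (s , t) (g , a , b) → s ≡ g ℕ.* a × t ≡ g ℕ.* b) (Unique-pairs N)
    (λ (g , p) → 0≤* (0≤recip² g) (0≤weight p)) total (λ { (refl , refl) (refl , refl) → refl }))
  where
  total : ∀ {p} → p ∈ pairs N → ∃ λ u → u ∈ (range N ⋉ λ _ → coprimePairs N) ×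
    (proj₁ p ≡ proj₁ u ℕ.* proj₁ (proj₂ u) × proj₂ p ≡ proj₁ u ℕ.* proj₂ (proj₂ u)) ×
    weight p ≤ scaledWeight u
  total {s , t} m = (g , a , b)
    , ∈-⋉⁺ (∈-range⁺ 1≤g (ℕP.≤-trans (ℕP.m≤m*n g a {{ℕ.>-nonZero 1≤a}}) (subst (ℕ._≤ N) s≡ s≤N)))
        (∈-coprimePairs⁺ 1≤a 1≤b (ℕP.≤-trans (ℕP.*-mono-≤ a≤s b≤t) st≤N) (coprime-/gcd s t))
    , (s≡ , t≡)
    , ≤-reflexive (trans (cong weight (cong₂ _,_ s≡ t≡)) (sym (weight-scaled g a b)))
    where
    1≤s : 1 ℕ.≤ s
    1≤s = proj₁ (∈-pairs⁻ {N} m)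
    1≤t : 1 ℕ.≤ t
    1≤t = proj₁ (proj₂ (∈-pairs⁻ {N} m))
    st≤N : s ℕ.* t ℕ.≤ N
    st≤N = proj₂ (proj₂ (∈-pairs⁻ {N} m))
    g : ℕ
    g = gcd s t
    1≤g : 1 ℕ.≤ g
    1≤g = ∣⇒1≤ (gcd[m,n]∣m s t) 1≤s
    instance
      g≢0 : ℕ.NonZero (gcd s t)
      g≢0 = ℕ.>-nonZero 1≤g
    a b : ℕ
    a = s ℕ./ gcd s t
    b = t ℕ./ gcd s t
    s≡ : s ≡ g ℕ.* a
    s≡ = sym (trans (ℕP.*-comm g a) (ℕD.m/n*n≡m (gcd[m,n]∣m s t)))
    t≡ : t ≡ g ℕ.* b
    t≡ = sym (trans (ℕP.*-comm g b) (ℕD.m/n*n≡m (gcd[m,n]∣n s t)))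
    1≤a : 1 ℕ.≤ a
    1≤a = ∣⇒1≤ (divides g s≡) 1≤s
    1≤b : 1 ℕ.≤ b
    1≤b = ∣⇒1≤ (divides g t≡) 1≤t
    s≤N : s ℕ.≤ N
    s≤N = ℕP.≤-trans (ℕP.m≤m*n s t {{ℕ.>-nonZero 1≤t}}) st≤N
    a≤s : a ℕ.≤ s
    a≤s = subst (a ℕ.≤_) (sym s≡) (ℕP.m≤n*m a g)
    b≤t : b ℕ.≤ t
    b≤t = subst (b ℕ.≤_) (sym t≡) (ℕP.m≤n*m b g)

-- Alternating series

Σ<-cong′ : ∀ m {f g} → (∀ i → i ℕ.< m → f i ≡ g i) → Σ< m f ≡ Σ< m g
Σ<-cong′ zero e = refl
Σ<-cong′ (suc m) e = cong₂ _+_ (Σ<-cong′ m (λ i i<m → e i (ℕP.m<n⇒m<1+n i<m))) (e m ℕP.≤-refl)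

Σ<-distrib : ∀ m f g → Σ< m (λ i → f i + g i) ≡ Σ< m f + Σ< m g
Σ<-distrib zero f g = refl
Σ<-distrib (suc m) f g = trans (cong (_+ (f m + g m)) (Σ<-distrib m f g))
  (lemma (Σ< m f) (Σ< m g) (f m) (g m))
  where
  lemma : ∀ a b c e → a + b + (c + e) ≡ a + c + (b + e)
  lemma = solve-∀ ℚ-ring

Σ<-swap : ∀ m k (f : ℕ → ℕ → ℚ) → Σ< m (λ i → Σ< k (f i)) ≡ Σ< k (λ j → Σ< m (λ i → f i j))
Σ<-swap m zero f = trans (Σ<-const m 0ℚ) (*-zeroʳ (ℕ→ℚ m))
Σ<-swap m (suc k) f = trans (Σ<-distrib m (λ i → Σ< k (f i)) (λ i → f i k))
  (cong (_+ Σ< m (λ i → f i k)) (Σ<-swap m k f))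

∣Σ<∣≤ : ∀ m f → ∣ Σ< m f ∣ ≤ Σ< m (λ i → ∣ f i ∣)
∣Σ<∣≤ zero f = ≤-refl
∣Σ<∣≤ (suc m) f = ≤-trans (∣p+q∣≤∣p∣+∣q∣ (Σ< m f) (f m)) (+-monoˡ-≤ ∣ f m ∣ (∣Σ<∣≤ m f))

Σ<-reverse : ∀ m f → Σ< m (λ i → f (m ∸ suc i)) ≡ Σ< m f
Σ<-reverse zero f = refl
Σ<-reverse (suc m) f = trans (Σ<-+ 1 m (λ i → f (m ∸ i))) (trans
  (cong (0ℚ + f m +_) (Σ<-reverse m f)) (lemma (f m) (Σ< m f)))
  where
  lemma : ∀ a b → 0ℚ + a + b ≡ b + a
  lemma = solve-∀ ℚ-ring

sg : ℕ → ℚ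
sg zero = 1ℚ
sg (suc n) = - sg n

sg-+ : ∀ m n → sg (m ℕ.+ n) ≡ sg m * sg n
sg-+ zero n = sym (*-identityˡ (sg n))
sg-+ (suc m) n = trans (cong -_ (sg-+ m n)) (neg-distribˡ-* (sg m) (sg n))

sg-square : ∀ n → sg n * sg n ≡ 1ℚ
sg-square zero = refl
sg-square (suc n) = trans (lemma (sg n)) (sg-square n)
  where
  lemma : ∀ a → (- a) * (- a) ≡ a * a
  lemma = solve-∀ ℚ-ring

∣sg∣ : ∀ n → ∣ sg n ∣ ≡ 1ℚ
∣sg∣ zero = refl
∣sg∣ (suc n) = trans (∣-p∣≡∣p∣ (sg n)) (∣sg∣ n)

sg-∸ : ∀ {m N} → m ℕ.≤ N → sg (N ∸ m) ≡ sg (N ℕ.+ m)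
sg-∸ {m} {N} m≤N = ≡-comb₁ (- sg (N ∸ m)) (sg-square m) (trans (cong (λ t → sg (N ∸ m) - t) e) (lemma (sg (N ∸ m)) (sg m)))
  where
  e : sg (N ℕ.+ m) ≡ sg (N ∸ m) * sg m * sg m
  e = trans (sg-+ N m) (cong (_* sg m) (trans (cong sg (sym (ℕP.m∸n+n≡m m≤N))) (sg-+ (N ∸ m) m)))
  lemma : ∀ a b → a - a * b * b ≡ (- a) * (b * b - 1ℚ)
  lemma = solve-∀ ℚ-ring

odd : ℕ → ℕ
odd k = suc (2 ℕ.* k)

-- Partial sums of 1 - 1/3 + 1/5 - ..., of 1 + 1/9 + 1/25 + ..., and of -1 + 1/2 - 1/3 + ....
A B U : ℕ → ℚ
A N = Σ< N (λ k → sg k * recip (odd k))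
B N = Σ< N (λ k → recip² (odd k))
U n = Σ< n (λ j → sg (suc j) * recip (suc j))

-- 2A² − B will turn out to be E, a combination of windows of the alternating
-- harmonic series, each bounded by its first term.
E-term : ℕ → ℕ → ℚ
E-term N m = recip (odd m) * (U (N ∸ suc m) - U (N ℕ.+ m))

E : ℕ → ℚ
E N = Σ< N (E-term N)

suc[N∸suc] : ∀ {m N} → m ℕ.< N → suc (N ∸ suc m) ≡ N ∸ m
suc[N∸suc] {m} {N} m<N = sym (ℕP.+-∸-assoc 1 m<N)

-- This is (u + v)(1/u + 1/v) = 4 + (v - u)(1/u - 1/v), divided by (u + v)(v - u). It is applied to
-- u = N - m and v = N + m + 1, with sum 2N + 1 and difference 2m + 1.
partial-fractions : ∀ {u v p M i j r s} → u * i ≡ 1ℚ → v * j ≡ 1ℚ → p * r ≡ 1ℚ → M * s ≡ 1ℚ →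
  M ≡ u + v → p ≡ v - u → r * (i + j) ≡ s * (ℕ→ℚ 4 * r + i - j)
partial-fractions {u} {v} {i = i} {j} {r} {s} ui vj pr Ms refl refl =
  trans (sym (*-identityˡ _)) (trans (cong (_* (r * (i + j))) (sym Ms)) (trans
    (≡-comb₂ (ℕ→ℚ 2 * r * s) (ℕ→ℚ 2 * r * s) ui vj (lemma u v i j r s))
    (trans (cong (λ t → s * (ℕ→ℚ 4 * r + t * (i - j))) pr)
      (cong (λ t → s * t) (lemma′ r i j)))))
  where
  lemma : ∀ u v i j r s → (u + v) * s * (r * (i + j)) - s * (ℕ→ℚ 4 * r + (v - u) * r * (i - j)) ≡
    ℕ→ℚ 2 * r * s * (u * i - 1ℚ) + ℕ→ℚ 2 * r * s * (v * j - 1ℚ)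
  lemma = solve-∀ ℚ-ring
  lemma′ : ∀ r i j → ℕ→ℚ 4 * r + 1ℚ * (i - j) ≡ ℕ→ℚ 4 * r + i - j
  lemma′ = solve-∀ ℚ-ring

fractions-at : ∀ {N m} → m ℕ.< N →
  recip (odd m) * (recip (N ∸ m) + recip (suc (N ℕ.+ m))) ≡
  recip (odd N) * (ℕ→ℚ 4 * recip (odd m) + recip (N ∸ m) - recip (suc (N ℕ.+ m)))
fractions-at {N} {m} m<N = partial-fractions {ℕ→ℚ u} {ℕ→ℚ (suc (N ℕ.+ m))} {ℕ→ℚ (odd m)} {ℕ→ℚ (odd N)}
  {recip u} {recip (suc (N ℕ.+ m))} {recip (odd m)} {recip (odd N)}
  (recip-inverse 1≤u) (recip-inverse {suc (N ℕ.+ m)} ℕP.0<1+n)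
  (recip-inverse {odd m} ℕP.0<1+n) (recip-inverse {odd N} ℕP.0<1+n)
  (trans (cong ℕ→ℚ M≡) (ℕ→ℚ-+ u (suc (N ℕ.+ m))))
  (trans (lemma (ℕ→ℚ (odd m)) (ℕ→ℚ u)) (cong (_- ℕ→ℚ u)
    (trans (sym (ℕ→ℚ-+ (odd m) u)) (cong ℕ→ℚ (sym v≡)))))
  where
  u = N ∸ m
  N≡ : N ≡ u ℕ.+ m
  N≡ = sym (ℕP.m∸n+n≡m (ℕP.<⇒≤ m<N))
  1≤u : 1 ℕ.≤ u
  1≤u = ℕP.m<n⇒0<n∸m m<N
  e₁ : ∀ u m → 1 ℕ.+ 2 ℕ.* (u ℕ.+ m) ≡ u ℕ.+ (1 ℕ.+ (u ℕ.+ m ℕ.+ m))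
  e₁ = ℕ-Solver.solve-∀
  e₂ : ∀ u m → 1 ℕ.+ (u ℕ.+ m ℕ.+ m) ≡ 1 ℕ.+ 2 ℕ.* m ℕ.+ u
  e₂ = ℕ-Solver.solve-∀
  M≡ : odd N ≡ u ℕ.+ suc (N ℕ.+ m)
  M≡ = trans (cong odd N≡) (trans (e₁ u m) (cong (λ t → u ℕ.+ suc (t ℕ.+ m)) (sym N≡)))
  v≡ : suc (N ℕ.+ m) ≡ odd m ℕ.+ u
  v≡ = trans (cong (λ t → suc (t ℕ.+ m)) N≡) (e₂ u m)
  lemma : ∀ p u → p ≡ p + u - u
  lemma = solve-∀ ℚ-ring

U-N∸ : ∀ {m N} → m ℕ.< N → U (N ∸ m) ≡ U (N ∸ suc m) + sg (N ℕ.+ m) * recip (N ∸ m)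
U-N∸ {m} {N} m<N = trans (cong U (sym (suc[N∸suc] m<N)))
  (cong (U (N ∸ suc m) +_) (trans (cong (λ t → sg t * recip t) (suc[N∸suc] m<N))
    (cong (_* recip (N ∸ m)) (sg-∸ (ℕP.<⇒≤ m<N)))))

-- The window slides by one: 1/(N - m) leaves and 1/(N + m + 1) enters. Their opposite parity makes
-- both changes carry the same sign, and partial fractions bring out the factor 1/(2N + 1), which is
-- free of m.
E-term-suc : ∀ {N m} → m ℕ.< N → E-term (suc N) m ≡ E-term N m +
  recip (odd N) * (ℕ→ℚ 4 * sg N * (sg m * recip (odd m)) +
    sg (N ℕ.+ m) * (recip (N ∸ m) - recip (suc (N ℕ.+ m))))
E-term-suc {N} {m} m<N = begin
  r * (U (N ∸ m) - (U (N ℕ.+ m) + (- s) * j))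
    ≡⟨ cong (λ t → r * (t - (U (N ℕ.+ m) + (- s) * j))) (U-N∸ m<N) ⟩
  r * (U (N ∸ suc m) + s * i - (U (N ℕ.+ m) + (- s) * j))
    ≡⟨ lemma₁ r (U (N ∸ suc m)) (U (N ℕ.+ m)) s i j ⟩
  E-term N m + s * (r * (i + j))
    ≡⟨ cong (λ t → E-term N m + s * t) (fractions-at m<N) ⟩
  E-term N m + s * (recip (odd N) * (ℕ→ℚ 4 * r + i - j))
    ≡⟨ ≡-comb₁ (ℕ→ℚ 4 * recip (odd N) * r) (sg-+ N m) (lemma₂ (E-term N m) s (recip (odd N)) r i j (sg N) (sg m)) ⟩
  E-term N m + recip (odd N) * (ℕ→ℚ 4 * sg N * (sg m * r) + s * (i - j)) ∎
  where
  open ≡-Reasoning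
  r = recip (odd m)
  s = sg (N ℕ.+ m)
  i = recip (N ∸ m)
  j = recip (suc (N ℕ.+ m))
  lemma₁ : ∀ r a b s i j → r * (a + s * i - (b + (- s) * j)) ≡ r * (a - b) + s * (r * (i + j))
  lemma₁ = solve-∀ ℚ-ring
  lemma₂ : ∀ e s R r i j a b → e + s * (R * (ℕ→ℚ 4 * r + i - j)) - (e + R * (ℕ→ℚ 4 * a * (b * r) + s * (i - j))) ≡
    ℕ→ℚ 4 * R * r * (s - a * b)
  lemma₂ = solve-∀ ℚ-ring

-- As m runs below N, the denominators N - m cover 1 to N and the N + m + 1 cover N + 1 to 2N.
U-2N : ∀ N → Σ< N (λ m → sg (N ℕ.+ m) * (recip (N ∸ m) - recip (suc (N ℕ.+ m)))) ≡ U (N ℕ.+ N)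
U-2N N = begin
  Σ< N (λ m → sg (N ℕ.+ m) * (recip (N ∸ m) - recip (suc (N ℕ.+ m))))
    ≡⟨ Σ<-cong′ N term ⟩
  Σ< N (λ m → u (N ∸ suc m) + u (N ℕ.+ m))
    ≡⟨ Σ<-distrib N (λ m → u (N ∸ suc m)) (λ m → u (N ℕ.+ m)) ⟩
  Σ< N (λ m → u (N ∸ suc m)) + Σ< N (λ m → u (N ℕ.+ m))
    ≡⟨ cong (_+ Σ< N (λ m → u (N ℕ.+ m))) (Σ<-reverse N u) ⟩
  U N + Σ< N (λ m → u (N ℕ.+ m))
    ≡⟨ Σ<-+ N N u ⟨
  U (N ℕ.+ N) ∎
  where
  open ≡-Reasoning
  u : ℕ → ℚ
  u j = sg (suc j) * recip (suc j)
  lemma : ∀ s i j → s * (i - j) ≡ s * i + (- s) * j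
  lemma = solve-∀ ℚ-ring
  term : ∀ m → m ℕ.< N → sg (N ℕ.+ m) * (recip (N ∸ m) - recip (suc (N ℕ.+ m))) ≡ u (N ∸ suc m) + u (N ℕ.+ m)
  term m m<N = trans (lemma (sg (N ℕ.+ m)) (recip (N ∸ m)) (recip (suc (N ℕ.+ m))))
    (cong (_+ u (N ℕ.+ m)) (trans (cong (_* recip (N ∸ m)) (sym (sg-∸ (ℕP.<⇒≤ m<N))))
      (cong (λ t → sg t * recip t) (sym (suc[N∸suc] m<N)))))

-- Apart from the factor 1/(2N + 1), the old windows together change by 4 (-1)^N A N + U(2N), and
-- the new one, m = N, is -U(2N + 1). The two U(2N) cancel.
E-suc : ∀ N → E (suc N) ≡ E N + recip (odd N) * (ℕ→ℚ 4 * sg N * A N + recip (odd N))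
E-suc N = begin
  Σ< N (E-term (suc N)) + rN * (U (N ∸ N) - U (suc (N ℕ.+ N)))
    ≡⟨ cong₂ (λ s t → s + rN * (t - U (suc (N ℕ.+ N)))) inner (cong U (ℕP.n∸n≡0 N)) ⟩
  E N + rN * (ℕ→ℚ 4 * sg N * A N + U (N ℕ.+ N)) + rN * (0ℚ - (U (N ℕ.+ N) + sg (suc (N ℕ.+ N)) * recip (suc (N ℕ.+ N))))
    ≡⟨ cong₂ (λ s t → E N + rN * (ℕ→ℚ 4 * sg N * A N + U (N ℕ.+ N)) + rN * (0ℚ - (U (N ℕ.+ N) + s * t)))
        (cong -_ (trans (sg-+ N N) (sg-square N))) (cong (λ t → recip (suc (N ℕ.+ t))) (sym (ℕP.+-identityʳ N))) ⟩
  E N + rN * (ℕ→ℚ 4 * sg N * A N + U (N ℕ.+ N)) + rN * (0ℚ - (U (N ℕ.+ N) + (- 1ℚ) * rN))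
    ≡⟨ lemma (E N) rN (ℕ→ℚ 4 * sg N * A N) (U (N ℕ.+ N)) ⟩
  E N + rN * (ℕ→ℚ 4 * sg N * A N + rN) ∎
  where
  open ≡-Reasoning
  rN = recip (odd N)
  lemma : ∀ e r a u → e + r * (a + u) + r * (0ℚ - (u + (- 1ℚ) * r)) ≡ e + r * (a + r)
  lemma = solve-∀ ℚ-ring
  V : ℕ → ℚ
  V m = sg (N ℕ.+ m) * (recip (N ∸ m) - recip (suc (N ℕ.+ m)))
  a : ℕ → ℚ
  a m = sg m * recip (odd m)
  inner : Σ< N (E-term (suc N)) ≡ E N + rN * (ℕ→ℚ 4 * sg N * A N + U (N ℕ.+ N))
  inner = begin
    Σ< N (E-term (suc N))
      ≡⟨ Σ<-cong′ N (λ m m<N → E-term-suc m<N) ⟩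
    Σ< N (λ m → E-term N m + rN * (ℕ→ℚ 4 * sg N * a m + V m))
      ≡⟨ Σ<-distrib N (E-term N) (λ m → rN * (ℕ→ℚ 4 * sg N * a m + V m)) ⟩
    E N + Σ< N (λ m → rN * (ℕ→ℚ 4 * sg N * a m + V m))
      ≡⟨ cong (E N +_) (Σ<-*ˡ N rN (λ m → ℕ→ℚ 4 * sg N * a m + V m)) ⟩
    E N + rN * Σ< N (λ m → ℕ→ℚ 4 * sg N * a m + V m)
      ≡⟨ cong (λ t → E N + rN * t) (Σ<-distrib N (λ m → ℕ→ℚ 4 * sg N * a m) V) ⟩
    E N + rN * (Σ< N (λ m → ℕ→ℚ 4 * sg N * a m) + Σ< N V)
      ≡⟨ cong₂ (λ s t → E N + rN * (s + t)) (Σ<-*ˡ N (ℕ→ℚ 4 * sg N) a) (U-2N N) ⟩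
    E N + rN * (ℕ→ℚ 4 * sg N * A N + U (N ℕ.+ N)) ∎

-- Induction replaces the rearrangement of a double sum: with r = 1/(2N + 1), both sides grow by r(4
-- (-1)^N A N + r).
2A²-B≡E : ∀ N → ℕ→ℚ 2 * (A N * A N) - B N ≡ E N
2A²-B≡E zero = refl
2A²-B≡E (suc N) = ≡-comb₂ 1ℚ (ℕ→ℚ 2 * r * r) (2A²-B≡E N) (sg-square N)
  (trans (cong (λ t → ℕ→ℚ 2 * (A (suc N) * A (suc N)) - B (suc N) - t) (E-suc N))
    (lemma (A N) (B N) (E N) (sg N) r))
  where
  r = recip (odd N)
  lemma : ∀ a b e s r → ℕ→ℚ 2 * ((a + s * r) * (a + s * r)) - (b + r * r) - (e + r * (ℕ→ℚ 4 * s * a + r)) ≡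
    1ℚ * (ℕ→ℚ 2 * (a * a) - b - e) + ℕ→ℚ 2 * r * r * (s * s - 1ℚ)
  lemma = solve-∀ ℚ-ring

-- Leibniz's criterion: a stretch of the series is its first term minus the next shorter stretch,
-- which by induction lies between 0 and the second term.
alternating : ∀ k n → 0ℚ ≤ sg (suc n) * (U (k ℕ.+ n) - U n) × sg (suc n) * (U (k ℕ.+ n) - U n) ≤ recip (suc n)
alternating zero n = ≤-reflexive (sym zero≡) , subst (_≤ recip (suc n)) (sym zero≡) (0≤recip (suc n))
  where
  zero≡ : sg (suc n) * (U n - U n) ≡ 0ℚ
  zero≡ = trans (cong (sg (suc n) *_) (+-inverseʳ (U n))) (*-zeroʳ (sg (suc n)))
alternating (suc k) n = subst (0ℚ ≤_) (sym e) (≤-trans (p≤q⇒0≤q-p (recip-anti {suc n} {2 ℕ.+ n} ℕP.0<1+n (ℕP.n≤1+n _)))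
    (≤-comb₁ 1ℚ (<⇒≤ 0<1) hi (lemma₂ (recip (suc n)) (recip (2 ℕ.+ n)) rest)))
  , subst (_≤ recip (suc n)) (sym e) (≤-comb₁ 1ℚ (<⇒≤ 0<1) lo (lemma₃ (recip (suc n)) rest))
  where
  rest = sg (2 ℕ.+ n) * (U (k ℕ.+ suc n) - U (suc n))
  lo : 0ℚ ≤ rest
  lo = proj₁ (alternating k (suc n))
  hi : rest ≤ recip (2 ℕ.+ n)
  hi = proj₂ (alternating k (suc n))
  lemma : ∀ s u w r → s * (u - w) - (r - (- s) * (u - (w + s * r))) ≡ r * (s * s - 1ℚ)
  lemma = solve-∀ ℚ-ring
  e : sg (suc n) * (U (suc k ℕ.+ n) - U n) ≡ recip (suc n) - rest
  e = trans (cong (λ t → sg (suc n) * (U t - U n)) (sym (ℕP.+-suc k n)))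
    (≡-comb₁ (recip (suc n)) (sg-square (suc n))
      (lemma (sg (suc n)) (U (k ℕ.+ suc n)) (U n) (recip (suc n))))
  lemma₂ : ∀ r i t → r - t - (r - i) ≡ 1ℚ * (i - t)
  lemma₂ = solve-∀ ℚ-ring
  lemma₃ : ∀ r t → r - (r - t) ≡ 1ℚ * (t - 0ℚ)
  lemma₃ = solve-∀ ℚ-ring

∣window∣≤ : ∀ {m N} → m ℕ.< N → ∣ U (N ∸ suc m) - U (N ℕ.+ m) ∣ ≤ recip (N ∸ m)
∣window∣≤ {m} {N} m<N = begin
  ∣ U n - U (N ℕ.+ m) ∣                   ≡⟨ cong (λ t → ∣ U n - U t ∣) N+m≡ ⟩
  ∣ U n - U (k ℕ.+ n) ∣                   ≡⟨ trans (cong ∣_∣ (lemma (U n) (U (k ℕ.+ n)))) (∣-p∣≡∣p∣ (U (k ℕ.+ n) - U n)) ⟩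
  ∣ U (k ℕ.+ n) - U n ∣                   ≡⟨ trans (cong (_* ∣ U (k ℕ.+ n) - U n ∣) (∣sg∣ (suc n))) (*-identityˡ _) ⟨
  ∣ sg (suc n) ∣ * ∣ U (k ℕ.+ n) - U n ∣   ≡⟨ ∣p*q∣≡∣p∣*∣q∣ (sg (suc n)) (U (k ℕ.+ n) - U n) ⟨
  ∣ sg (suc n) * (U (k ℕ.+ n) - U n) ∣    ≡⟨ 0≤p⇒∣p∣≡p (proj₁ (alternating k n)) ⟩
  sg (suc n) * (U (k ℕ.+ n) - U n)        ≤⟨ proj₂ (alternating k n) ⟩
  recip (suc n)                           ≡⟨ cong recip (suc[N∸suc] m<N) ⟩
  recip (N ∸ m)                           ∎
  where
  open ≤-Reasoning
  n = N ∸ suc m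
  k = suc (2 ℕ.* m)
  lemma : ∀ a b → a - b ≡ - (b - a)
  lemma = solve-∀ ℚ-ring
  ℕ-lemma : ∀ n m → n ℕ.+ (1 ℕ.+ m) ℕ.+ m ≡ 1 ℕ.+ 2 ℕ.* m ℕ.+ n
  ℕ-lemma = ℕ-Solver.solve-∀
  N+m≡ : N ℕ.+ m ≡ k ℕ.+ n
  N+m≡ = trans (cong (ℕ._+ m) (sym (ℕP.m∸n+n≡m m<N))) (ℕ-lemma n m)

-- Since 2N + 1 = (2m + 1) + 2(N - m), the bound for window m, multiplied by 2N + 1, is 1/(N - m) +
-- 2/(2m + 1). Both parts sum to harmonic numbers, so E is O(log N / N).
∣E∣≤ : ∀ N → ℕ→ℚ (odd N) * ∣ E N ∣ ≤ ℕ→ℚ 3 * h N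
∣E∣≤ N = begin
  ℕ→ℚ (odd N) * ∣ E N ∣
    ≤⟨ *-monoˡ (ℕ→ℚ (odd N)) (0≤ℕ→ℚ (odd N)) (≤-trans (∣Σ<∣≤ N (E-term N)) (Σ<-mono N term)) ⟩
  ℕ→ℚ (odd N) * Σ< N (λ m → recip (odd m) * recip (N ∸ m))
    ≡⟨ Σ<-*ˡ N (ℕ→ℚ (odd N)) (λ m → recip (odd m) * recip (N ∸ m)) ⟨
  Σ< N (λ m → ℕ→ℚ (odd N) * (recip (odd m) * recip (N ∸ m)))
    ≤⟨ Σ<-mono N split ⟩
  Σ< N (λ m → recip (suc (N ∸ suc m)) + ℕ→ℚ 2 * recip (suc m))
    ≡⟨ Σ<-distrib N (λ m → recip (suc (N ∸ suc m))) (λ m → ℕ→ℚ 2 * recip (suc m)) ⟩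
  Σ< N (λ m → recip (suc (N ∸ suc m))) + Σ< N (λ m → ℕ→ℚ 2 * recip (suc m))
    ≡⟨ cong₂ _+_ (trans (Σ<-reverse N (λ j → recip (suc j))) (Σ<-recip N))
        (trans (Σ<-*ˡ N (ℕ→ℚ 2) (λ m → recip (suc m))) (cong (ℕ→ℚ 2 *_) (Σ<-recip N))) ⟩
  h N + ℕ→ℚ 2 * h N
    ≡⟨ lemma (h N) ⟩
  ℕ→ℚ 3 * h N ∎
  where
  open ≤-Reasoning
  lemma : ∀ h → h + ℕ→ℚ 2 * h ≡ ℕ→ℚ 3 * h
  lemma = solve-∀ ℚ-ring
  term : ∀ m → m ℕ.< N → ∣ E-term N m ∣ ≤ recip (odd m) * recip (N ∸ m)
  term m m<N = ≤-trans
    (≤-reflexive (trans (∣p*q∣≡∣p∣*∣q∣ (recip (odd m)) (U (N ∸ suc m) - U (N ℕ.+ m)))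
      (cong (_* ∣ U (N ∸ suc m) - U (N ℕ.+ m) ∣) (0≤p⇒∣p∣≡p (0≤recip (odd m))))))
    (*-monoˡ (recip (odd m)) (0≤recip (odd m)) (∣window∣≤ m<N))
  split : ∀ m → m ℕ.< N → ℕ→ℚ (odd N) * (recip (odd m) * recip (N ∸ m)) ≤ recip (suc (N ∸ suc m)) + ℕ→ℚ 2 * recip (suc m)
  split m m<N = subst (_≤ recip (suc (N ∸ suc m)) + ℕ→ℚ 2 * recip (suc m)) (sym split≡)
    (+-mono-≤ (≤-reflexive (cong recip (sym (suc[N∸suc] m<N))))
      (*-monoˡ (ℕ→ℚ 2) (0≤ℕ→ℚ 2) (recip-anti {suc m} {odd m} ℕP.0<1+n (ℕ.s≤s (ℕP.m≤m+n m (m ℕ.+ 0))))))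
    where
    u = N ∸ m
    ℕ-lemma : ∀ u m → 1 ℕ.+ 2 ℕ.* (u ℕ.+ m) ≡ 1 ℕ.+ 2 ℕ.* m ℕ.+ 2 ℕ.* u
    ℕ-lemma = ℕ-Solver.solve-∀
    M≡ : ℕ→ℚ (odd N) ≡ ℕ→ℚ (odd m) + ℕ→ℚ 2 * ℕ→ℚ u
    M≡ = trans (cong ℕ→ℚ (trans (cong odd (sym (ℕP.m∸n+n≡m (ℕP.<⇒≤ m<N)))) (ℕ-lemma u m)))
      (trans (ℕ→ℚ-+ (odd m) (2 ℕ.* u)) (cong (ℕ→ℚ (odd m) +_) (ℕ→ℚ-* 2 u)))
    lemma′ : ∀ p u r i → (p + ℕ→ℚ 2 * u) * (r * i) - (i + ℕ→ℚ 2 * r) ≡ i * (p * r - 1ℚ) + ℕ→ℚ 2 * r * (u * i - 1ℚ)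
    lemma′ = solve-∀ ℚ-ring
    split≡ : ℕ→ℚ (odd N) * (recip (odd m) * recip u) ≡ recip u + ℕ→ℚ 2 * recip (odd m)
    split≡ = trans (cong (_* (recip (odd m) * recip u)) M≡)
      (≡-comb₂ (recip u) (ℕ→ℚ 2 * recip (odd m)) (recip-inverse {odd m} ℕP.0<1+n)
        (recip-inverse (ℕP.m<n⇒0<n∸m m<N)) (lemma′ (ℕ→ℚ (odd m)) (ℕ→ℚ u) (recip (odd m)) (recip u)))

-- Along squares the harmonic numbers are visibly of smaller order.
∣2A²-B∣≤ : ∀ {K} → 1 ℕ.≤ K → ℕ→ℚ K * ∣ ℕ→ℚ 2 * (A (K ℕ.* K) * A (K ℕ.* K)) - B (K ℕ.* K) ∣ ≤ ℕ→ℚ 6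
∣2A²-B∣≤ {suc k} _ = *-cancelˡ (ℕ→ℚ K) (0<suc k) (begin
  ℕ→ℚ K * (ℕ→ℚ K * ∣ ℕ→ℚ 2 * (A N * A N) - B N ∣)  ≡⟨ cong (λ t → ℕ→ℚ K * (ℕ→ℚ K * ∣ t ∣)) (2A²-B≡E N) ⟩
  ℕ→ℚ K * (ℕ→ℚ K * ∣ E N ∣)  ≡⟨ trans (cong (_* ∣ E N ∣) (ℕ→ℚ-* K K)) (*-assoc (ℕ→ℚ K) (ℕ→ℚ K) ∣ E N ∣) ⟨
  ℕ→ℚ N * ∣ E N ∣            ≤⟨ *-monoʳ ∣ E N ∣ (0≤∣p∣ (E N)) (ℕ→ℚ-mono (ℕP.m≤n⇒m≤1+n (ℕP.m≤m+n N (N ℕ.+ 0)))) ⟩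
  ℕ→ℚ (odd N) * ∣ E N ∣      ≤⟨ ∣E∣≤ N ⟩
  ℕ→ℚ 3 * h N                ≤⟨ *-monoˡ (ℕ→ℚ 3) (0≤ℕ→ℚ 3) (≤-trans (h-*≤ {K} k ℕP.0<1+n)
                                 (+-mono-≤ (h≤n K) (≤-trans (h-mono (ℕP.n≤1+n k)) (h≤n K)))) ⟩
  ℕ→ℚ 3 * (ℕ→ℚ K + ℕ→ℚ K)    ≡⟨ lemma (ℕ→ℚ K) ⟩
  ℕ→ℚ K * ℕ→ℚ 6              ∎)
  where
  open ≤-Reasoning
  K = suc k
  N = K ℕ.* K
  lemma : ∀ k → ℕ→ℚ 3 * (k + k) ≡ k * ℕ→ℚ 6
  lemma = solve-∀ ℚ-ring

-- From odd squares to all squares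

¼ : ℚ
¼ = ½ * ½

-- The even terms of Z(2N) make up a quarter of Z N. As Z(2N) exceeds Z N by at most 1/N, this puts
-- B N within 1/N of three quarters of Z N.
Z-double : ∀ N → Z (2 ℕ.* N) ≡ B N + ¼ * Z N
Z-double zero = refl
Z-double (suc N) = begin
  Z (2 ℕ.* suc N)                                        ≡⟨ cong Z 2sucN ⟩
  recip² (2 ℕ.+ 2 ℕ.* N) + (recip² (odd N) + Z (2 ℕ.* N)) ≡⟨ cong₂ (λ s t → s + (recip² (odd N) + t)) even (Z-double N) ⟩
  ¼ * recip² (suc N) + (recip² (odd N) + (B N + ¼ * Z N)) ≡⟨ lemma ¼ (recip² (suc N)) (recip² (odd N)) (B N) (Z N) ⟩
  B N + recip² (odd N) + ¼ * (recip² (suc N) + Z N)      ∎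
  where
  open ≡-Reasoning
  2sucN : 2 ℕ.* suc N ≡ 2 ℕ.+ 2 ℕ.* N
  2sucN = ℕP.*-suc 2 N
  lemma′ : ∀ a b → a * b * (a * b) ≡ a * a * (b * b)
  lemma′ = solve-∀ ℚ-ring
  even : recip² (2 ℕ.+ 2 ℕ.* N) ≡ ¼ * recip² (suc N)
  even = trans (cong recip² (sym 2sucN)) (trans (cong (λ t → t * t) (recip-* 2 (suc N))) (lemma′ ½ (recip (suc N))))
  lemma : ∀ q a b c e → q * a + (b + (c + q * e)) ≡ c + b + q * (a + e)
  lemma = solve-∀ ℚ-ring

¾Z≤B : ∀ N → Z N ≤ B N + ¼ * Z N
¾Z≤B N = subst (Z N ≤_) (Z-double N) (Z-mono (ℕP.m≤m+n N (N ℕ.+ 0)))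

B≤¾Z : ∀ {N} → 1 ℕ.≤ N → B N + ¼ * Z N ≤ Z N + recip N
B≤¾Z {N} 1≤N = subst (_≤ Z N + recip N) (Z-double N) (Z≤ (2 ℕ.* N) 1≤N)

-- Leibniz's series

pow : ℚ → ℕ → ℚ
pow x zero = 1ℚ
pow x (suc n) = x * pow x n

0≤pow : ∀ {x} n → 0ℚ ≤ x → 0ℚ ≤ pow x n
0≤pow zero _ = <⇒≤ 0<1
0≤pow (suc n) 0≤x = 0≤* 0≤x (0≤pow n 0≤x)

pow-mono : ∀ {x y} n → 0ℚ ≤ x → x ≤ y → pow x n ≤ pow y n
pow-mono zero _ _ = ≤-refl
pow-mono (suc n) 0≤x x≤y = *-mono-≤-≤ 0≤x x≤y (0≤pow n 0≤x) (pow-mono n 0≤x x≤y)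

pow-1 : ∀ n → pow 1ℚ n ≡ 1ℚ
pow-1 zero = refl
pow-1 (suc n) = trans (*-identityˡ (pow 1ℚ n)) (pow-1 n)

pow-square : ∀ x n → pow (x * x) n ≡ pow x (2 ℕ.* n)
pow-square x zero = refl
pow-square x (suc n) = trans (cong (x * x *_) (pow-square x n))
  (trans (*-assoc x x (pow x (2 ℕ.* n))) (cong (pow x) (sym (ℕP.*-suc 2 n))))

geometric : ℚ → ℕ → ℚ
geometric w K = Σ< K (λ k → sg k * pow w k)

geometric-sum : ∀ w K → (1ℚ + w) * geometric w K ≡ 1ℚ - sg K * pow w K
geometric-sum w zero = *-zeroʳ (1ℚ + w)
geometric-sum w (suc K) = ≡-comb₁ 1ℚ (geometric-sum w K) (lemma w (geometric w K) (sg K) (pow w K))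
  where
  lemma : ∀ w g s p → (1ℚ + w) * (g + s * p) - (1ℚ - (- s) * (w * p)) ≡ 1ℚ * ((1ℚ + w) * g - (1ℚ - s * p))
  lemma = solve-∀ ℚ-ring

-- The remainder is exactly w^K/(1 + w), up to sign.
∣inv-geometric∣≤ : ∀ {w} K → 0ℚ ≤ w → ∣ inv (1ℚ + w) - geometric w K ∣ ≤ pow w K
∣inv-geometric∣≤ {w} K 0≤w = begin
  ∣ i - geometric w K ∣        ≡⟨ cong ∣_∣ (≡-comb₂ (1ℚ * g) (- i) (inverseʳ 0<1+w) (geometric-sum w K) (lemma w i g s p)) ⟩
  ∣ s * (p * i) ∣              ≡⟨ trans (∣p*q∣≡∣p∣*∣q∣ s (p * i)) (trans (cong (_* ∣ p * i ∣) (∣sg∣ K)) (*-identityˡ ∣ p * i ∣)) ⟩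
  ∣ p * i ∣                    ≡⟨ 0≤p⇒∣p∣≡p (0≤* 0≤p 0≤i) ⟩
  p * i                        ≤⟨ *-monoˡ p 0≤p i≤1 ⟩
  p * 1ℚ                       ≡⟨ *-identityʳ p ⟩
  p                            ∎
  where
  open ≤-Reasoning
  i = inv (1ℚ + w)
  g = geometric w K
  s = sg K
  p = pow w K
  1≤1+w : 1ℚ ≤ 1ℚ + w
  1≤1+w = ≤-by w 0≤w refl
  0<1+w : 0ℚ < 1ℚ + w
  0<1+w = <-≤-trans 0<1 1≤1+w
  0≤i : 0ℚ ≤ i
  0≤i = <⇒≤ (0<inv 0<1+w)
  0≤p : 0ℚ ≤ p
  0≤p = 0≤pow K 0≤w
  i≤1 : i ≤ 1ℚ
  i≤1 = inv-anti 0<1 1≤1+w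
  lemma : ∀ w i g s p → i - g - s * (p * i) ≡ (1ℚ * g) * ((1ℚ + w) * i - 1ℚ) + (- i) * ((1ℚ + w) * g - (1ℚ - s * p))
  lemma = solve-∀ ℚ-ring

-- With `≤pow-step`, a mean value inequality for t^(j + 1). Telescoped over a division of [0, 1],
-- the two replace the integration of t^j.
pow-step≤ : ∀ {u δ} j → 0ℚ ≤ u → 0ℚ ≤ δ → pow (u + δ) (suc j) - pow u (suc j) ≤ ℕ→ℚ (suc j) * (δ * pow (u + δ) j)
pow-step≤ {u} {δ} zero 0≤u 0≤δ = ≤-reflexive (lemma u δ)
  where
  lemma : ∀ u δ → (u + δ) * 1ℚ - u * 1ℚ ≡ 1ℚ * (δ * 1ℚ)
  lemma = solve-∀ ℚ-ring
pow-step≤ {u} {δ} (suc j) 0≤u 0≤δ =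
  subst (λ t → v * pow v (suc j) - u * pow u (suc j) ≤ t * (δ * pow v (suc j))) (sym (ℕ→ℚ-suc (suc j)))
    (≤-comb₂ v δ 0≤v 0≤δ (pow-step≤ j 0≤u 0≤δ) (pow-mono (suc j) 0≤u u≤v)
      (lemma u δ (pow v j) (pow u (suc j)) (ℕ→ℚ (suc j))))
  where
  v = u + δ
  0≤v : 0ℚ ≤ v
  0≤v = 0≤+ 0≤u 0≤δ
  u≤v : u ≤ v
  u≤v = ≤-by δ 0≤δ refl
  lemma : ∀ u δ p q n → (1ℚ + n) * (δ * ((u + δ) * p)) - ((u + δ) * ((u + δ) * p) - u * q) ≡
    (u + δ) * (n * (δ * p) - ((u + δ) * p - q)) + δ * ((u + δ) * p - q)
  lemma = solve-∀ ℚ-ring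

≤pow-step : ∀ {u δ} j → 0ℚ ≤ u → 0ℚ ≤ δ → ℕ→ℚ (suc j) * (δ * pow u j) ≤ pow (u + δ) (suc j) - pow u (suc j)
≤pow-step {u} {δ} zero 0≤u 0≤δ = ≤-reflexive (lemma u δ)
  where
  lemma : ∀ u δ → 1ℚ * (δ * 1ℚ) ≡ (u + δ) * 1ℚ - u * 1ℚ
  lemma = solve-∀ ℚ-ring
≤pow-step {u} {δ} (suc j) 0≤u 0≤δ =
  subst (λ t → t * (δ * pow u (suc j)) ≤ v * pow v (suc j) - u * pow u (suc j)) (sym (ℕ→ℚ-suc (suc j)))
    (≤-comb₂ u δ 0≤u 0≤δ (≤pow-step j 0≤u 0≤δ) (pow-mono (suc j) 0≤u u≤v)
      (lemma u δ (pow u j) (pow v (suc j)) (ℕ→ℚ (suc j))))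
  where
  v = u + δ
  u≤v : u ≤ v
  u≤v = ≤-by δ 0≤δ refl
  lemma : ∀ u δ p q n → (u + δ) * q - u * (u * p) - (1ℚ + n) * (δ * (u * p)) ≡
    u * (q - u * p - n * (δ * p)) + δ * (q - u * p)
  lemma = solve-∀ ℚ-ring

Σ<-telescope : ∀ m (g : ℕ → ℚ) → Σ< m (λ i → g (suc i) - g i) ≡ g m - g 0
Σ<-telescope zero g = sym (+-inverseʳ (g 0))
Σ<-telescope (suc m) g = trans (cong (_+ (g (suc m) - g m)) (Σ<-telescope m g)) (lemma (g m) (g 0) (g (suc m)))
  where
  lemma : ∀ a b c → a - b + (c - a) ≡ c - b
  lemma = solve-∀ ℚ-ring

quarterπ : ℕ → ℚ
quarterπ = riemann 0ℚ 1ℚ arctan′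

module UnitInterval (m : ℕ) where

  n : ℕ
  n = suc m

  δ : ℚ
  δ = step 0ℚ 1ℚ m

  δ≡ : δ ≡ recip n
  δ≡ = *-identityˡ (recip n)

  0≤δ : 0ℚ ≤ δ
  0≤δ = subst (0ℚ ≤_) (sym δ≡) (0≤recip n)

  nδ≡1 : ℕ→ℚ n * δ ≡ 1ℚ
  nδ≡1 = trans (cong (ℕ→ℚ n *_) δ≡) (recip-inverse {n} ℕP.0<1+n)

  point : ℕ → ℚ
  point i = 0ℚ + ℕ→ℚ i * δ

  0≤point : ∀ i → 0ℚ ≤ point i
  0≤point i = 0≤+ (≤-refl {0ℚ}) (0≤* (0≤ℕ→ℚ i) 0≤δ)

  point-suc : ∀ i → point (suc i) ≡ point i + δ
  point-suc i = trans (cong (λ t → 0ℚ + t * δ) (ℕ→ℚ-suc i)) (lemma (ℕ→ℚ i) δ)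
    where
    lemma : ∀ i δ → 0ℚ + (1ℚ + i) * δ ≡ 0ℚ + i * δ + δ
    lemma = solve-∀ ℚ-ring

  point-0 : point 0 ≡ 0ℚ
  point-0 = trans (+-identityˡ (0ℚ * δ)) (*-zeroˡ δ)

  point-n : point n ≡ 1ℚ
  point-n = trans (+-identityˡ (ℕ→ℚ n * δ)) nδ≡1

  -- The right Riemann sum of t^j over [0, 1].
  moment : ℕ → ℚ
  moment j = δ * Σ< n (λ i → pow (point (suc i)) j)

  private
    steps : ℕ → ℚ
    steps j = Σ< n (λ i → pow (point (suc i)) (suc j) - pow (point i) (suc j))

    steps≡1 : ∀ j → steps j ≡ 1ℚ
    steps≡1 j = trans (Σ<-telescope n (λ i → pow (point i) (suc j)))
      (trans (cong₂ (λ s t → pow s (suc j) - t) point-n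
          (trans (cong (λ t → t * pow (point 0) j) point-0) (*-zeroˡ (pow (point 0) j))))
        (cong (_- 0ℚ) (pow-1 (suc j))))

    factor : ∀ j (g : ℕ → ℚ) → Σ< n (λ i → ℕ→ℚ (suc j) * (δ * g i)) ≡ ℕ→ℚ (suc j) * (δ * Σ< n g)
    factor j g = trans (Σ<-*ˡ n (ℕ→ℚ (suc j)) (λ i → δ * g i)) (cong (ℕ→ℚ (suc j) *_) (Σ<-*ˡ n δ g))

  ≤moment : ∀ j → recip (suc j) ≤ moment j
  ≤moment j = *-cancelˡ (ℕ→ℚ (suc j)) (0<suc j) (subst₂ _≤_
    (trans (steps≡1 j) (sym (recip-inverse {suc j} ℕP.0<1+n)))
    (factor j (λ i → pow (point (suc i)) j))
    (Σ<-mono n (λ i _ → subst (λ t → pow t (suc j) - pow (point i) (suc j) ≤ ℕ→ℚ (suc j) * (δ * pow t j))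
      (sym (point-suc i)) (pow-step≤ j (0≤point i) 0≤δ))))

  -- The left sum is at most 1/(j + 1), and the right sum exceeds it by at most one step, as t^j
  -- grows by at most 1 over the interval.
  moment≤ : ∀ j → moment j ≤ recip (suc j) + δ
  moment≤ j = *-cancelˡ (ℕ→ℚ (suc j)) (0<suc j)
    (≤-comb₂ 1ℚ (ℕ→ℚ (suc j) * δ) (<⇒≤ 0<1) (0≤* (0≤ℕ→ℚ (suc j)) 0≤δ) lower (0≤pow j (0≤point 0))
      (trans (cong (_- ℕ→ℚ (suc j) * moment j) expand) (trans
        (cong (λ t → 1ℚ + ℕ→ℚ (suc j) * δ - ℕ→ℚ (suc j) * (δ * t)) shift)
        (lemma (ℕ→ℚ (suc j)) δ left (pow (point 0) j)))))
    where
    left = Σ< n (λ i → pow (point i) j)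
    shift : Σ< n (λ i → pow (point (suc i)) j) ≡ left - pow (point 0) j + 1ℚ
    shift = trans (lemma₂ (Σ< n (λ i → pow (point (suc i)) j)) (pow (point 0) j) (pow (point n) j))
      (cong₂ (λ s t → s - pow (point 0) j + t) (sym (Σ<-shift n (λ i → pow (point i) j)))
        (trans (cong (λ t → pow t j) point-n) (pow-1 j)))
      where
      lemma₂ : ∀ s a b → s ≡ s + (a - b) - a + b
      lemma₂ = solve-∀ ℚ-ring
    expand : ℕ→ℚ (suc j) * (recip (suc j) + δ) ≡ 1ℚ + ℕ→ℚ (suc j) * δ
    expand = trans (*-distribˡ-+ (ℕ→ℚ (suc j)) (recip (suc j)) δ)
      (cong (_+ ℕ→ℚ (suc j) * δ) (recip-inverse {suc j} ℕP.0<1+n))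
    lower : ℕ→ℚ (suc j) * (δ * left) ≤ 1ℚ
    lower = subst₂ _≤_ (factor j (λ i → pow (point i) j)) (steps≡1 j)
      (Σ<-mono n (λ i _ → subst (λ t → ℕ→ℚ (suc j) * (δ * pow (point i) j) ≤ pow t (suc j) - pow (point i) (suc j))
        (sym (point-suc i)) (≤pow-step j (0≤point i) 0≤δ)))
    lemma : ∀ n δ l p → 1ℚ + n * δ - n * (δ * (l - p + 1ℚ)) ≡ 1ℚ * (1ℚ - n * (δ * l)) + n * δ * (p - 0ℚ)
    lemma = solve-∀ ℚ-ring

  approx : ℕ → ℚ
  approx K = Σ< K (λ k → sg k * moment (2 ℕ.* k))

  approx≡ : ∀ K → approx K ≡ δ * Σ< n (λ i → geometric (point (suc i) * point (suc i)) K)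
  approx≡ K = sym (begin
    δ * Σ< n (λ i → geometric (t i * t i) K)
      ≡⟨ cong (δ *_) (Σ<-swap n K (λ i k → sg k * pow (t i * t i) k)) ⟩
    δ * Σ< K (λ k → Σ< n (λ i → sg k * pow (t i * t i) k))
      ≡⟨ Σ<-*ˡ K δ (λ k → Σ< n (λ i → sg k * pow (t i * t i) k)) ⟨
    Σ< K (λ k → δ * Σ< n (λ i → sg k * pow (t i * t i) k))
      ≡⟨ Σ<-cong K term ⟩
    approx K ∎)
    where
    open ≡-Reasoning
    t : ℕ → ℚ
    t i = point (suc i)
    lemma : ∀ d s x → d * (s * x) ≡ s * (d * x)
    lemma = solve-∀ ℚ-ring
    term : ∀ k → δ * Σ< n (λ i → sg k * pow (t i * t i) k) ≡ sg k * moment (2 ℕ.* k)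
    term k = trans (cong (δ *_) (trans (Σ<-*ˡ n (sg k) (λ i → pow (t i * t i) k))
        (cong (sg k *_) (Σ<-cong n (λ i → pow-square (t i) k)))))
      (lemma δ (sg k) (Σ< n (λ i → pow (t i) (2 ℕ.* k))))

  ∣quarterπ-approx∣≤ : ∀ K → ∣ quarterπ m - approx K ∣ ≤ moment (2 ℕ.* K)
  ∣quarterπ-approx∣≤ K = begin
    ∣ quarterπ m - approx K ∣
      ≡⟨ cong ∣_∣ (trans (cong (λ t → quarterπ m - t) (approx≡ K)) factor′) ⟩
    ∣ δ * Σ< n diff ∣
      ≡⟨ trans (∣p*q∣≡∣p∣*∣q∣ δ (Σ< n diff)) (cong (_* ∣ Σ< n diff ∣) (0≤p⇒∣p∣≡p 0≤δ)) ⟩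
    δ * ∣ Σ< n diff ∣
      ≤⟨ *-monoˡ δ 0≤δ (≤-trans (∣Σ<∣≤ n diff) (Σ<-mono n (λ i _ → term i))) ⟩
    moment (2 ℕ.* K) ∎
    where
    open ≤-Reasoning
    t : ℕ → ℚ
    t i = point (suc i)
    f g diff : ℕ → ℚ
    f i = arctan′ (t i)
    g i = geometric (t i * t i) K
    diff i = f i - g i
    negate : ∀ j → Σ< j diff ≡ Σ< j f - Σ< j g
    negate zero = refl
    negate (suc j) = trans (cong (_+ diff j) (negate j)) (lemma (Σ< j f) (Σ< j g) (f j) (g j))
      where
      lemma : ∀ a b c e → a - b + (c - e) ≡ a + c - (b + e)
      lemma = solve-∀ ℚ-ring
    factor′ : quarterπ m - δ * Σ< n g ≡ δ * Σ< n diff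
    factor′ = trans (lemma δ (Σ< n f) (Σ< n g)) (cong (δ *_) (sym (negate n)))
      where
      lemma : ∀ d a b → d * a - d * b ≡ d * (a - b)
      lemma = solve-∀ ℚ-ring
    term : ∀ i → ∣ diff i ∣ ≤ pow (t i) (2 ℕ.* K)
    term i = ≤-trans (∣inv-geometric∣≤ K (0≤* (0≤point (suc i)) (0≤point (suc i))))
      (≤-reflexive (pow-square (t i) K))

  ∣approx-A∣≤ : ∀ K → ∣ approx K - A K ∣ ≤ ℕ→ℚ K * δ
  ∣approx-A∣≤ zero = ≤-reflexive (sym (*-zeroˡ δ))
  ∣approx-A∣≤ (suc K) = begin
    ∣ approx (suc K) - A (suc K) ∣
      ≡⟨ cong ∣_∣ (lemma (approx K) (A K) (sg K) (moment (2 ℕ.* K)) (recip (odd K))) ⟩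
    ∣ approx K - A K + sg K * (moment (2 ℕ.* K) - recip (odd K)) ∣
      ≤⟨ ∣p+q∣≤∣p∣+∣q∣ (approx K - A K) (sg K * (moment (2 ℕ.* K) - recip (odd K))) ⟩
    ∣ approx K - A K ∣ + ∣ sg K * (moment (2 ℕ.* K) - recip (odd K)) ∣
      ≤⟨ +-mono-≤ (∣approx-A∣≤ K) term ⟩
    ℕ→ℚ K * δ + δ
      ≡⟨ trans (lemma₂ (ℕ→ℚ K) δ) (cong (_* δ) (sym (ℕ→ℚ-suc K))) ⟩
    ℕ→ℚ (suc K) * δ ∎
    where
    open ≤-Reasoning
    lemma : ∀ p a s x y → p + s * x - (a + s * y) ≡ p - a + s * (x - y)
    lemma = solve-∀ ℚ-ring
    lemma₂ : ∀ k d → k * d + d ≡ (1ℚ + k) * d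
    lemma₂ = solve-∀ ℚ-ring
    lemma₃ : ∀ x y d → d - (x - y) ≡ 1ℚ * (y + d - x)
    lemma₃ = solve-∀ ℚ-ring
    term : ∣ sg K * (moment (2 ℕ.* K) - recip (odd K)) ∣ ≤ δ
    term = ≤-trans (≤-reflexive (trans (∣p*q∣≡∣p∣*∣q∣ (sg K) (moment (2 ℕ.* K) - recip (odd K)))
        (trans (cong (_* ∣ moment (2 ℕ.* K) - recip (odd K) ∣) (∣sg∣ K))
          (trans (*-identityˡ _) (0≤p⇒∣p∣≡p (p≤q⇒0≤q-p (≤moment (2 ℕ.* K))))))))
      (≤-comb₁ 1ℚ (<⇒≤ 0<1) (moment≤ (2 ℕ.* K)) (lemma₃ (moment (2 ℕ.* K)) (recip (odd K)) δ))

  -- Truncating the geometric series costs moment 2K, that is 1/(2K + 1) plus a step; each of the K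
  -- moments kept is off by at most another step. Hence K + 1 steps in all, small once m is large
  -- against K.
  ∣quarterπ-A∣≤ : ∀ K → ∣ quarterπ m - A K ∣ ≤ recip (odd K) + ℕ→ℚ (suc K) * recip n
  ∣quarterπ-A∣≤ K = begin
    ∣ quarterπ m - A K ∣
      ≡⟨ cong ∣_∣ (lemma (quarterπ m) (approx K) (A K)) ⟩
    ∣ quarterπ m - approx K + (approx K - A K) ∣
      ≤⟨ ∣p+q∣≤∣p∣+∣q∣ (quarterπ m - approx K) (approx K - A K) ⟩
    ∣ quarterπ m - approx K ∣ + ∣ approx K - A K ∣
      ≤⟨ +-mono-≤ (≤-trans (∣quarterπ-approx∣≤ K) (moment≤ (2 ℕ.* K))) (∣approx-A∣≤ K) ⟩
    recip (odd K) + δ + ℕ→ℚ K * δ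
      ≡⟨ trans (lemma₂ (recip (odd K)) (ℕ→ℚ K) δ) (cong₂ (λ s t → recip (odd K) + s * t) (sym (ℕ→ℚ-suc K)) δ≡) ⟩
    recip (odd K) + ℕ→ℚ (suc K) * recip n ∎
    where
    open ≤-Reasoning
    lemma : ∀ r p a → r - a ≡ r - p + (p - a)
    lemma = solve-∀ ℚ-ring
    lemma₂ : ∀ x k d → x + d + k * d ≡ x + (1ℚ + k) * d
    lemma₂ = solve-∀ ℚ-ring

-- ζ(2) = π²/6

arctan′≤1 : ∀ t → arctan′ t ≤ 1ℚ
arctan′≤1 t = inv-anti {1ℚ} 0<1 (≤-by (t * t) (0≤square t) refl)

quarterπ≤1 : ∀ m → quarterπ m ≤ 1ℚ
quarterπ≤1 m = begin
  δ * Σ< n (λ k → arctan′ (point (suc k)))  ≤⟨ *-monoˡ δ 0≤δ (Σ<-mono n (λ k _ → arctan′≤1 (point (suc k)))) ⟩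
  δ * Σ< n (λ _ → 1ℚ)                       ≡⟨ cong (δ *_) (trans (Σ<-const n 1ℚ) (*-identityʳ (ℕ→ℚ n))) ⟩
  δ * ℕ→ℚ n                                 ≡⟨ trans (*-comm δ (ℕ→ℚ n)) nδ≡1 ⟩
  1ℚ                                        ∎
  where
  open UnitInterval m
  open ≤-Reasoning

½≤quarterπ : ∀ m → ½ ≤ quarterπ m
½≤quarterπ m = subst (λ t → ½ ≤ quarterπ t) (ℕP.+-identityʳ m) (R≤refined 0 m)
  where open Riemann 0ℚ 1ℚ arctan′ (<⇒≤ 0<1) arctan′-anti using (R≤refined)

square-close : ∀ {r a ρ} → 0ℚ ≤ r → r ≤ 1ℚ → 0ℚ ≤ ρ → ρ ≤ 1ℚ → ∣ r - a ∣ ≤ ρ + ρ →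
  ∣ r * r - a * a ∣ ≤ ℕ→ℚ 8 * ρ
square-close {r} {a} {ρ} 0≤r r≤1 0≤ρ ρ≤1 close = begin
  ∣ r * r - a * a ∣         ≡⟨ trans (cong ∣_∣ (lemma r a)) (∣p*q∣≡∣p∣*∣q∣ (r - a) (r + a)) ⟩
  ∣ r - a ∣ * ∣ r + a ∣     ≤⟨ *-mono-≤-≤ (0≤∣p∣ (r - a)) close (0≤∣p∣ (r + a)) sum≤ ⟩
  (ρ + ρ) * ℕ→ℚ 4           ≡⟨ lemma₁ ρ ⟩
  ℕ→ℚ 8 * ρ                 ∎
  where
  open ≤-Reasoning
  lemma : ∀ r a → r * r - a * a ≡ (r - a) * (r + a)
  lemma = solve-∀ ℚ-ring
  lemma₁ : ∀ ρ → (ρ + ρ) * ℕ→ℚ 4 ≡ ℕ→ℚ 8 * ρ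
  lemma₁ = solve-∀ ℚ-ring
  ρρ≤2 : ρ + ρ ≤ ℕ→ℚ 2
  ρρ≤2 = +-mono-≤ ρ≤1 ρ≤1
  2r≤2 : r + r ≤ ℕ→ℚ 2
  2r≤2 = +-mono-≤ r≤1 r≤1
  lemma₂ : ∀ r a → r + a ≡ r + r + (- (r - a))
  lemma₂ = solve-∀ ℚ-ring
  sum≤ : ∣ r + a ∣ ≤ ℕ→ℚ 4
  sum≤ = begin
    ∣ r + a ∣                     ≡⟨ cong ∣_∣ (lemma₂ r a) ⟩
    ∣ r + r + (- (r - a)) ∣       ≤⟨ ∣p+q∣≤∣p∣+∣q∣ (r + r) (- (r - a)) ⟩
    ∣ r + r ∣ + ∣ - (r - a) ∣     ≡⟨ cong₂ _+_ (0≤p⇒∣p∣≡p (0≤+ 0≤r 0≤r)) (∣-p∣≡∣p∣ (r - a)) ⟩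
    r + r + ∣ r - a ∣             ≤⟨ +-mono-≤ 2r≤2 (≤-trans close ρρ≤2) ⟩
    ℕ→ℚ 4                         ∎

-- The chain is π² = 16R² ≈ 16A² ≈ 8B ≈ 6Z, with errors 8ρ in R², 6ρ in 2A² and ρ in B: 16 · 8 + 8 ·
-- 6 + 8 = 184. The condition on m makes (G + 1)/(m + 1) at most 1/K.
π²-bounds : ∀ {K m} → 1 ℕ.≤ K → K ℕ.* suc (K ℕ.* K) ℕ.≤ suc m → let G = K ℕ.* K in
  seq (π *ᴿ π) m ≤ ℕ→ℚ 6 * Z G + ℕ→ℚ 184 * recip K ×
  ℕ→ℚ 6 * Z G ≤ seq (π *ᴿ π) m + ℕ→ℚ 184 * recip K
π²-bounds {K} {m} 1≤K large =
    ≤-comb₃ (ℕ→ℚ 16) (ℕ→ℚ 8) (ℕ→ℚ 8) (0≤ℕ→ℚ 16) (0≤ℕ→ℚ 8) (0≤ℕ→ℚ 8)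
      (proj₁ R²~A²) (proj₁ 2A²~B) B≤
      (lemma₁ (quarterπ m) (A G) (B G) (Z G) ρ)
  , ≤-comb₃ (ℕ→ℚ 16) (ℕ→ℚ 8) (ℕ→ℚ 8) (0≤ℕ→ℚ 16) (0≤ℕ→ℚ 8) (0≤ℕ→ℚ 8)
      (proj₂ R²~A²) (proj₂ 2A²~B) (≤-trans (¾Z≤B G) (≤-by ρ 0≤ρ refl))
      (lemma₂ (quarterπ m) (A G) (B G) (Z G) ρ)
  where
  G = K ℕ.* K
  ρ = recip K
  0≤ρ : 0ℚ ≤ ρ
  0≤ρ = 0≤recip K
  K≤G : K ℕ.≤ G
  K≤G = ℕP.m≤m*n K K {{ℕ.>-nonZero 1≤K}}
  close : ∣ quarterπ m - A G ∣ ≤ ρ + ρ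
  close = ≤-trans (UnitInterval.∣quarterπ-A∣≤ m G) (+-mono-≤
    (recip-anti 1≤K (ℕP.≤-trans K≤G (ℕP.m≤n⇒m≤1+n (ℕP.m≤m+n G (G ℕ.+ 0)))))
    (≤-trans (*-monoˡ (ℕ→ℚ (suc G)) (0≤ℕ→ℚ (suc G)) (recip-anti (ℕP.*-mono-≤ 1≤K (ℕP.0<1+n {G})) large))
      (≤-reflexive (n*recip[m*n] K {suc G} ℕP.0<1+n))))
  R²~A² = ≤∣-∣ {quarterπ m * quarterπ m} {A G * A G}
    (square-close (≤-trans (<⇒≤ (positive⁻¹ ½)) (½≤quarterπ m)) (quarterπ≤1 m) 0≤ρ (recip≤1 K) close)
  lemma₀ : ∀ k x r → ℕ→ℚ 6 * r - x ≡ r * (ℕ→ℚ 6 - k * x) + x * (k * r - 1ℚ)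
  lemma₀ = solve-∀ ℚ-ring
  2A²~B = ≤∣-∣ {ℕ→ℚ 2 * (A G * A G)} {B G} (≤-comb₂ ρ x 0≤ρ (0≤∣p∣ (ℕ→ℚ 2 * (A G * A G) - B G)) (∣2A²-B∣≤ 1≤K)
      (≤-reflexive (sym (recip-inverse 1≤K))) (lemma₀ (ℕ→ℚ K) x ρ))
    where x = ∣ ℕ→ℚ 2 * (A G * A G) - B G ∣
  B≤ : B G + ¼ * Z G ≤ Z G + ρ
  B≤ = ≤-trans (B≤¾Z {G} (ℕP.*-mono-≤ 1≤K 1≤K)) (+-monoʳ-≤ (Z G) (recip-anti 1≤K K≤G))
  lemma₁ : ∀ R A B Z ρ → ℕ→ℚ 6 * Z + ℕ→ℚ 184 * ρ - ℕ→ℚ 4 * R * (ℕ→ℚ 4 * R) ≡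
    ℕ→ℚ 16 * (A * A + ℕ→ℚ 8 * ρ - R * R) + ℕ→ℚ 8 * (B + ℕ→ℚ 6 * ρ - ℕ→ℚ 2 * (A * A)) +
    ℕ→ℚ 8 * (Z + ρ - (B + ¼ * Z))
  lemma₁ = solve-∀ ℚ-ring
  lemma₂ : ∀ R A B Z ρ → ℕ→ℚ 4 * R * (ℕ→ℚ 4 * R) + ℕ→ℚ 184 * ρ - ℕ→ℚ 6 * Z ≡
    ℕ→ℚ 16 * (R * R + ℕ→ℚ 8 * ρ - A * A) + ℕ→ℚ 8 * (ℕ→ℚ 2 * (A * A) + ℕ→ℚ 6 * ρ - B) +
    ℕ→ℚ 8 * (B + ¼ * Z + ρ - Z)
  lemma₂ = solve-∀ ℚ-ring

-- Logarithm and harmonic numbers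

module LogBounds (p : ℕ) where

  N : ℕ
  N = 2 ℕ.+ p

  inv-antitone : AntitoneOn 1ℚ (ℕ→ℚ N) inv
  inv-antitone x y 1≤x x≤y _ = inv-anti (<-≤-trans 0<1 1≤x) x≤y

  open Riemann 1ℚ (ℕ→ℚ N) inv (1≤suc (suc p)) inv-antitone

  N-1≡ : ℕ→ℚ N - 1ℚ ≡ ℕ→ℚ (suc p)
  N-1≡ = trans (cong (_- 1ℚ) (ℕ→ℚ-suc (suc p))) (lemma (ℕ→ℚ (suc p)))
    where
    lemma : ∀ a → 1ℚ + a - 1ℚ ≡ a
    lemma = solve-∀ ℚ-ring

  step≡1 : step 1ℚ (ℕ→ℚ N) p ≡ 1ℚ
  step≡1 = trans (cong (_* recip (suc p)) N-1≡) (recip-inverse {suc p} ℕP.0<1+n)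

  -- Division number p cuts [1, N] into unit steps, so its right sum is 1/2 + ... + 1/N.
  R≡ : R p + 1ℚ ≡ h N
  R≡ = begin
    step 1ℚ (ℕ→ℚ N) p * Σ< (suc p) (λ k → inv (1ℚ + ℕ→ℚ (suc k) * step 1ℚ (ℕ→ℚ N) p)) + 1ℚ
      ≡⟨ cong (λ t → t * Σ< (suc p) (λ k → inv (1ℚ + ℕ→ℚ (suc k) * t)) + 1ℚ) step≡1 ⟩
    1ℚ * Σ< (suc p) (λ k → inv (1ℚ + ℕ→ℚ (suc k) * 1ℚ)) + 1ℚ
      ≡⟨ cong (_+ 1ℚ) (trans (*-identityˡ _) (Σ<-cong (suc p) (λ k →
          cong inv (trans (cong (1ℚ +_) (*-identityʳ (ℕ→ℚ (suc k)))) (sym (ℕ→ℚ-suc (suc k))))))) ⟩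
    Σ< (suc p) (λ k → recip (2 ℕ.+ k)) + 1ℚ
      ≡⟨ +-comm (Σ< (suc p) (λ k → recip (2 ℕ.+ k))) 1ℚ ⟩
    0ℚ + 1ℚ + Σ< (suc p) (λ k → recip (2 ℕ.+ k))
      ≡⟨ Σ<-+ 1 (suc p) (λ j → recip (suc j)) ⟨
    Σ< (suc (suc p)) (λ j → recip (suc j))
      ≡⟨ Σ<-recip N ⟩
    h N ∎
    where open ≡-Reasoning

  drop≤ : drop ≤ ℕ→ℚ (suc p)
  drop≤ = begin
    (ℕ→ℚ N - 1ℚ) * (inv 1ℚ - recip N)  ≡⟨ cong (_* (1ℚ - recip N)) N-1≡ ⟩
    ℕ→ℚ (suc p) * (1ℚ - recip N)       ≤⟨ *-monoˡ (ℕ→ℚ (suc p)) (0≤ℕ→ℚ (suc p)) (≤-comb₁ 1ℚ (<⇒≤ 0<1) (0≤recip N) (lemma (recip N))) ⟩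
    ℕ→ℚ (suc p) * 1ℚ                   ≡⟨ *-identityʳ (ℕ→ℚ (suc p)) ⟩
    ℕ→ℚ (suc p)                        ∎
    where
    open ≤-Reasoning
    lemma : ∀ r → 1ℚ - (1ℚ - r) ≡ 1ℚ * (r - 0ℚ)
    lemma = solve-∀ ℚ-ring

  drop*recip≤1 : ∀ {m} → p ℕ.≤ m → drop * recip (suc m) ≤ 1ℚ
  drop*recip≤1 {m} p≤m = begin
    drop * recip (suc m)          ≤⟨ *-monoʳ (recip (suc m)) (0≤recip (suc m)) drop≤ ⟩
    ℕ→ℚ (suc p) * recip (suc m)   ≤⟨ *-monoˡ (ℕ→ℚ (suc p)) (0≤ℕ→ℚ (suc p)) (recip-anti {suc p} ℕP.0<1+n (ℕ.s≤s p≤m)) ⟩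
    ℕ→ℚ (suc p) * recip (suc p)   ≡⟨ recip-inverse {suc p} ℕP.0<1+n ⟩
    1ℚ                            ∎
    where open ≤-Reasoning

  -- Sums p and m have a common refinement, and refining sum m gains at most drop/(m + 1), which is
  -- at most 1 for m ≥ p. The second unit is the first term of h N, missing from R p.
  ≤log : ∀ {m} → p ℕ.≤ m → h N ≤ seq (log N) m + ℕ→ℚ 2
  ≤log {m} p≤m = begin
    h N                                     ≡⟨ R≡ ⟨
    R p + 1ℚ                                ≤⟨ +-monoˡ-≤ 1ℚ (R≤refined p m) ⟩
    R (refine p m) + 1ℚ                     ≡⟨ cong (λ t → R t + 1ℚ) (refine-comm p m) ⟩
    R (refine m p) + 1ℚ                     ≤⟨ +-monoˡ-≤ 1ℚ (≤-trans (refined≤R m p) (+-monoʳ-≤ (R m) (drop*recip≤1 p≤m))) ⟩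
    R m + 1ℚ + 1ℚ                           ≡⟨ +-assoc (R m) 1ℚ 1ℚ ⟩
    R m + ℕ→ℚ 2                             ∎
    where open ≤-Reasoning

  log≤ : ∀ m → seq (log N) m ≤ h N
  log≤ m = begin
    R m                                     ≤⟨ R≤refined m p ⟩
    R (refine m p)                          ≡⟨ cong R (refine-comm m p) ⟩
    R (refine p m)                          ≤⟨ refined≤R p m ⟩
    R p + drop * recip (suc p)              ≤⟨ +-monoʳ-≤ (R p) (drop*recip≤1 ℕP.≤-refl) ⟩
    R p + 1ℚ                                ≡⟨ R≡ ⟩
    h N                                     ∎
    where open ≤-Reasoning

-- Asymptotics

h-scaled : ∀ M {N} → 1 ℕ.≤ M → 1 ℕ.≤ N → h (M ℕ.* N) ≤ h N + h M
h-scaled (suc M) {N} _ 1≤N = ≤-trans (h-*≤ M 1≤N) (+-monoʳ-≤ (h N) (h-mono (ℕP.n≤1+n M)))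

-- The upper half of the Tauberian argument: since P is monotone,
-- F(G²N) = Σ_g P(G²N/g²)/g² is at least Z(G) P(N).
T*Z≤ : ∀ {G N} → let H = h (G ℕ.* G ℕ.* N) in
  ℕ→ℚ (T N) * Z G ≤ ℕ→ℚ N * ((H + 1ℚ) * (H + 1ℚ))
T*Z≤ {G} {N} = begin
  ℕ→ℚ (T N) * Z G                              ≤⟨ *-monoʳ (Z G) (0≤Z G) (T≤ N) ⟩
  ℕ→ℚ 2 * (ℕ→ℚ N * P N) * Z G                  ≡⟨ lemma (ℕ→ℚ N) (P N) (Z G) ⟩
  ℕ→ℚ N * (ℕ→ℚ 2 * (Z G * P N))                ≤⟨ *-monoˡ (ℕ→ℚ N) (0≤ℕ→ℚ N) (*-monoˡ (ℕ→ℚ 2) (0≤ℕ→ℚ 2) (Z*P≤F G N)) ⟩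
  ℕ→ℚ N * (ℕ→ℚ 2 * F M)                        ≤⟨ *-monoˡ (ℕ→ℚ N) (0≤ℕ→ℚ N)
    (≤-comb₂ 1ℚ 1ℚ (<⇒≤ 0<1) (<⇒≤ 0<1) (F≤ M) (0≤+ (0≤Z M) (<⇒≤ 0<1)) (lemma′ (F M) (h M) (Z M))) ⟩
  ℕ→ℚ N * ((h M + 1ℚ) * (h M + 1ℚ))            ∎
  where
  open ≤-Reasoning
  M = G ℕ.* G ℕ.* N
  lemma : ∀ n p z → ℕ→ℚ 2 * (n * p) * z ≡ n * (ℕ→ℚ 2 * (z * p))
  lemma = solve-∀ ℚ-ring
  lemma′ : ∀ f h z → (h + 1ℚ) * (h + 1ℚ) - ℕ→ℚ 2 * f ≡
    1ℚ * (h * h + ℕ→ℚ 2 * h - (ℕ→ℚ 2 * f + z)) + 1ℚ * (z + 1ℚ - 0ℚ)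
  lemma′ = solve-∀ ℚ-ring

-- F N ≤ Z N · P N, and Z N ≤ Z G + 1/G = W. The constant is 20 = 6 · 3 + 2: W ≤ 3 multiplies the
-- error of `≤T`, and Z N ≤ 2 ≤ 2h N.
≤T*Z : ∀ {G N} → 1 ℕ.≤ G → 1 ℕ.≤ N →
  ℕ→ℚ N * (h N * h N) ≤ ℕ→ℚ (T N) * (Z G + recip G) + ℕ→ℚ N * (ℕ→ℚ 20 * h N)
≤T*Z {G} {N} 1≤G 1≤N = begin
  n * (h N * h N)
    ≤⟨ *-monoˡ n (0≤ℕ→ℚ N) (≤-trans (≤F N) (+-mono-≤ (*-monoˡ (ℕ→ℚ 2) (0≤ℕ→ℚ 2) F≤WP) Z≤2h)) ⟩
  n * (ℕ→ℚ 2 * (W * P N) + ℕ→ℚ 2 * h N)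
    ≡⟨ lemma n W (P N) (h N) ⟩
  W * (ℕ→ℚ 2 * (n * P N)) + ℕ→ℚ 2 * (n * h N)
    ≤⟨ +-monoˡ-≤ (ℕ→ℚ 2 * (n * h N)) (*-monoˡ W 0≤W (≤T N)) ⟩
  W * (ℕ→ℚ (T N) + ℕ→ℚ 6 * (n * h N)) + ℕ→ℚ 2 * (n * h N)
    ≤⟨ ≤-comb₁ (ℕ→ℚ 6 * (n * h N)) (0≤* (0≤ℕ→ℚ 6) (0≤* (0≤ℕ→ℚ N) (0≤h N))) W≤3
        (lemma′ n W (h N) (ℕ→ℚ (T N))) ⟩
  ℕ→ℚ (T N) * W + n * (ℕ→ℚ 20 * h N) ∎
  where
  open ≤-Reasoning
  n = ℕ→ℚ N
  W = Z G + recip G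
  0≤P : 0ℚ ≤ P N
  0≤P = 0≤∑ (coprimePairs N) 0≤weight
  0≤W : 0ℚ ≤ W
  0≤W = 0≤+ (0≤Z G) (0≤recip G)
  W≤3 : W ≤ ℕ→ℚ 3
  W≤3 = +-mono-≤ (Z≤2 G) (recip≤1 G)
  F≤WP : F N ≤ W * P N
  F≤WP = ≤-trans (F≤Z*P N) (*-monoʳ (P N) 0≤P (Z≤ N 1≤G))
  Z≤2h : Z N ≤ ℕ→ℚ 2 * h N
  Z≤2h = ≤-trans (Z≤2 N) (≤-trans (≤-reflexive (sym (*-identityʳ (ℕ→ℚ 2)))) (*-monoˡ (ℕ→ℚ 2) (0≤ℕ→ℚ 2) (1≤h 1≤N)))
  lemma : ∀ n w p h → n * (ℕ→ℚ 2 * (w * p) + ℕ→ℚ 2 * h) ≡ w * (ℕ→ℚ 2 * (n * p)) + ℕ→ℚ 2 * (n * h)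
  lemma = solve-∀ ℚ-ring
  lemma′ : ∀ n w h t → t * w + n * (ℕ→ℚ 20 * h) - (w * (t + ℕ→ℚ 6 * (n * h)) + ℕ→ℚ 2 * (n * h)) ≡
    ℕ→ℚ 6 * (n * h) * (ℕ→ℚ 3 - w)
  lemma′ = solve-∀ ℚ-ring

-- With p ≈ π², z = Z(G) and L ≈ log N up to a relative error θ, the main
-- term is compared with p T without dividing.
upper-comparison : ∀ {p t z n L H ρ θ} → 0ℚ ≤ t → 0ℚ ≤ n → 0ℚ ≤ H → 0ℚ ≤ L → 0ℚ ≤ θ → θ ≤ 1ℚ → 1ℚ ≤ z → 0ℚ ≤ ρ →
  ℕ→ℚ 32 * ρ ≤ θ → p ≤ ℕ→ℚ 6 * z + ℕ→ℚ 184 * ρ → t * z ≤ n * ((H + 1ℚ) * (H + 1ℚ)) →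
  H + 1ℚ ≤ L * (1ℚ + θ) → p * t ≤ (1ℚ + ℕ→ℚ 7 * θ) * (ℕ→ℚ 6 * (n * (L * L)))
upper-comparison {p} {t} {z} {n} {L} {H} {ρ} {θ} 0≤t 0≤n 0≤H 0≤L 0≤θ θ≤1 1≤z 0≤ρ 32ρ≤θ p≤ tz≤ H≤ = begin
  p * t                                               ≤⟨ *-monoʳ t 0≤t (≤-trans p≤ p≤′) ⟩
  ℕ→ℚ 6 * (1ℚ + θ) * z * t                            ≡⟨ lemma₁ θ z t ⟩
  ℕ→ℚ 6 * (1ℚ + θ) * (t * z)                          ≤⟨ *-monoˡ (ℕ→ℚ 6 * (1ℚ + θ)) 0≤6[1+θ] (≤-trans tz≤
    (*-monoˡ n 0≤n (*-mono-≤-≤ 0≤H+1 H≤ 0≤H+1 H≤))) ⟩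
  ℕ→ℚ 6 * (1ℚ + θ) * (n * (L * (1ℚ + θ) * (L * (1ℚ + θ)))) ≡⟨ lemma₂ θ n L ⟩
  (1ℚ + θ) * (1ℚ + θ) * (1ℚ + θ) * (ℕ→ℚ 6 * (n * (L * L))) ≤⟨ *-monoʳ (ℕ→ℚ 6 * (n * (L * L)))
    (0≤* (0≤ℕ→ℚ 6) (0≤* 0≤n (0≤* 0≤L 0≤L)))
    cube≤ ⟩
  (1ℚ + ℕ→ℚ 7 * θ) * (ℕ→ℚ 6 * (n * (L * L)))           ∎
  where
  open ≤-Reasoning
  0≤H+1 : 0ℚ ≤ H + 1ℚ
  0≤H+1 = 0≤+ 0≤H (<⇒≤ 0<1)
  0≤6[1+θ] : 0ℚ ≤ ℕ→ℚ 6 * (1ℚ + θ)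
  0≤6[1+θ] = 0≤* (0≤ℕ→ℚ 6) (0≤+ (<⇒≤ 0<1) 0≤θ)
  lemma₁ : ∀ θ z t → ℕ→ℚ 6 * (1ℚ + θ) * z * t ≡ ℕ→ℚ 6 * (1ℚ + θ) * (t * z)
  lemma₁ = solve-∀ ℚ-ring
  lemma₂ : ∀ θ n L → ℕ→ℚ 6 * (1ℚ + θ) * (n * (L * (1ℚ + θ) * (L * (1ℚ + θ)))) ≡ (1ℚ + θ) * (1ℚ + θ) * (1ℚ + θ) * (ℕ→ℚ 6 * (n * (L * L)))
  lemma₂ = solve-∀ ℚ-ring
  lemma₃ : ∀ θ → 1ℚ + ℕ→ℚ 7 * θ - (1ℚ + θ) * (1ℚ + θ) * (1ℚ + θ) ≡ θ * θ * (1ℚ - θ) + ℕ→ℚ 4 * θ * (1ℚ - θ)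
  lemma₃ = solve-∀ ℚ-ring
  -- One factor 1 + θ comes from p against 6z, two from H + 1 against L.
  cube≤ : (1ℚ + θ) * (1ℚ + θ) * (1ℚ + θ) ≤ 1ℚ + ℕ→ℚ 7 * θ
  cube≤ = ≤-comb₂ (θ * θ) (ℕ→ℚ 4 * θ) (0≤* 0≤θ 0≤θ) (0≤* (0≤ℕ→ℚ 4) 0≤θ) θ≤1 θ≤1 (lemma₃ θ)
  lemma₄ : ∀ θ z ρ → ℕ→ℚ 6 * (1ℚ + θ) * z - (ℕ→ℚ 6 * z + ℕ→ℚ 184 * ρ) ≡
    ℕ→ℚ 6 * θ * (z - 1ℚ) + ℕ→ℚ 6 * (θ - ℕ→ℚ 32 * ρ) + ℕ→ℚ 8 * (ρ - 0ℚ)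
  lemma₄ = solve-∀ ℚ-ring
  p≤′ : ℕ→ℚ 6 * z + ℕ→ℚ 184 * ρ ≤ ℕ→ℚ 6 * (1ℚ + θ) * z
  p≤′ = ≤-comb₃ (ℕ→ℚ 6 * θ) (ℕ→ℚ 6) (ℕ→ℚ 8) (0≤* (0≤ℕ→ℚ 6) 0≤θ) (0≤ℕ→ℚ 6) (0≤ℕ→ℚ 8) 1≤z 32ρ≤θ 0≤ρ (lemma₄ θ z ρ)

-- Only two factors 1 - θ arise, one from p against 6(z + r) and one from the error 20η; the 7 is
-- kept to match the upper bound.
lower-comparison : ∀ {p t z r n L η ρ θ} → 0ℚ ≤ t → 0ℚ ≤ n → 0ℚ ≤ L → 0ℚ ≤ θ → θ ≤ 1ℚ → 1ℚ ≤ z → 0ℚ ≤ r → r ≤ ρ →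
  ℕ→ℚ 32 * ρ ≤ θ → ℕ→ℚ 6 * z ≤ p + ℕ→ℚ 184 * ρ → n * (η * η) ≤ t * (z + r) + n * (ℕ→ℚ 20 * η) →
  L ≤ η → ℕ→ℚ 20 ≤ θ * L → (1ℚ - ℕ→ℚ 7 * θ) * (ℕ→ℚ 6 * (n * (L * L))) ≤ p * t
lower-comparison {p} {t} {z} {r} {n} {L} {η} {ρ} {θ} 0≤t 0≤n 0≤L 0≤θ θ≤1 1≤z 0≤r r≤ρ 32ρ≤θ ≤p ≤tz L≤η 20≤θL = begin
  (1ℚ - ℕ→ℚ 7 * θ) * (ℕ→ℚ 6 * (n * (L * L)))            ≤⟨ *-monoʳ (ℕ→ℚ 6 * (n * (L * L)))
    (0≤* (0≤ℕ→ℚ 6) (0≤* 0≤n (0≤* 0≤L 0≤L)))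
    ≤square ⟩
  (1ℚ - θ) * (1ℚ - θ) * (ℕ→ℚ 6 * (n * (L * L)))         ≡⟨ lemma₂ θ n L ⟩
  ℕ→ℚ 6 * (1ℚ - θ) * (n * (L * L * (1ℚ - θ)))           ≤⟨ *-monoˡ (ℕ→ℚ 6 * (1ℚ - θ)) 0≤6[1-θ] tw≥ ⟩
  ℕ→ℚ 6 * (1ℚ - θ) * (t * (z + r))                      ≡⟨ lemma₁ θ (z + r) t ⟩
  ℕ→ℚ 6 * (1ℚ - θ) * (z + r) * t                        ≤⟨ *-monoʳ t 0≤t p≥ ⟩
  p * t                                                 ∎
  where
  open ≤-Reasoning
  0≤1-θ : 0ℚ ≤ 1ℚ - θ
  0≤1-θ = p≤q⇒0≤q-p θ≤1
  0≤6[1-θ] : 0ℚ ≤ ℕ→ℚ 6 * (1ℚ - θ)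
  0≤6[1-θ] = 0≤* (0≤ℕ→ℚ 6) 0≤1-θ
  lemma₁ : ∀ θ w t → ℕ→ℚ 6 * (1ℚ - θ) * (t * w) ≡ ℕ→ℚ 6 * (1ℚ - θ) * w * t
  lemma₁ = solve-∀ ℚ-ring
  lemma₂ : ∀ θ n L → (1ℚ - θ) * (1ℚ - θ) * (ℕ→ℚ 6 * (n * (L * L))) ≡ ℕ→ℚ 6 * (1ℚ - θ) * (n * (L * L * (1ℚ - θ)))
  lemma₂ = solve-∀ ℚ-ring
  lemma₃ : ∀ θ → (1ℚ - θ) * (1ℚ - θ) - (1ℚ - ℕ→ℚ 7 * θ) ≡ ℕ→ℚ 5 * (θ - 0ℚ) + θ * (θ - 0ℚ)
  lemma₃ = solve-∀ ℚ-ring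
  ≤square : 1ℚ - ℕ→ℚ 7 * θ ≤ (1ℚ - θ) * (1ℚ - θ)
  ≤square = ≤-comb₂ (ℕ→ℚ 5) θ (0≤ℕ→ℚ 5) 0≤θ 0≤θ 0≤θ (lemma₃ θ)
  20≤L : ℕ→ℚ 20 ≤ L
  20≤L = ≤-comb₂ 1ℚ L (<⇒≤ 0<1) 0≤L 20≤θL θ≤1 (lemma θ L)
    where
    lemma : ∀ θ L → L - ℕ→ℚ 20 ≡ 1ℚ * (θ * L - ℕ→ℚ 20) + L * (1ℚ - θ)
    lemma = solve-∀ ℚ-ring
  lemma₄ : ∀ L η θ → η * η - ℕ→ℚ 20 * η - L * L * (1ℚ - θ) ≡
    (η + (L - ℕ→ℚ 20)) * (η - L) + L * (θ * L - ℕ→ℚ 20)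
  lemma₄ = solve-∀ ℚ-ring
  -- η(η - 20) ≥ L(L - 20), since η ≥ L ≥ 20, and L(L - 20) ≥ L²(1 - θ) because 20 ≤ θL.
  square≥ : L * L * (1ℚ - θ) ≤ η * η - ℕ→ℚ 20 * η
  square≥ = ≤-comb₂ (η + (L - ℕ→ℚ 20)) L (0≤+ (≤-trans 0≤L L≤η) (p≤q⇒0≤q-p 20≤L)) 0≤L L≤η 20≤θL (lemma₄ L η θ)
  lemma₅ : ∀ n η t w L θ → t * w - n * (L * L * (1ℚ - θ)) ≡
    1ℚ * (t * w + n * (ℕ→ℚ 20 * η) - n * (η * η)) + n * (η * η - ℕ→ℚ 20 * η - L * L * (1ℚ - θ))
  lemma₅ = solve-∀ ℚ-ring
  tw≥ : n * (L * L * (1ℚ - θ)) ≤ t * (z + r)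
  tw≥ = ≤-comb₂ 1ℚ n (<⇒≤ 0<1) 0≤n ≤tz square≥ (lemma₅ n η t (z + r) L θ)
  lemma₆ : ∀ p z r ρ θ → p - ℕ→ℚ 6 * (1ℚ - θ) * (z + r) ≡
    1ℚ * (p + ℕ→ℚ 184 * ρ - ℕ→ℚ 6 * z) + ℕ→ℚ 6 * θ * (z + r - 1ℚ) +
    1ℚ * (ℕ→ℚ 6 * (θ - ℕ→ℚ 32 * ρ) + ℕ→ℚ 6 * (ρ - r) + ℕ→ℚ 2 * ρ - 0ℚ)
  lemma₆ = solve-∀ ℚ-ring
  0≤ρ : 0ℚ ≤ ρ
  0≤ρ = ≤-trans 0≤r r≤ρ
  -- The errors 184ρ from π² and 6r ≤ 6ρ add up to 190ρ, within 6 · 32ρ; this is the origin of the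
  -- 32 in θ.
  p≥ : ℕ→ℚ 6 * (1ℚ - θ) * (z + r) ≤ p
  p≥ = ≤-comb₃ 1ℚ (ℕ→ℚ 6 * θ) 1ℚ (<⇒≤ 0<1) (0≤* (0≤ℕ→ℚ 6) 0≤θ) (<⇒≤ 0<1) ≤p
    (≤-trans 1≤z (≤-by r 0≤r refl))
    (0≤+ (0≤+ (0≤* (0≤ℕ→ℚ 6) (p≤q⇒0≤q-p 32ρ≤θ)) (0≤* (0≤ℕ→ℚ 6) (p≤q⇒0≤q-p r≤ρ))) (0≤* (0≤ℕ→ℚ 2) 0≤ρ))
    (lemma₆ p z r ρ θ)

ratio-close : ∀ {t g η} → 0ℚ < g → t ≤ (1ℚ + η) * g → (1ℚ - η) * g ≤ t → ∣ t * inv g - 1ℚ ∣ ≤ η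
ratio-close {t} {g} {η} 0<g t≤ ≤t = ∣p∣≤
  (≤-comb₁ 1ℚ (<⇒≤ 0<1) (subst (t * i ≤_) (divide (1ℚ + η)) (*-monoʳ i 0≤i t≤)) (lemma (t * i) η))
  (≤-comb₁ 1ℚ (<⇒≤ 0<1) (subst (_≤ t * i) (divide (1ℚ - η)) (*-monoʳ i 0≤i ≤t)) (lemma′ (t * i) η))
  where
  i = inv g
  0≤i : 0ℚ ≤ i
  0≤i = <⇒≤ (0<inv 0<g)
  divide : ∀ x → x * g * i ≡ x
  divide x = trans (*-assoc x g i) (trans (cong (x *_) (inverseʳ 0<g)) (*-identityʳ x))
  lemma : ∀ q η → η - (q - 1ℚ) ≡ 1ℚ * (1ℚ + η - q)
  lemma = solve-∀ ℚ-ring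
  lemma′ : ∀ q η → η - (- (q - 1ℚ)) ≡ 1ℚ * (q - (1ℚ - η))
  lemma′ = solve-∀ ℚ-ring

h≤log+2 : ∀ {N} → 2 ℕ.≤ N → ∀ {m} → N ℕ.≤ m → h N ≤ seq (log N) m + ℕ→ℚ 2
h≤log+2 {suc (suc p)} _ N≤m = LogBounds.≤log p (ℕP.≤-trans (ℕP.m≤n+m p 2) N≤m)
h≤log+2 {suc zero} (ℕ.s≤s ())

log≤h : ∀ {N} → 2 ℕ.≤ N → ∀ m → seq (log N) m ≤ h N
log≤h {suc (suc p)} _ = LogBounds.log≤ p
log≤h {suc zero} (ℕ.s≤s ())

mainTerm : ℕ → ℝ
mainTerm N = (ℕ→ℝ 6 ÷ᴿ π *ᴿ π [ π²-nonZero ]) *ᴿ ℕ→ℝ N *ᴿ (log N *ᴿ log N)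

0<π² : ∀ m → 0ℚ < seq (π *ᴿ π) m
0<π² m = 0<* 0<π 0<π
  where
  0<π : 0ℚ < seq π m
  0<π = 0<* (0<suc 3) (<-≤-trans (positive⁻¹ ½) (½≤quarterπ m))

π²≤16 : ∀ m → seq (π *ᴿ π) m ≤ ℕ→ℚ 16
π²≤16 m = *-mono-≤-≤ 0≤π π≤4 0≤π π≤4
  where
  0≤π : 0ℚ ≤ seq π m
  0≤π = 0≤* (0≤ℕ→ℚ 4) (≤-trans (<⇒≤ (positive⁻¹ ½)) (½≤quarterπ m))
  π≤4 : seq π m ≤ ℕ→ℚ 4
  π≤4 = *-monoˡ (ℕ→ℚ 4) (0≤ℕ→ℚ 4) (quarterπ≤1 m)

h-unbounded : ∀ c → ∃ λ N₀ → ∀ N → N₀ ℕ.≤ N → 2 ℕ.≤ N × ℕ→ℚ c ≤ h N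
h-unbounded c = 4 ^ suc c , λ N N₀≤N →
    ℕP.≤-trans (ℕP.≤-trans (ℕ.s≤s (ℕ.s≤s ℕ.z≤n)) (ℕP.m≤m*n 4 (4 ^ c) {{ℕ.>-nonZero (ℕP.m^n>0 4 c)}})) N₀≤N
  , ≤-trans (ℕ→ℚ-mono (ℕP.n≤1+n c)) (≤-trans (4^≤h (suc c)) (h-mono N₀≤N))

-- Choice of parameters and passage to the limit

module Comparison (K : ℕ) (1≤K : 1 ℕ.≤ K) (θ≤1 : ℕ→ℚ 32 * recip K ≤ 1ℚ) where

  G : ℕ
  G = K ℕ.* K

  1≤G : 1 ℕ.≤ G
  1≤G = ℕP.*-mono-≤ 1≤K 1≤K

  -- Λ ≤ θL has to cover the 20 of the lower bound and, for the upper one, H + 1 - L ≤ 3 + G², where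
  -- h(G²) is crudely bounded by G².
  ρ θ Λ : ℚ
  ρ = recip K
  θ = ℕ→ℚ 32 * ρ
  Λ = ℕ→ℚ 23 + ℕ→ℚ (G ℕ.* G)

  0≤ρ : 0ℚ ≤ ρ
  0≤ρ = 0≤recip K

  0≤θ : 0ℚ ≤ θ
  0≤θ = 0≤* (0≤ℕ→ℚ 32) 0≤ρ

  module At (N : ℕ) (2≤N : 2 ℕ.≤ N) (KΛ≤h : ℕ→ℚ 2 + ℕ→ℚ K * Λ ≤ h N) where

    1≤N : 1 ℕ.≤ N
    1≤N = ℕP.<⇒≤ 2≤N

    -- Index from which the Riemann sums serve: N for the lower bound on log N, K(G + 1) for π².
    threshold : ℕ
    threshold = N ℕ.⊔ K ℕ.* suc G

    module _ {m : ℕ} (large : threshold ℕ.≤ m) where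

      L p g H : ℚ
      L = seq (log N) m
      p = seq (π *ᴿ π) m
      g = seq (mainTerm N) m
      H = h (G ℕ.* G ℕ.* N)

      h≤L+2 : h N ≤ L + ℕ→ℚ 2
      h≤L+2 = h≤log+2 2≤N (ℕP.m⊔n≤o⇒m≤o N (K ℕ.* suc G) large)

      KΛ≤L : ℕ→ℚ K * Λ ≤ L
      KΛ≤L = ≤-comb₂ 1ℚ 1ℚ (<⇒≤ 0<1) (<⇒≤ 0<1) KΛ≤h h≤L+2 (lemma L (ℕ→ℚ K * Λ) (h N))
        where
        lemma : ∀ L x h → L - x ≡ 1ℚ * (h - (ℕ→ℚ 2 + x)) + 1ℚ * (L + ℕ→ℚ 2 - h)
        lemma = solve-∀ ℚ-ring

      1≤L : 1ℚ ≤ L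
      1≤L = ≤-trans (*-mono-≤-≤ {1ℚ} {ℕ→ℚ K} {1ℚ} (<⇒≤ 0<1) (ℕ→ℚ-mono 1≤K) (<⇒≤ 0<1)
        (+-mono-≤ (1≤suc 22) (0≤ℕ→ℚ (G ℕ.* G)))) KΛ≤L

      0≤L : 0ℚ ≤ L
      0≤L = ≤-trans (<⇒≤ 0<1) 1≤L

      0≤Λ : 0ℚ ≤ Λ
      0≤Λ = 0≤+ (0≤ℕ→ℚ 23) (0≤ℕ→ℚ (G ℕ.* G))

      Λ≤θL : Λ ≤ θ * L
      Λ≤θL = ≤-comb₃ ρ Λ (ℕ→ℚ 31 * ρ) 0≤ρ 0≤Λ (0≤* (0≤ℕ→ℚ 31) 0≤ρ)
        KΛ≤L (≤-reflexive (sym (recip-inverse 1≤K))) 0≤L (lemma ρ L (ℕ→ℚ K) Λ)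
        where
        lemma : ∀ ρ L K y → ℕ→ℚ 32 * ρ * L - y ≡ ρ * (L - K * y) + y * (K * ρ - 1ℚ) + ℕ→ℚ 31 * ρ * (L - 0ℚ)
        lemma = solve-∀ ℚ-ring

      20≤θL : ℕ→ℚ 20 ≤ θ * L
      20≤θL = ≤-trans (≤-by (ℕ→ℚ 3 + ℕ→ℚ (G ℕ.* G)) (0≤+ (0≤ℕ→ℚ 3) (0≤ℕ→ℚ (G ℕ.* G))) (lemma (ℕ→ℚ (G ℕ.* G)))) Λ≤θL
        where
        lemma : ∀ x → ℕ→ℚ 23 + x ≡ ℕ→ℚ 20 + (ℕ→ℚ 3 + x)
        lemma = solve-∀ ℚ-ring

      H+1≤ : H + 1ℚ ≤ L * (1ℚ + θ)
      H+1≤ = begin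
        H + 1ℚ                              ≤⟨ +-monoˡ-≤ 1ℚ (h-scaled (G ℕ.* G) (ℕP.*-mono-≤ 1≤G 1≤G) 1≤N) ⟩
        h N + h (G ℕ.* G) + 1ℚ              ≤⟨ +-monoˡ-≤ 1ℚ (+-mono-≤ h≤L+2 (h≤n (G ℕ.* G))) ⟩
        L + ℕ→ℚ 2 + ℕ→ℚ (G ℕ.* G) + 1ℚ      ≤⟨ ≤-comb₂ 1ℚ 1ℚ (<⇒≤ 0<1) (<⇒≤ 0<1) Λ≤θL (0≤ℕ→ℚ 20)
          (lemma L θ (ℕ→ℚ (G ℕ.* G))) ⟩
        L * (1ℚ + θ)                        ∎
        where
        open ≤-Reasoning
        lemma : ∀ L θ x → L * (1ℚ + θ) - (L + ℕ→ℚ 2 + x + 1ℚ) ≡ 1ℚ * (θ * L - (ℕ→ℚ 23 + x)) + 1ℚ * (ℕ→ℚ 20 - 0ℚ)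
        lemma = solve-∀ ℚ-ring

      0<p : 0ℚ < p
      0<p = 0<π² m

      n : ℚ
      n = ℕ→ℚ N

      gp≡ : p * g ≡ ℕ→ℚ 6 * (n * (L * L))
      gp≡ = ≡-comb₁ (ℕ→ℚ 6 * (n * (L * L))) (inverseʳ 0<p) (lemma p (inv p) n L)
        where
        lemma : ∀ p i n L → p * (ℕ→ℚ 6 * i * n * (L * L)) - ℕ→ℚ 6 * (n * (L * L)) ≡ ℕ→ℚ 6 * (n * (L * L)) * (p * i - 1ℚ)
        lemma = solve-∀ ℚ-ring

      -- A lower bound uniform in m is what apartness from 0 requires: π² ≤ 16, while 6, N and L are
      -- at least 1.
      recip16≤g : recip 16 ≤ g
      recip16≤g = begin
        recip 16                               ≤⟨ inv-anti 0<p (π²≤16 m) ⟩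
        inv p                                  ≡⟨ *-identityʳ (inv p) ⟨
        inv p * (1ℚ * (1ℚ * (1ℚ * 1ℚ)))        ≤⟨ *-monoˡ (inv p) (<⇒≤ (0<inv 0<p))
          (*-mono-≤-≤ 0≤1ℚ (1≤suc 5) 0≤1ℚ (*-mono-≤-≤ 0≤1ℚ (ℕ→ℚ-mono 1≤N) 0≤1ℚ (*-mono-≤-≤ 0≤1ℚ 1≤L 0≤1ℚ 1≤L))) ⟩
        inv p * (ℕ→ℚ 6 * (n * (L * L)))        ≡⟨ lemma (inv p) n L ⟩
        g                                      ∎
        where
        open ≤-Reasoning
        0≤1ℚ : 0ℚ ≤ 1ℚ
        0≤1ℚ = <⇒≤ 0<1
        lemma : ∀ i n L → i * (ℕ→ℚ 6 * (n * (L * L))) ≡ ℕ→ℚ 6 * i * n * (L * L)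
        lemma = solve-∀ ℚ-ring

      0<g : 0ℚ < g
      0<g = <-≤-trans (0<recip {16} ℕP.0<1+n) recip16≤g

      t : ℚ
      t = ℕ→ℚ (T N)

      close : ∣ t * inv g - 1ℚ ∣ ≤ ℕ→ℚ 7 * θ
      close = ratio-close {t} {g} {ℕ→ℚ 7 * θ} 0<g
        (*-cancelˡ p {t} {(1ℚ + ℕ→ℚ 7 * θ) * g} 0<p (subst (p * t ≤_) (move (1ℚ + ℕ→ℚ 7 * θ))
          (upper-comparison {p} {t} {Z G} {n} {L} {H} {ρ} {θ} (0≤ℕ→ℚ (T N)) (0≤ℕ→ℚ N) (0≤h (G ℕ.* G ℕ.* N)) 0≤L 0≤θ θ≤1 (1≤Z 1≤G) 0≤ρ ≤-refl
            (proj₁ π²) (T*Z≤ {G} {N}) H+1≤)))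
        (*-cancelˡ p {(1ℚ - ℕ→ℚ 7 * θ) * g} {t} 0<p (subst (_≤ p * t) (move (1ℚ - ℕ→ℚ 7 * θ))
          (lower-comparison {p} {t} {Z G} {recip G} {n} {L} {h N} {ρ} {θ} (0≤ℕ→ℚ (T N)) (0≤ℕ→ℚ N) 0≤L 0≤θ θ≤1 (1≤Z 1≤G) (0≤recip G) (recip-anti 1≤K (ℕP.m≤m*n K K {{ℕ.>-nonZero 1≤K}}))
            ≤-refl (proj₂ π²) (≤T*Z 1≤G 1≤N) (log≤h 2≤N m) 20≤θL)))
        where
        π² = π²-bounds {K} {m} 1≤K (ℕP.m≤n⇒m≤1+n (ℕP.m⊔n≤o⇒n≤o N (K ℕ.* suc G) large))
        swap : ∀ x p g → x * (p * g) ≡ p * (x * g)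
        swap = solve-∀ ℚ-ring
        move : ∀ x → x * (ℕ→ℚ 6 * (n * (L * L))) ≡ p * (x * g)
        move x = trans (cong (x *_) (sym gp≡)) (swap x p g)

    mainTerm-nonZero : NonZeroᴿ (mainTerm N)
    mainTerm-nonZero = recip 16 , 0<recip {16} ℕP.0<1+n , threshold , λ m large →
      ≤-trans (≤-reflexive (+-identityˡ (recip 16))) (≤-trans (recip16≤g large) (p≤∣p∣ (g large)))

    ratio : ℝ
    ratio = ℕ→ℝ (T N) ÷ᴿ mainTerm N [ mainTerm-nonZero ]

    -- Half of δ bounds the distance of the ratio from 1; the other half is the gap that `_<ᴿ_`
    -- demands.
    limit : ∀ {δ} ε → 0ℚ < δ → ℕ→ℚ 7 * θ ≤ ½ * δ →
      (∃ λ M → ∀ m → M ℕ.≤ m → 0ℚ + δ ≤ seq ε m) → ∣ ratio -ᴿ 1ℝ ∣ᴿ <ᴿ ε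
    limit {δ} ε 0<δ 7θ≤ (M , far) = ½ * δ , 0<* (positive⁻¹ ½) 0<δ , threshold ℕ.⊔ M , λ m u →
      ≤-trans (+-monoˡ-≤ (½ * δ) (≤-trans (close (ℕP.m⊔n≤o⇒m≤o threshold M u)) 7θ≤))
        (≤-trans (≤-reflexive (halves δ)) (far m (ℕP.m⊔n≤o⇒n≤o threshold M u)))
      where
      halves : ∀ δ → ½ * δ + ½ * δ ≡ 0ℚ + δ
      halves = solve-∀ ℚ-ring

small-recip : ∀ δ → 0ℚ < δ → ∃ λ K → 1 ℕ.≤ K × ℕ→ℚ 32 * recip K ≤ 1ℚ × ℕ→ℚ 7 * (ℕ→ℚ 32 * recip K) ≤ ½ * δ
small-recip δ 0<δ = choose (archimedean (ℕ→ℚ 448) δ 0<δ)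
  where
  lemma : ∀ δ ρ → ½ * δ - ℕ→ℚ 7 * (ℕ→ℚ 32 * ρ) ≡ ½ * (δ - ℕ→ℚ 448 * ρ)
  lemma = solve-∀ ℚ-ring
  choose : (∃ λ M → ∀ n → M ℕ.≤ n → ℕ→ℚ 448 * recip (suc n) < δ) →
    ∃ λ K → 1 ℕ.≤ K × ℕ→ℚ 32 * recip K ≤ 1ℚ × ℕ→ℚ 7 * (ℕ→ℚ 32 * recip K) ≤ ½ * δ
  -- K ≥ 32 gives θ ≤ 1, and 448 = 2 · 7 · 32 gives 7θ ≤ δ/2.
  choose (M , small) = suc (M ℕ.⊔ 31) , ℕP.0<1+n
    , subst (ℕ→ℚ 32 * recip (suc (M ℕ.⊔ 31)) ≤_) (recip-inverse {32} ℕP.0<1+n)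
        (*-monoˡ (ℕ→ℚ 32) (0≤ℕ→ℚ 32) (recip-anti {32} ℕP.0<1+n (ℕ.s≤s (ℕP.m≤n⊔m M 31))))
    , ≤-comb₁ ½ (<⇒≤ (positive⁻¹ ½)) (<⇒≤ (small (M ℕ.⊔ 31) (ℕP.m≤m⊔n M 31))) (lemma δ (recip (suc (M ℕ.⊔ 31))))

h-threshold : ∀ K x → ∃ λ N₀ → ∀ N → N₀ ℕ.≤ N →
  2 ℕ.≤ N × ℕ→ℚ 2 + ℕ→ℚ K * (ℕ→ℚ 23 + ℕ→ℚ x) ≤ h N
h-threshold K x = proj₁ bound , λ N N₀≤N →
  proj₁ (proj₂ bound N N₀≤N) , subst (_≤ h N) expand (proj₂ (proj₂ bound N N₀≤N))
  where
  bound = h-unbounded (2 ℕ.+ K ℕ.* (23 ℕ.+ x))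
  expand : ℕ→ℚ (2 ℕ.+ K ℕ.* (23 ℕ.+ x)) ≡ ℕ→ℚ 2 + ℕ→ℚ K * (ℕ→ℚ 23 + ℕ→ℚ x)
  expand = trans (ℕ→ℚ-+ 2 (K ℕ.* (23 ℕ.+ x))) (cong (ℕ→ℚ 2 +_)
    (trans (ℕ→ℚ-* K (23 ℕ.+ x)) (cong (ℕ→ℚ K *_) (ℕ→ℚ-+ 23 x))))

T∼mainTerm : (λ N → ℕ→ℝ (T N)) ∼ mainTerm
T∼mainTerm ε (δ , 0<δ , far) = choose (small-recip δ 0<δ)
  where
  choose : (∃ λ K → 1 ℕ.≤ K × ℕ→ℚ 32 * recip K ≤ 1ℚ × ℕ→ℚ 7 * (ℕ→ℚ 32 * recip K) ≤ ½ * δ) →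
    ∃ λ N₀ → ∀ N → N₀ ℕ.≤ N →
      Σ (NonZeroᴿ (mainTerm N)) λ g≠0 → ∣ (ℕ→ℝ (T N) ÷ᴿ mainTerm N [ g≠0 ]) -ᴿ 1ℝ ∣ᴿ <ᴿ ε
  choose (K , 1≤K , θ≤1 , 7θ≤) = proj₁ bound , λ N N₀≤N →
      At.mainTerm-nonZero N (proj₁ (proj₂ bound N N₀≤N)) (proj₂ (proj₂ bound N N₀≤N))
    , At.limit N (proj₁ (proj₂ bound N N₀≤N)) (proj₂ (proj₂ bound N N₀≤N)) ε 0<δ 7θ≤ far
    where
    open Comparison K 1≤K θ≤1
    bound = h-threshold K (G ℕ.* G)

theorem1 : (λ N → ℕ→ℝ (sum₂ N (λ n → d (n ^ 2 ∸ 1))))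
    ∼ (λ N → (ℕ→ℝ 6 ÷ᴿ π *ᴿ π [ π²-nonZero ]) *ᴿ ℕ→ℝ N *ᴿ (log N *ᴿ log N))
theorem1 = T∼mainTerm
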